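{- Let $n\ge0$ and let $\{\lambda,\underline{m}\}=\{\lambda_1,\ldots,\lambda_p,\underline{m}\}$ be a pointed knapsack partition of $n$, and let $F$ be the filter of $I_n^{\bullet}$ generated by $\{\lambda,\underline m\}$. Then $$\mu\left(\Pi_n^{\bullet}(F)\cup\{\hat0\}\right)=(-1)^{p-1}\sum_{\vec c\in V}\beta(\vec c),$$ that is, $(-1)^{p-1}$ times the number of permutations in $\mathfrak S_n$ whose descent composition belongs to $V$.
   Context: A pointed integer partition of $n$ is a pair $\{\lambda,\underline{m}\}=\{\lambda_1,\ldots,\lambda_k,\underline{m}\}$ with $m\ge0$ an integer (the pointed part) and $\lambda$ an integer partition (multiset of positive integers) of $n-m$. $I_n^{\bullet}$ is the set of these, ordered by the cover relations $\{\ldots,\lambda_{k-1},\lambda_k,\underline{m}\}\prec\{\ldots,\lambda_{k-1}+\lambda_k,\underline{m}\}$ and $\{\ldots,\lambda_{k-1},\lambda_k,\underline{m}\}\prec\{\ldots,\lambda_{k-1},\underline{\lambda_k+m}\}$. The filter generated by $x$ is $\{y:y\ge x\}$. A pointed set partition of $\{1,\ldots,n\}$ is a pair $(\sigma,Z)$ with $Z\subseteq\{1,\ldots,n\}$ (zero block, possibly empty) and $\sigma$ a set partition of the complement of $Z$. $\Pi_n^{\bullet}$ is the poset of these under refinement (every block of $\pi$ lies in a block, possibly the zero block, of $\pi'$, and the zero block of $\pi$ lies in the zero block of $\pi'$). Its type is $\{\{|B|:B\in\sigma\},\underline{|Z|}\}$, and $\Pi_n^{\bullet}(F)=\{\pi:\mathrm{type}(\pi)\in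 F\}$. $\Pi_n^{\bullet}(F)\cup\{\hat0\}$ is this poset with a new minimum adjoined; its maximum $\hat1$ is the pointed partition with zero block $\{1,\ldots,n\}$, and $\mu(P)=\mu_P(\hat0,\hat1)$. A pointed composition of $n$ is a list $\vec c=(c_1,\ldots,c_{k-1},\underline{c_k})$ of non-negative integers summing to $n$ with $c_1,\ldots,c_{k-1}>0$, $c_k\ge0$; $C_n^\bullet$ is ordered by adding adjacent entries; type$(\vec c)=\{c_1,\ldots,c_{k-1},\underline{c_k}\}$ and $C_n^{\bullet}(F)=\{\vec c:\mathrm{type}(\vec c)\in F\}$. For a pointed composition $\vec c=(c_1,\ldots,c_{k-1},\underline{c_k})$ of $n$: if $c_k>0$, $\beta(\vec c)$ is the number of permutations in $\mathfrak S_n$ with descent set exactly $\{c_1,c_1+c_2,\ldots,c_1+\cdots+c_{k-1}\}$ (equivalently with descent composition $(c_1,\ldots,c_k)$); if $k\ge2$ and $c_k=0$, $\beta(\vec c)=0$; $\beta((\underline0))=1$. A multiset $\lambda=\{e_1^{m_1},\ldots,e_q^{m_q}\}$ of positive integers (distinct $e_i$) is a knapsack partition if every sum of a multi-subset of $\lambda$ has a unique representation as such a sum (equivalently, there are exactly $\prod(m_i+1)$ distinct multi-subset sums). $\{\lambda,\underline m\}$ is a pointed knapsack partition if $\lambda$ is a knapsack partition. $V$ is the set of pointed compositions $\vec c=(c_1,\ldots,c_{k-1},\underline{m})$ in $C_n^{\bullet}(F)$ (pointed part exactly $m$) such that for each $i\le k-1$ the unique multi-subset of $\lambda$ summing to $c_i$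 has distinct elements. -}

module Defs where

open import Data.Nat as ℕ using (ℕ; zero; suc; _+_; _∸_; _⊔_; _≡ᵇ_; _<ᵇ_)
open import Data.Bool using (Bool; true; false; _∧_; _∨_; not; if_then_else_)
open import Data.List using (List; []; _∷_; map; filterᵇ; concatMap; replicate;
  applyUpTo; upTo; length; zip; foldr)
open import Data.Bool.ListAction using (all; any)
open import Data.Nat.ListAction using (sum)
open import Data.List.Relation.Binary.Sublist.Propositional using (_⊆_)
open import Data.List.Relation.Binary.Permutation.Propositional using (_↭_)
open import Data.Maybe using (Maybe; just; nothing)
open import Data.Product using (_×_; _,_)
open import Data.Integer as ℤ using (ℤ; +_)
open import Relation.Binary.PropositionalEquality using (_≡_)

_≡ᴸ_ : List ℕ → List ℕ → Bool
[] ≡ᴸ [] = true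
(x ∷ xs) ≡ᴸ (y ∷ ys) = (x ≡ᵇ y) ∧ (xs ≡ᴸ ys)
_ ≡ᴸ _ = false

insert : ℕ → List ℕ → List ℕ
insert x [] = x ∷ []
insert x (y ∷ ys) = if y <ᵇ x then y ∷ insert x ys else x ∷ y ∷ ys

sort : List ℕ → List ℕ
sort = foldr insert []

occ : ℕ → List ℕ → ℕ
occ l xs = length (filterᵇ (λ a → a ≡ᵇ l) xs)

distinctᵇ : List ℕ → Bool
distinctᵇ [] = true
distinctᵇ (x ∷ xs) = not (any (λ y → x ≡ᵇ y) xs) ∧ distinctᵇ xs

picks : {A : Set} → List A → List (A × List A)
picks [] = []
picks (x ∷ xs) = (x , xs) ∷ map (λ { (y , ys) → (y , x ∷ ys) }) (picks xs)

subs : List ℕ → List (List ℕ)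
subs [] = [] ∷ []
subs (x ∷ xs) = subs xs Data.List.++ map (x ∷_) (subs xs)

sumℤ : List ℤ → ℤ
sumℤ = foldr ℤ._+_ (+ 0)

-- Pointed integer partitions  {λ, m̲}  represented as (list of parts , m).
-- Two representations denote the same pointed partition iff the parts
-- agree as multisets and the pointed parts agree.

PIP : Set
PIP = List ℕ × ℕ

_≡ᴾ_ : PIP → PIP → Bool
(a , m) ≡ᴾ (b , m') = (sort a ≡ᴸ sort b) ∧ (m ≡ᵇ m')

covers : PIP → List PIP
covers (ps , m) =
  concatMap (λ { (x , r) → map (λ { (y , r') → ((x + y) ∷ r' , m) }) (picks r) }) (picks ps)
  Data.List.++ map (λ { (x , r) → (r , m + x) }) (picks ps)

-- reach f x y : y is obtained from x by at most f cover steps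
-- (each cover step decreases the number of parts by one, so f = #parts of x
--  gives exactly the order relation x ≤ y of I_n^•)
reach : ℕ → PIP → PIP → Bool
reach zero x y = x ≡ᴾ y
reach (suc f) x y = (x ≡ᴾ y) ∨ any (λ z → reach f z y) (covers x)

_≤ᴵ_ : PIP → PIP → Bool
(ps , m) ≤ᴵ y = reach (length ps) (ps , m) y

inFilter : PIP → PIP → Bool
inFilter x y = x ≤ᴵ y

-- Pointed set partitions of {1,…,n}.
-- A pointed set partition (σ , Z) is encoded canonically by a word
-- w = w₁ … wₙ of naturals: wᵢ = 0 iff i ∈ Z, and the nonzero letters form a
-- restricted growth string (each nonzero letter is at most 1 + the maximum of
-- the letters before it), the blocks of σ being the fibres of the nonzero
-- letters.  This is a bijection with pointed set partitions.

rgs : ℕ → ℕ → List (List ℕ)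
rgs zero mx = [] ∷ []
rgs (suc k) mx = concatMap (λ a → map (a ∷_) (rgs k (a ⊔ mx))) (upTo (suc (suc mx)))

allPSP : ℕ → List (List ℕ)
allPSP n = rgs n 0

maxL : List ℕ → ℕ
maxL = foldr _⊔_ 0

typeP : List ℕ → PIP
typeP w = (map (λ l → occ l w) (applyUpTo suc (maxL w)) , occ 0 w)

-- refinement order: π ≤ π' iff the zero block of π lies in that of π',
-- and any two elements in a common (nonzero) block of π lie in a common
-- block (possibly the zero block) of π'
refines : List ℕ → List ℕ → Bool
refines w w' =
  all (λ { (a , a') → not (a ≡ᵇ 0) ∨ (a' ≡ᵇ 0) }) ps
  ∧ all (λ { (a , a') → all (λ { (b , b') →
        not ((a ≡ᵇ b) ∧ not (a ≡ᵇ 0)) ∨ (a' ≡ᵇ b') }) ps }) ps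
  where ps = zip w w'

-- The poset Π_n^•(F) ∪ {0̂}: 'nothing' is the adjoined minimum 0̂.

ΠF0-elems : ℕ → PIP → List (Maybe (List ℕ))
ΠF0-elems n x = nothing ∷ map just (filterᵇ (λ w → inFilter x (typeP w)) (allPSP n))

ΠF0-leq : Maybe (List ℕ) → Maybe (List ℕ) → Bool
ΠF0-leq nothing _ = true
ΠF0-leq (just _) nothing = false
ΠF0-leq (just w) (just w') = refines w w'

ΠF0-eq : Maybe (List ℕ) → Maybe (List ℕ) → Bool
ΠF0-eq nothing nothing = true
ΠF0-eq (just w) (just w') = w ≡ᴸ w'
ΠF0-eq _ _ = false

ΠF0-top : ℕ → Maybe (List ℕ)
ΠF0-top n = just (replicate n 0)

-- Möbius function of a finite poset given by its list of (distinct)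
-- elements, its order and its equality, via the defining recursion
--   μ(x,x) = 1,  μ(x,y) = - Σ_{x ≤ z < y} μ(x,z)  (x < y),  μ(x,y) = 0 otherwise.
-- The fuel (number of elements) bounds the length of every chain.

module Mobius {A : Set} (leq eq : A → A → Bool) (elems : List A) where
  mobF : ℕ → A → A → ℤ
  mobF zero x y = if eq x y then + 1 else + 0
  mobF (suc f) x y =
    if eq x y then + 1
    else (if leq x y
          then ℤ.- sumℤ (map (mobF f x)
                 (filterᵇ (λ z → leq x z ∧ leq z y ∧ not (eq z y)) elems))
          else + 0)

  mob : A → A → ℤ
  mob = mobF (length elems)

μΠF : ℕ → PIP → ℤ
μΠF n x = Mobius.mob ΠF0-leq ΠF0-eq (ΠF0-elems n x) nothing (ΠF0-top n)

-- Permutations and descents.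
-- 𝔖_n is realised as the words of length n over {0,…,n-1} with distinct letters.

words : ℕ → ℕ → List (List ℕ)
words n zero = [] ∷ []
words n (suc k) = concatMap (λ a → map (a ∷_) (words n k)) (upTo n)

perms : ℕ → List (List ℕ)
perms n = filterᵇ distinctᵇ (words n n)

desFrom : ℕ → List ℕ → List ℕ
desFrom i (a ∷ b ∷ r) = if b <ᵇ a then i ∷ desFrom (suc i) (b ∷ r) else desFrom (suc i) (b ∷ r)
desFrom i _ = []

descents : List ℕ → List ℕ
descents = desFrom 1

psums : ℕ → List ℕ → List ℕ
psums acc [] = []
psums acc (c ∷ cs) = (acc + c) ∷ psums (acc + c) cs

-- Pointed compositions (c₁,…,c_{k-1}, c̲ₖ) are represented as (cs , cₖ)
-- with cs = (c₁,…,c_{k-1}) a list of positive integers.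

β : ℕ → List ℕ × ℕ → ℕ
β n ([] , zero) = 1
β n (_ ∷ _ , zero) = 0
β n (cs , suc k) = length (filterᵇ (λ w → descents w ≡ᴸ psums 0 cs) (perms n))

-- compositions of s into positive parts (fuel f ≥ s)
compsF : ℕ → ℕ → List (List ℕ)
compsF zero s = [] ∷ []
compsF (suc f) zero = [] ∷ []
compsF (suc f) (suc s) =
  concatMap (λ a → map (suc a ∷_) (compsF f (s ∸ a))) (upTo (suc s))

comps : ℕ → List (List ℕ)
comps s = compsF s s

-- Knapsack partitions: every multi-subset sum has a unique representation.
-- Multi-subsets of the multiset λ are the sublists of (any list for) λ,
-- considered up to permutation.

Knapsack : List ℕ → Set
Knapsack lam = ∀ (A B : List ℕ) → A ⊆ lam → B ⊆ lam → sum A ≡ sum B → A ↭ B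

-- "the unique multi-subset of λ summing to c has distinct elements"
-- (some multi-subset sums to c, and every one that does has distinct elements)
distinctRep : List ℕ → ℕ → Bool
distinctRep lam c =
  any (λ s → sum s ≡ᵇ c) (subs lam)
  ∧ all (λ s → not (sum s ≡ᵇ c) ∨ distinctᵇ s) (subs lam)

V : ℕ → List ℕ → ℕ → List (List ℕ × ℕ)
V n lam m =
  filterᵇ (λ c → inFilter (lam , m) c ∧ all (distinctRep lam) (Data.Product.proj₁ c))
    (map (λ cs → (cs , m)) (comps (n ∸ m)))

-- (-1)^(p-1)  (equal to -1 for p = 0)
signPm1 : ℕ → ℤ
signPm1 p = ℤ.- ((ℤ.- (+ 1)) ℤ.^ p)

-- By Möbius inversion from the top, μ(0̂,1̂) = -Σ μ(π,1̂) over π ∈ Π_n^•(F), and μ(π,1̂) = (-1)^k k! when π has k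
-- nonzero blocks, because a block opened while k others exist has k + 1 possible images.  The factor k! orders the
-- blocks, and an ordered pointed partition is a permutation with a bar at every descent, the blocks being listed
-- increasingly; hence μ(0̂,1̂) is minus the sum, over permutations w and pointed compositions c of type in F refining
-- the descent composition of w, of (-1)^(number of bars).
--
-- For a knapsack partition λ, such a c is a chain 0 = t₀ ⊏ t₁ ⊏ … of sums of sub-multisets of λ, where t ⊑ d means
-- that the multi-subset with sum t is contained in the one with sum d.  This poset is a product of chains, so its
-- Möbius function μ(t,d) is (-1)^|U| when the difference U is a set and 0 otherwise.  The signed sum over the chains
-- through the descents d₁ < … < d_r is therefore Π μ(d_{i-1},d_i), times 1 or 0 according as d_r is the top sum or not
-- (the chains may end anywhere above d_r).  It equals (-1)^p when the descent composition lies in V and 0 otherwise.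

module Submission where

open import Defs
open import Data.Nat as ℕ using (ℕ; zero; suc; _+_; _∸_; _⊔_; _≤_; _<_; z≤n; s≤s; _≡ᵇ_; _<ᵇ_; _≤ᵇ_; _!)
open import Data.Bool using (Bool; true; false; _∧_; _∨_; not; if_then_else_; T; T?)
open import Data.Bool.ListAction using (all; any)
open import Data.Empty using (⊥; ⊥-elim)
open import Data.Integer as ℤ using (ℤ; +_; _*_; 0ℤ; 1ℤ) renaming (_+_ to _+ᶻ_; -_ to -ᶻ_)
import Data.Integer.Properties as ℤₚ
open import Data.Integer.Tactic.RingSolver using (solve-∀)
open import Data.List using (List; []; _∷_; _++_; map; length; filterᵇ; concatMap; upTo; applyUpTo; replicate; zip; deduplicate; [_])
import Data.List.Properties as Listₚ
open import Data.List.Membership.DecPropositional ℕ._≟_ using (_∈?_)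
open import Data.List.Membership.Propositional using (_∈_; _∉_; find; lose)
open import Data.List.Membership.Propositional.Properties
  using (∈-∃++; ∈-++⁻; ∈-++⁺ˡ; ∈-++⁺ʳ; ∈-map⁺; ∈-map⁻; ∈-filter⁺; ∈-filter⁻; ∈-concatMap⁺; ∈-concatMap⁻; ∈-upTo⁺; ∈-upTo⁻;
    ∈-deduplicate⁺; ∈-deduplicate⁻)
open import Data.List.Relation.Binary.Permutation.Propositional as Perm using (_↭_; prep; swap; ↭-sym; ↭-refl; ↭-trans)
import Data.List.Relation.Binary.Permutation.Propositional.Properties as Permₚ
import Data.List.Relation.Binary.Permutation.Setoid.Properties as PermSetoidₚ
open import Data.List.Relation.Binary.Sublist.Propositional using (_⊆_; []; _∷_; _∷ʳ_)
open import Data.List.Relation.Unary.All as All using (All; []; _∷_)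
open import Data.List.Relation.Unary.AllPairs using ([]; _∷_)
open import Data.List.Relation.Unary.Any using (here; there)
open import Data.List.Relation.Unary.Unique.DecPropositional.Properties ℕ._≟_ using (deduplicate-!)
open import Data.List.Relation.Unary.Unique.Propositional using (Unique)
import Data.List.Relation.Unary.Unique.Propositional.Properties as Uniqueₚ
open import Data.Maybe using (Maybe; just; nothing)
open import Data.Maybe.Properties using (just-injective)
open import Data.Nat.ListAction using (sum)
open import Data.Nat.ListAction.Properties using (sum-++; sum-↭)
import Data.Nat.Properties as ℕₚ
open import Data.Product using (_×_; _,_; proj₁; proj₂; ∃-syntax)
open import Data.Sum using (_⊎_; inj₁; inj₂)
open import Data.Unit using (⊤; tt)
open import Function using (_∘_; id; case_of_)
open import Relation.Binary.Definitions using (tri<; tri≈; tri>)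
open import Relation.Binary.PropositionalEquality hiding ([_])
open import Relation.Nullary using (¬_; yes; no)

-- No bijection between ordered pointed partitions and barred permutations is built. Both sums obey
-- one recursion, `D`, for adding an element: among words the new element is appended as the last
-- letter, among permutations it is the largest letter, inserted in every position. Hence the
-- summation against an arbitrary `h` on types; `h` must be symmetric only on the side of words,
-- where the blocks carry no order and a factorial counts their orders. The order on types is given
-- by sequences of covers, which interact badly with set partitions. Colourings of the parts of λ
-- replace them: an order-free witness that serves both for the upward closure of the filter and for
-- the chains of sums. The sum over chains is evaluated while the word is read from left to right,
-- the Möbius identity of `⊑` being spent once per descent. The sign of a surviving product is
-- (-1)^p because the differences along a chain that ends at the top use up all of λ.

private
  variable
    A B : Set

-- Indicators, Boolean tests and finite sums of integers

𝟙 : Bool → ℤ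
𝟙 true = 1ℤ
𝟙 false = 0ℤ

∑ : {A : Set} → List A → (A → ℤ) → ℤ
∑ xs f = sumℤ (map f xs)

≡true⇒T : ∀ {b} → b ≡ true → T b
≡true⇒T refl = tt

T⇒≡true : ∀ {b} → T b → b ≡ true
T⇒≡true {true} _ = refl

¬true⇒false : ∀ {b} → ¬ (b ≡ true) → b ≡ false
¬true⇒false {true} h = ⊥-elim (h refl)
¬true⇒false {false} _ = refl

bool-ext : ∀ {a b} → (a ≡ true → b ≡ true) → (b ≡ true → a ≡ true) → a ≡ b
bool-ext {true} f g = sym (f refl)
bool-ext {false} {true} f g = sym (sym (g refl))
bool-ext {false} {false} f g = refl

∧-true⁻ : ∀ {a b} → a ∧ b ≡ true → a ≡ true × b ≡ true
∧-true⁻ {true} {true} _ = refl , refl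

∧-true⁺ : ∀ {a b} → a ≡ true → b ≡ true → a ∧ b ≡ true
∧-true⁺ refl refl = refl

∨-true⁻ : ∀ {a b} → a ∨ b ≡ true → a ≡ true ⊎ b ≡ true
∨-true⁻ {true} _ = inj₁ refl
∨-true⁻ {false} p = inj₂ p

∨-true⁺ˡ : ∀ {a b} → a ≡ true → a ∨ b ≡ true
∨-true⁺ˡ refl = refl

∨-true⁺ʳ : ∀ {a b} → b ≡ true → a ∨ b ≡ true
∨-true⁺ʳ {true} refl = refl
∨-true⁺ʳ {false} refl = refl

not-true⁻ : ∀ {a} → not a ≡ true → ¬ (a ≡ true)
not-true⁻ {true} () refl

not-true⁺ : ∀ {a} → ¬ (a ≡ true) → not a ≡ true
not-true⁺ {true} h = ⊥-elim (h refl)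
not-true⁺ {false} h = refl

≡ᵇ-true⁻ : ∀ {m n} → (m ≡ᵇ n) ≡ true → m ≡ n
≡ᵇ-true⁻ {m} {n} p = ℕₚ.≡ᵇ⇒≡ m n (≡true⇒T p)

≡ᵇ-refl : ∀ n → (n ≡ᵇ n) ≡ true
≡ᵇ-refl n = T⇒≡true (ℕₚ.≡⇒≡ᵇ n n refl)

≡ᵇ-true⁺ : ∀ {m n} → m ≡ n → (m ≡ᵇ n) ≡ true
≡ᵇ-true⁺ {m} refl = ≡ᵇ-refl m

≡ᵇ-false⁺ : ∀ {m n} → m ≢ n → (m ≡ᵇ n) ≡ false
≡ᵇ-false⁺ m≢n = ¬true⇒false (m≢n ∘ ≡ᵇ-true⁻)

<ᵇ-true⁻ : ∀ {m n} → (m <ᵇ n) ≡ true → m < n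
<ᵇ-true⁻ {m} {n} p = ℕₚ.<ᵇ⇒< m n (≡true⇒T p)

<ᵇ-true⁺ : ∀ {m n} → m < n → (m <ᵇ n) ≡ true
<ᵇ-true⁺ p = T⇒≡true (ℕₚ.<⇒<ᵇ p)

<ᵇ-false⁺ : ∀ {m n} → n ≤ m → (m <ᵇ n) ≡ false
<ᵇ-false⁺ n≤m = ¬true⇒false (ℕₚ.≤⇒≯ n≤m ∘ <ᵇ-true⁻)

module _ {A : Set} {p : A → Bool} where

  any-true⁻ : ∀ xs → any p xs ≡ true → ∃[ x ] x ∈ xs × p x ≡ true
  any-true⁻ (x ∷ xs) h with p x in eq
  ... | true = x , here refl , eq
  ... | false with y , y∈ , py ← any-true⁻ xs h = y , there y∈ , py

  any-true⁺ : ∀ {x xs} → x ∈ xs → p x ≡ true → any p xs ≡ true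
  any-true⁺ {x} (here refl) px rewrite px = refl
  any-true⁺ (there x∈) px = ∨-true⁺ʳ (any-true⁺ x∈ px)

  all-true⁻ : ∀ {x xs} → all p xs ≡ true → x ∈ xs → p x ≡ true
  all-true⁻ h (here refl) = proj₁ (∧-true⁻ h)
  all-true⁻ {xs = y ∷ _} h (there x∈) = all-true⁻ (proj₂ (∧-true⁻ {p y} h)) x∈

  all-true⁺ : ∀ xs → (∀ {x} → x ∈ xs → p x ≡ true) → all p xs ≡ true
  all-true⁺ [] h = refl
  all-true⁺ (x ∷ xs) h = ∧-true⁺ (h (here refl)) (all-true⁺ xs (h ∘ there))

∑-cong : ∀ (xs : List A) {f g : A → ℤ} → (∀ {x} → x ∈ xs → f x ≡ g x) → ∑ xs f ≡ ∑ xs g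
∑-cong [] h = refl
∑-cong (x ∷ xs) h = cong₂ _+ᶻ_ (h (here refl)) (∑-cong xs (h ∘ there))

∑-zero : ∀ (xs : List A) {f : A → ℤ} → (∀ {x} → x ∈ xs → f x ≡ 0ℤ) → ∑ xs f ≡ 0ℤ
∑-zero [] h = refl
∑-zero (x ∷ xs) h rewrite h (here refl) | ∑-zero xs (h ∘ there) = refl

∑-++ : ∀ (xs ys : List A) (f : A → ℤ) → ∑ (xs ++ ys) f ≡ ∑ xs f +ᶻ ∑ ys f
∑-++ [] ys f = sym (ℤₚ.+-identityˡ _)
∑-++ (x ∷ xs) ys f rewrite ∑-++ xs ys f = sym (ℤₚ.+-assoc (f x) _ _)

∑-map : ∀ (g : B → A) xs (f : A → ℤ) → ∑ (map g xs) f ≡ ∑ xs (f ∘ g)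
∑-map g xs f = cong sumℤ (sym (Listₚ.map-∘ xs))

∑-concatMap : ∀ (g : B → List A) xs (f : A → ℤ) → ∑ (concatMap g xs) f ≡ ∑ xs (λ x → ∑ (g x) f)
∑-concatMap g [] f = refl
∑-concatMap g (x ∷ xs) f = trans (∑-++ (g x) (concatMap g xs) f) (cong (∑ (g x) f +ᶻ_) (∑-concatMap g xs f))

∑-+ : ∀ xs (f g : A → ℤ) → ∑ xs (λ x → f x +ᶻ g x) ≡ ∑ xs f +ᶻ ∑ xs g
∑-+ [] f g = refl
∑-+ (x ∷ xs) f g rewrite ∑-+ xs f g = lemma (f x) (g x) (∑ xs f) (∑ xs g)
  where
  lemma : ∀ a b c d → (a +ᶻ b) +ᶻ (c +ᶻ d) ≡ (a +ᶻ c) +ᶻ (b +ᶻ d)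
  lemma = solve-∀

∑-*ˡ : ∀ c xs (f : A → ℤ) → ∑ xs (λ x → c * f x) ≡ c * ∑ xs f
∑-*ˡ c [] f = sym (ℤₚ.*-zeroʳ c)
∑-*ˡ c (x ∷ xs) f rewrite ∑-*ˡ c xs f = sym (ℤₚ.*-distribˡ-+ c (f x) _)

∑-swap : ∀ (xs : List A) (ys : List B) (f : A → B → ℤ) →
  ∑ xs (λ x → ∑ ys (f x)) ≡ ∑ ys (λ y → ∑ xs (λ x → f x y))
∑-swap [] ys f = sym (∑-zero ys (λ _ → refl))
∑-swap (x ∷ xs) ys f rewrite ∑-swap xs ys f = sym (∑-+ ys (f x) (λ y → ∑ xs (λ x → f x y)))

∑-filterᵇ : ∀ p xs (f : A → ℤ) → ∑ (filterᵇ p xs) f ≡ ∑ xs (λ x → 𝟙 (p x) * f x)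
∑-filterᵇ p [] f = refl
∑-filterᵇ p (x ∷ xs) f with p x
... | true = cong₂ _+ᶻ_ (sym (ℤₚ.*-identityˡ (f x))) (∑-filterᵇ p xs f)
... | false = trans (∑-filterᵇ p xs f) (sym (ℤₚ.+-identityˡ _))

∑-↭ : ∀ {xs ys} (f : A → ℤ) → xs ↭ ys → ∑ xs f ≡ ∑ ys f
∑-↭ f Perm.refl = refl
∑-↭ f (prep x p) = cong (f x +ᶻ_) (∑-↭ f p)
∑-↭ f (swap {ys = ys} x y p) = trans (cong (λ s → f x +ᶻ (f y +ᶻ s)) (∑-↭ f p)) (lemma (f x) (f y) (∑ ys f))
  where
  lemma : ∀ a b c → a +ᶻ (b +ᶻ c) ≡ b +ᶻ (a +ᶻ c)
  lemma = solve-∀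
∑-↭ f (Perm.trans p q) = trans (∑-↭ f p) (∑-↭ f q)

∑-single : ∀ {xs x} (f : A → ℤ) → Unique xs → x ∈ xs → (∀ {y} → y ∈ xs → y ≢ x → f y ≡ 0ℤ) → ∑ xs f ≡ f x
∑-single {xs = x ∷ xs} f (x∉ ∷ u) (here refl) h =
  trans (cong (f x +ᶻ_) (∑-zero xs (λ y∈ → h (there y∈) (λ y≡x → All.lookup x∉ y∈ (sym y≡x))))) (ℤₚ.+-identityʳ _)
∑-single {xs = x ∷ xs} f (x∉ ∷ u) (there z∈) h =
  trans (cong₂ _+ᶻ_ (h (here refl) (All.lookup x∉ z∈)) (∑-single f u z∈ (h ∘ there))) (ℤₚ.+-identityˡ _)

length-filterᵇ : ∀ (p : A → Bool) xs → + length (filterᵇ p xs) ≡ ∑ xs (𝟙 ∘ p)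
length-filterᵇ p [] = refl
length-filterᵇ p (x ∷ xs) with p x
... | true = cong (1ℤ +ᶻ_) (length-filterᵇ p xs)
... | false = trans (length-filterᵇ p xs) (sym (ℤₚ.+-identityˡ _))

sum-map : ∀ (f : A → ℕ) xs → + sum (map f xs) ≡ ∑ xs (λ x → + f x)
sum-map f [] = refl
sum-map f (x ∷ xs) = cong (+ f x +ᶻ_) (sum-map f xs)

∑-upTo-first : ∀ n (f : ℕ → ℤ) → ∑ (upTo (suc n)) f ≡ f 0 +ᶻ ∑ (upTo n) (f ∘ suc)
∑-upTo-first n f = cong (f 0 +ᶻ_) (trans (cong (λ xs → ∑ xs f) (sym (Listₚ.map-upTo suc n))) (∑-map suc (upTo n) f))

∑-upTo-last : ∀ n (f : ℕ → ℤ) → ∑ (upTo (suc n)) f ≡ ∑ (upTo n) f +ᶻ f n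
∑-upTo-last n f = trans (cong (λ xs → ∑ xs f) (sym (Listₚ.upTo-∷ʳ n)))
  (trans (∑-++ (upTo n) [ n ] f) (cong (∑ (upTo n) f +ᶻ_) (ℤₚ.+-identityʳ (f n))))

-- Möbius functions of finite posets

∈-filterᵇ⁻ : ∀ (p : A → Bool) {xs x} → x ∈ filterᵇ p xs → x ∈ xs × p x ≡ true
∈-filterᵇ⁻ p x∈ with x∈xs , px ← ∈-filter⁻ (T? ∘ p) x∈ = x∈xs , T⇒≡true px

count-≤ : ∀ (p q : A → Bool) xs → (∀ {x} → x ∈ xs → p x ≡ true → q x ≡ true) →
  length (filterᵇ p xs) ≤ length (filterᵇ q xs)
count-≤ p q [] h = z≤n
count-≤ p q (x ∷ xs) h with p x in px | q x in qx
... | false | false = count-≤ p q xs (h ∘ there)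
... | false | true = ℕₚ.m≤n⇒m≤1+n (count-≤ p q xs (h ∘ there))
... | true | true = s≤s (count-≤ p q xs (h ∘ there))
... | true | false with () ← trans (sym qx) (h (here refl) px)

count-< : ∀ (p q : A → Bool) {x} xs → (∀ {x} → x ∈ xs → p x ≡ true → q x ≡ true) →
  x ∈ xs → p x ≡ false → q x ≡ true → length (filterᵇ p xs) < length (filterᵇ q xs)
count-< p q (x ∷ xs) h (here refl) px qx rewrite px | qx = s≤s (count-≤ p q xs (h ∘ there))
count-< p q (y ∷ xs) h (there x∈) px qx with p y in py | q y in qy
... | false | false = count-< p q xs (h ∘ there) x∈ px qx
... | false | true = ℕₚ.m≤n⇒m≤1+n (count-< p q xs (h ∘ there) x∈ px qx)
... | true | true = s≤s (count-< p q xs (h ∘ there) x∈ px qx)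
... | true | false with () ← trans (sym qy) (h (here refl) py)

module FinitePoset
  {A : Set} (leq eq : A → A → Bool) (elems : List A)
  (eq⇒≡ : ∀ {x y} → eq x y ≡ true → x ≡ y)
  (eq-refl : ∀ x → eq x x ≡ true)
  (leq-refl : ∀ {x} → x ∈ elems → leq x x ≡ true)
  (leq-trans : ∀ {x y z} → x ∈ elems → y ∈ elems → z ∈ elems → leq x y ≡ true → leq y z ≡ true → leq x z ≡ true)
  (leq-antisym : ∀ {x y} → x ∈ elems → y ∈ elems → leq x y ≡ true → leq y x ≡ true → x ≡ y)
  (unique : Unique elems)
  (bot : A) (bot∈ : bot ∈ elems) (bot-min : ∀ y → leq bot y ≡ true)
  where

  open Mobius leq eq elems

  below : A → A → Bool
  below y z = leq z y ∧ not (eq z y)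

  rank : A → ℕ
  rank y = length (filterᵇ (below y) elems)

  eq-false : ∀ {x y} → x ≢ y → eq x y ≡ false
  eq-false x≢y = ¬true⇒false (x≢y ∘ eq⇒≡)

  eq-self : ∀ {x} → ¬ (eq x x ≡ false)
  eq-self {x} e with () ← trans (sym e) (eq-refl x)

  below-leq : ∀ {y z} → below y z ≡ true → leq z y ≡ true
  below-leq = proj₁ ∘ ∧-true⁻

  below-≢ : ∀ {y z} → below y z ≡ true → z ≢ y
  below-≢ {y} b refl = not-true⁻ (proj₂ (∧-true⁻ b)) (eq-refl y)

  below⁺ : ∀ {y z} → leq z y ≡ true → z ≢ y → below y z ≡ true
  below⁺ l z≢y = ∧-true⁺ l (not-true⁺ (z≢y ∘ eq⇒≡))

  below-irrefl : ∀ y → below y y ≡ false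
  below-irrefl y = ¬true⇒false (λ b → below-≢ b refl)

  rank-mono : ∀ {y z} → y ∈ elems → z ∈ elems → below y z ≡ true → rank z < rank y
  rank-mono {y} {z} y∈ z∈ b = count-< (below z) (below y) elems inc z∈ (below-irrefl z) b
    where
    inc : ∀ {u} → u ∈ elems → below z u ≡ true → below y u ≡ true
    inc u∈ bu = below⁺ (leq-trans u∈ z∈ y∈ (below-leq bu) (below-leq b))
      λ { refl → below-≢ b (leq-antisym z∈ y∈ (below-leq b) (below-leq bu)) }

  rank-positive : ∀ {y} → bot ≢ y → 0 < rank y
  rank-positive {y} bot≢y = ℕₚ.≤-<-trans z≤n (count-< (λ _ → false) (below y) elems (λ _ ()) bot∈ refl (below⁺ (bot-min y) bot≢y))

  rank≤length : ∀ y → rank y ≤ length elems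
  rank≤length y = Listₚ.length-filter (T? ∘ below y) elems

  strictlyBelow : A → List A
  strictlyBelow y = filterᵇ (λ z → leq bot z ∧ leq z y ∧ not (eq z y)) elems

  -- Each unfolding passes to strictly smaller elements, whose rank is smaller, so fuel beyond the
  -- rank changes nothing. This turns the definition with fuel into the genuine recursion `M-step`.
  mobF-stable : ∀ f g {y} → y ∈ elems → rank y ≤ f → rank y ≤ g → mobF f bot y ≡ mobF g bot y
  mobF-stable zero zero y∈ _ _ = refl
  mobF-stable zero (suc g) {y} y∈ r≤0 _ with eq bot y in e
  ... | true = refl
  ... | false = ⊥-elim (ℕₚ.<⇒≱ (rank-positive {y} λ { refl → eq-self e }) r≤0)
  mobF-stable (suc f) zero y∈ r≤ r≤0 = sym (mobF-stable zero (suc f) y∈ r≤0 r≤)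
  mobF-stable (suc f) (suc g) {y} y∈ r≤f r≤g with eq bot y | leq bot y
  ... | true | _ = refl
  ... | false | false = refl
  ... | false | true = cong -ᶻ_ (∑-cong (strictlyBelow y) step)
    where
    step : ∀ {z} → z ∈ strictlyBelow y → mobF f bot z ≡ mobF g bot z
    step {z} z∈′ with z∈ , b ← ∈-filterᵇ⁻ _ {elems} z∈′ =
      let r = rank-mono y∈ z∈ (proj₂ (∧-true⁻ {leq bot z} b)) in
      mobF-stable f g z∈ (ℕₚ.≤-pred (ℕₚ.≤-trans r r≤f)) (ℕₚ.≤-pred (ℕₚ.≤-trans r r≤g))

  M : A → ℤ
  M = mob bot

  M-bot : M bot ≡ 1ℤ
  M-bot = go (length elems)
    where
    go : ∀ k → mobF k bot bot ≡ 1ℤ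
    go zero rewrite eq-refl bot = refl
    go (suc k) rewrite eq-refl bot = refl

  M-step : ∀ {y} → y ∈ elems → y ≢ bot → M y ≡ -ᶻ (∑ (strictlyBelow y) M)
  M-step {y} y∈ y≢bot = trans (mobF-stable (length elems) (suc (length elems)) y∈ (rank≤length y) (ℕₚ.m≤n⇒m≤1+n (rank≤length y))) unfold
    where
    unfold : mobF (suc (length elems)) bot y ≡ -ᶻ (∑ (strictlyBelow y) M)
    unfold rewrite eq-false (y≢bot ∘ sym) | bot-min y = refl

  ∑-leq-M : ∀ {y} → y ∈ elems → y ≢ bot → ∑ elems (λ z → 𝟙 (leq z y) * M z) ≡ 0ℤ
  ∑-leq-M {y} y∈ y≢bot = begin
    ∑ elems (λ z → 𝟙 (leq z y) * M z)
      ≡⟨ ∑-cong elems (λ {z} _ → split z) ⟩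
    ∑ elems (λ z → 𝟙 (leq bot z ∧ leq z y ∧ not (eq z y)) * M z +ᶻ 𝟙 (eq z y) * M z)
      ≡⟨ ∑-+ elems _ _ ⟩
    ∑ elems (λ z → 𝟙 (leq bot z ∧ leq z y ∧ not (eq z y)) * M z) +ᶻ ∑ elems (λ z → 𝟙 (eq z y) * M z)
      ≡⟨ cong₂ _+ᶻ_ (sym (∑-filterᵇ _ elems M)) (∑-single _ unique y∈ off) ⟩
    ∑ (strictlyBelow y) M +ᶻ 𝟙 (eq y y) * M y
      ≡⟨ cong (∑ (strictlyBelow y) M +ᶻ_) (trans (cong (λ b → 𝟙 b * M y) (eq-refl y)) (ℤₚ.*-identityˡ _)) ⟩
    ∑ (strictlyBelow y) M +ᶻ M y
      ≡⟨ cong (∑ (strictlyBelow y) M +ᶻ_) (M-step y∈ y≢bot) ⟩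
    ∑ (strictlyBelow y) M +ᶻ -ᶻ ∑ (strictlyBelow y) M
      ≡⟨ ℤₚ.+-inverseʳ (∑ (strictlyBelow y) M) ⟩
    0ℤ ∎
    where
    open ≡-Reasoning
    off : ∀ {z} → z ∈ elems → z ≢ y → 𝟙 (eq z y) * M z ≡ 0ℤ
    off {z} _ z≢y rewrite eq-false z≢y = refl
    split : ∀ z → 𝟙 (leq z y) * M z ≡ 𝟙 (leq bot z ∧ leq z y ∧ not (eq z y)) * M z +ᶻ 𝟙 (eq z y) * M z
    split z rewrite bot-min z with eq z y in e
    ... | true with refl ← eq⇒≡ e rewrite leq-refl y∈ = sym (ℤₚ.+-identityˡ _)
    ... | false with leq z y
    ...   | true = sym (ℤₚ.+-identityʳ _)
    ...   | false = refl

  module _ (top : A) (top∈ : top ∈ elems) (f : A → ℤ) (f-bot : f bot ≡ 0ℤ)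
    (f-dual : ∀ {z} → z ∈ elems → z ≢ bot → ∑ elems (λ y → 𝟙 (leq z y) * f y) ≡ 𝟙 (eq z top))
    (bot≢top : bot ≢ top)
    where

    -- Double counting of `f y * M z` over pairs z ≤ y. For fixed y the sum over z vanishes, either
    -- by `∑-leq-M` or because `f bot` is 0. For fixed z the sum over y survives only at z = `bot`,
    -- giving the total of `f`, and at z = `top`, giving `M top`. Only the dual recursion of `f`
    -- enters, so the Möbius function of the upper intervals need not be defined.
    M-top : M top ≡ -ᶻ ∑ elems f
    M-top = begin
      M top
        ≡⟨ lemma (M top) (∑ elems f) ⟩
      (∑ elems f +ᶻ M top) +ᶻ -ᶻ ∑ elems f
        ≡⟨ cong (_+ᶻ -ᶻ ∑ elems f) (trans (sym dual) vanish) ⟩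
      0ℤ +ᶻ -ᶻ ∑ elems f
        ≡⟨ ℤₚ.+-identityˡ _ ⟩
      -ᶻ ∑ elems f ∎
      where
      open ≡-Reasoning
      lemma : ∀ a b → a ≡ (b +ᶻ a) +ᶻ -ᶻ b
      lemma = solve-∀
      comm₃ : ∀ a b c → a * (b * c) ≡ c * (b * a)
      comm₃ = solve-∀
      vanish : ∑ elems (λ y → ∑ elems (λ z → f y * (𝟙 (leq z y) * M z))) ≡ 0ℤ
      vanish = ∑-zero elems λ {y} y∈ → trans (∑-*ˡ (f y) elems _) (van y y∈)
        where
        van : ∀ y → y ∈ elems → f y * ∑ elems (λ z → 𝟙 (leq z y) * M z) ≡ 0ℤ
        van y y∈ with eq y bot in e
        ... | true with refl ← eq⇒≡ e rewrite f-bot = refl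
        ... | false = trans (cong (f y *_) (∑-leq-M y∈ (λ { refl → eq-self e }))) (ℤₚ.*-zeroʳ (f y))
      inner : ∀ {z} → z ∈ elems → ∑ elems (λ y → f y * (𝟙 (leq z y) * M z)) ≡ 𝟙 (eq z bot) * ∑ elems f +ᶻ 𝟙 (eq z top) * M z
      inner {z} z∈ = trans (∑-cong elems (λ {y} _ → comm₃ (f y) (𝟙 (leq z y)) (M z)))
        (trans (∑-*ˡ (M z) elems _) (cases (eq z bot) refl))
        where
        cases : ∀ b → eq z bot ≡ b → M z * ∑ elems (λ y → 𝟙 (leq z y) * f y) ≡ 𝟙 (eq z bot) * ∑ elems f +ᶻ 𝟙 (eq z top) * M z
        cases true e with refl ← eq⇒≡ e rewrite e | eq-false bot≢top | M-bot =
          trans (ℤₚ.*-identityˡ _) (trans (∑-cong elems (λ {y} _ → trans (cong (λ b → 𝟙 b * f y) (bot-min y)) (ℤₚ.*-identityˡ _)))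
            (sym (trans (ℤₚ.+-identityʳ _) (ℤₚ.*-identityˡ _))))
        cases false e rewrite f-dual z∈ (λ { refl → eq-self e }) | e =
          trans (ℤₚ.*-comm (M z) _) (sym (ℤₚ.+-identityˡ _))
      single : ∀ {x} → x ∈ elems → (g : A → ℤ) → ∑ elems (λ z → 𝟙 (eq z x) * g z) ≡ g x
      single {x} x∈ g = trans (∑-single _ unique x∈ (λ {y} _ y≢x → cong (λ b → 𝟙 b * g y) (eq-false y≢x)))
        (trans (cong (λ b → 𝟙 b * g x) (eq-refl x)) (ℤₚ.*-identityˡ _))
      dual : ∑ elems (λ y → ∑ elems (λ z → f y * (𝟙 (leq z y) * M z))) ≡ ∑ elems f +ᶻ M top
      dual = trans (∑-swap elems elems _) (trans (∑-cong elems inner) (trans (∑-+ elems _ _)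
        (cong₂ _+ᶻ_ (single bot∈ (λ _ → ∑ elems f)) (single top∈ M))))

-- Refinement of pointed set partitions

≤ᵇ-true⁻ : ∀ {m n} → (m ≤ᵇ n) ≡ true → m ≤ n
≤ᵇ-true⁻ {m} {n} p = ℕₚ.≤ᵇ⇒≤ m n (≡true⇒T p)

≤ᵇ-false⁻ : ∀ {m n} → (m ≤ᵇ n) ≡ false → n < m
≤ᵇ-false⁻ e = ℕₚ.≰⇒> λ m≤n → case trans (sym e) (T⇒≡true (ℕₚ.≤⇒≤ᵇ m≤n)) of λ ()

≤ᵇ-true⁺ : ∀ {m n} → m ≤ n → (m ≤ᵇ n) ≡ true
≤ᵇ-true⁺ p = T⇒≡true (ℕₚ.≤⇒≤ᵇ p)

≡ᴸ-true⁻ : ∀ {xs ys} → xs ≡ᴸ ys ≡ true → xs ≡ ys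
≡ᴸ-true⁻ {[]} {[]} _ = refl
≡ᴸ-true⁻ {x ∷ xs} {y ∷ ys} h with p , q ← ∧-true⁻ {x ≡ᵇ y} h = cong₂ _∷_ (≡ᵇ-true⁻ p) (≡ᴸ-true⁻ q)

≡ᴸ-refl : ∀ xs → xs ≡ᴸ xs ≡ true
≡ᴸ-refl [] = refl
≡ᴸ-refl (x ∷ xs) = ∧-true⁺ (≡ᵇ-refl x) (≡ᴸ-refl xs)

≡ᴸ-true⁺ : ∀ {xs ys} → xs ≡ ys → xs ≡ᴸ ys ≡ true
≡ᴸ-true⁺ {xs} refl = ≡ᴸ-refl xs

∈-concatMap-map⁺ : ∀ {w a} (g : ℕ → List (List ℕ)) {xs} → a ∈ xs → w ∈ g a → a ∷ w ∈ concatMap (λ a → map (a ∷_) (g a)) xs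
∈-concatMap-map⁺ g a∈ w∈ = ∈-concatMap⁺ _ (lose a∈ (∈-map⁺ _ w∈))

∈-concatMap-map⁻ : ∀ {w} (g : ℕ → List (List ℕ)) {xs} → w ∈ concatMap (λ a → map (a ∷_) (g a)) xs →
  ∃[ a ] ∃[ v ] w ≡ a ∷ v × a ∈ xs × v ∈ g a
∈-concatMap-map⁻ g {xs} w∈ with a , a∈ , w∈a ← find (∈-concatMap⁻ (λ a → map (a ∷_) (g a)) {xs} w∈) with v , v∈ , eq ← ∈-map⁻ _ w∈a =
  a , v , eq , a∈ , v∈

concatMap-unique : ∀ {g : A → List B} {xs} → Unique xs → (∀ {x} → x ∈ xs → Unique (g x)) →
  (∀ {x y w} → x ∈ xs → y ∈ xs → w ∈ g x → w ∈ g y → x ≡ y) → Unique (concatMap g xs)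
concatMap-unique {xs = []} _ _ _ = []
concatMap-unique {g = g} {xs = x ∷ xs} (x∉ ∷ u) ug disj = Uniqueₚ.++⁺ (ug (here refl))
  (concatMap-unique u (ug ∘ there) (λ x∈ y∈ → disj (there x∈) (there y∈)))
  λ { (w∈x , w∈) → let y , y∈ , w∈y = find (∈-concatMap⁻ g {xs} w∈) in All.lookup x∉ y∈ (disj (here refl) (there y∈) w∈x w∈y) }

concatMap-map-unique : ∀ {g : ℕ → List (List ℕ)} {xs} → Unique xs → (∀ a → Unique (g a)) →
  Unique (concatMap (λ a → map (a ∷_) (g a)) xs)
concatMap-map-unique {g} u ug = concatMap-unique u (λ {a} _ → Uniqueₚ.map⁺ Listₚ.∷-injectiveʳ (ug a)) (λ _ _ → disj)
  where
  disj : ∀ {a b w} → w ∈ map (a ∷_) (g a) → w ∈ map (b ∷_) (g b) → a ≡ b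
  disj w∈a w∈b with _ , _ , refl ← ∈-map⁻ _ w∈a | _ , _ , eq ← ∈-map⁻ _ w∈b = Listₚ.∷-injectiveˡ eq

∑-const : ∀ (xs : List A) c → ∑ xs (λ _ → c) ≡ + length xs * c
∑-const [] c = sym (ℤₚ.*-zeroˡ c)
∑-const (x ∷ xs) c rewrite ∑-const xs c = lemma c (+ length xs)
  where
  lemma : ∀ c l → c +ᶻ l * c ≡ (1ℤ +ᶻ l) * c
  lemma = solve-∀

RGS : ℕ → List ℕ → Set
RGS mx [] = ⊤
RGS mx (a ∷ w) = a ≤ suc mx × RGS (a ⊔ mx) w

∈-rgs⁻ : ∀ k {mx w} → w ∈ rgs k mx → length w ≡ k × RGS mx w
∈-rgs⁻ zero (here refl) = refl , tt
∈-rgs⁻ (suc k) {mx} w∈ with a , v , refl , a∈ , v∈ ← ∈-concatMap-map⁻ (λ a → rgs k (a ⊔ mx)) {upTo (suc (suc mx))} w∈ with l , r ← ∈-rgs⁻ k v∈ =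
  cong suc l , ℕₚ.≤-pred (∈-upTo⁻ a∈) , r

rgs-unique : ∀ k mx → Unique (rgs k mx)
rgs-unique zero mx = [] ∷ []
rgs-unique (suc k) mx = concatMap-map-unique (Uniqueₚ.upTo⁺ (suc (suc mx))) (λ a → rgs-unique k (a ⊔ mx))

-- The witness φ sends the label of a block of `z` to the label of the block of `y` that contains
-- it. In this form transitivity is composition.
Coarsens : List ℕ → List ℕ → Set
Coarsens z y = ∃[ φ ] φ 0 ≡ 0 × y ≡ map φ z

update : (ℕ → ℕ) → ℕ → ℕ → ℕ → ℕ
update φ a b x = if a ≡ᵇ x then b else φ x

-- The default value 0 makes the table fix the letter 0 even when the zero block of the finer
-- partition is empty.
lookupᶻ : List (ℕ × ℕ) → ℕ → ℕ
lookupᶻ [] = λ _ → 0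
lookupᶻ ((a , b) ∷ ps) = update (lookupᶻ ps) a b

update-≡ : ∀ φ a b → update φ a b a ≡ b
update-≡ φ a b rewrite ≡ᵇ-refl a = refl

update-≢ : ∀ φ a b x → a ≢ x → update φ a b x ≡ φ x
update-≢ φ a b x a≢x rewrite ≡ᵇ-false⁺ a≢x = refl

lookupᶻ-∈ : ∀ ps {a b : ℕ} → (∀ {p q} → p ∈ ps → q ∈ ps → proj₁ p ≡ proj₁ q → proj₂ p ≡ proj₂ q) →
  (a , b) ∈ ps → lookupᶻ ps a ≡ b
lookupᶻ-∈ ((c , d) ∷ ps) {a} fun (here refl) = update-≡ (lookupᶻ ps) c d
lookupᶻ-∈ ((c , d) ∷ ps) {a} fun (there p∈) with c ≡ᵇ a in e
... | true = fun (here refl) (there p∈) (≡ᵇ-true⁻ e)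
... | false = lookupᶻ-∈ ps (λ p q → fun (there p) (there q)) p∈

lookupᶻ-0 : ∀ ps → (∀ {p} → p ∈ ps → proj₁ p ≡ 0 → proj₂ p ≡ 0) → lookupᶻ ps 0 ≡ 0
lookupᶻ-0 [] h = refl
lookupᶻ-0 ((zero , b) ∷ ps) h = h (here refl) refl
lookupᶻ-0 ((suc a , b) ∷ ps) h = lookupᶻ-0 ps (h ∘ there)

zip-graph⁻ : ∀ φ z {y} → length z ≡ length y → (∀ {a b : ℕ} → (a , b) ∈ zip z y → φ a ≡ b) → y ≡ map φ z
zip-graph⁻ φ [] {[]} _ h = refl
zip-graph⁻ φ (a ∷ z) {b ∷ y} l h = cong₂ _∷_ (sym (h (here refl))) (zip-graph⁻ φ z (ℕₚ.suc-injective l) (h ∘ there))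

zip-graph⁺ : ∀ φ z {a b : ℕ} → (a , b) ∈ zip z (map φ z) → b ≡ φ a
zip-graph⁺ φ (c ∷ z) (here refl) = refl
zip-graph⁺ φ (c ∷ z) (there p∈) = zip-graph⁺ φ z p∈

-- The two tests in `refines` say that `zip z y` is the graph of a partial function with value 0
-- wherever its argument is 0; the table read off from this list is φ.
refines⁻ : ∀ {z y} → length z ≡ length y → refines z y ≡ true → Coarsens z y
refines⁻ {z} {y} l h with h₀ , h₁ ← ∧-true⁻ h =
  lookupᶻ ps , lookupᶻ-0 ps zero-block , zip-graph⁻ (lookupᶻ ps) z l (lookupᶻ-∈ ps functional)
  where
  ps = zip z y
  zero-block : ∀ {p} → p ∈ ps → proj₁ p ≡ 0 → proj₂ p ≡ 0
  zero-block {.0 , b} p∈ refl = ≡ᵇ-true⁻ (all-true⁻ h₀ p∈)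
  functional : ∀ {p q} → p ∈ ps → q ∈ ps → proj₁ p ≡ proj₁ q → proj₂ p ≡ proj₂ q
  functional {zero , b} {.0 , c} p∈ q∈ refl = trans (zero-block p∈ refl) (sym (zero-block q∈ refl))
  functional {suc a , b} {.(suc a) , c} p∈ q∈ refl = conclude (all-true⁻ (all-true⁻ h₁ p∈) q∈)
    where
    conclude : not ((a ≡ᵇ a) ∧ true) ∨ (b ≡ᵇ c) ≡ true → b ≡ c
    conclude rewrite ≡ᵇ-refl a = ≡ᵇ-true⁻

refines⁺ : ∀ {z y} → Coarsens z y → refines z y ≡ true
refines⁺ {z} (φ , φ0 , refl) = ∧-true⁺ (all-true⁺ ps zero-block) (all-true⁺ ps λ p∈ → all-true⁺ ps λ q∈ → functional p∈ q∈)
  where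
  ps = zip z (map φ z)
  zero-block : ∀ {p} → p ∈ ps → not (proj₁ p ≡ᵇ 0) ∨ (proj₂ p ≡ᵇ 0) ≡ true
  zero-block {zero , b} p∈ = ≡ᵇ-true⁺ (trans (zip-graph⁺ φ z p∈) φ0)
  zero-block {suc a , b} p∈ = refl
  functional : ∀ {p q} → p ∈ ps → q ∈ ps →
    not ((proj₁ p ≡ᵇ proj₁ q) ∧ not (proj₁ p ≡ᵇ 0)) ∨ (proj₂ p ≡ᵇ proj₂ q) ≡ true
  functional {a , b} {c , d} p∈ q∈ with a ≡ᵇ c in e
  ... | false = refl
  ... | true with refl ← ≡ᵇ-true⁻ {a} {c} e = ∨-true⁺ʳ (≡ᵇ-true⁺ (trans (zip-graph⁺ φ z p∈) (sym (zip-graph⁺ φ z q∈))))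

Coarsens-refl : ∀ z → Coarsens z z
Coarsens-refl z = id , refl , sym (Listₚ.map-id z)

Coarsens-trans : ∀ {x y z} → Coarsens x y → Coarsens y z → Coarsens x z
Coarsens-trans {x} (φ , φ0 , refl) (ψ , ψ0 , refl) = ψ ∘ φ , trans (cong ψ φ0) ψ0 , sym (Listₚ.map-∘ x)

≤⊔-cases : ∀ {x a mx} → a ≤ suc mx → x ≤ a ⊔ mx → x ≤ mx ⊎ (x ≡ suc mx × a ≡ suc mx)
≤⊔-cases {x} {a} {mx} a≤ x≤ with ℕₚ.m≤n⇒m<n∨m≡n a≤
... | inj₁ a<smx = inj₁ (subst (x ≤_) (ℕₚ.m≤n⇒m⊔n≡n (ℕₚ.≤-pred a<smx)) x≤)
... | inj₂ refl with ℕₚ.m≤n⇒m<n∨m≡n (subst (x ≤_) (ℕₚ.m≥n⇒m⊔n≡m (ℕₚ.n≤1+n mx)) x≤)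
...   | inj₁ x<smx = inj₁ (ℕₚ.≤-pred x<smx)
...   | inj₂ eq = inj₂ (eq , refl)

-- Here the normal form of the words is essential. Reading from the left, φ and ψ are the identity
-- on the letters up to `mx`; if one of the two next letters is among these, the other equals it,
-- and otherwise both open a block and are `suc mx`.
Coarsens-antisym : ∀ {z y} → RGS 0 z → RGS 0 y → Coarsens z y → Coarsens y z → z ≡ y
Coarsens-antisym {z} {y} rz ry (φ , φ0 , y≡) (ψ , ψ0 , z≡) =
  go 0 z y rz ry (λ { z≤n → φ0 }) (λ { z≤n → ψ0 }) y≡ z≡
  where
  go : ∀ mx z y → RGS mx z → RGS mx y → (∀ {x} → x ≤ mx → φ x ≡ x) → (∀ {x} → x ≤ mx → ψ x ≡ x) →
    y ≡ map φ z → z ≡ map ψ y → z ≡ y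
  go mx [] [] _ _ _ _ _ _ = refl
  go mx (a ∷ z) (b ∷ y) (a≤ , rz) (b≤ , ry) hφ hψ y≡ z≡ = cong₂ _∷_ a≡b
    (go (a ⊔ mx) z y rz (subst (λ c → RGS (c ⊔ mx) y) (sym a≡b) ry)
      (λ x≤ → ext φ hφ φa (≤⊔-cases a≤ x≤)) (λ x≤ → ext ψ hψ ψa (≤⊔-cases a≤ x≤))
      (Listₚ.∷-injectiveʳ y≡) (Listₚ.∷-injectiveʳ z≡))
    where
    b≡ = Listₚ.∷-injectiveˡ y≡
    a≡ = Listₚ.∷-injectiveˡ z≡
    a≡b : a ≡ b
    a≡b with ℕₚ.m≤n⇒m<n∨m≡n a≤ | ℕₚ.m≤n⇒m<n∨m≡n b≤
    ... | inj₁ a< | _ = sym (trans b≡ (hφ (ℕₚ.≤-pred a<)))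
    ... | inj₂ _ | inj₁ b< = trans a≡ (hψ (ℕₚ.≤-pred b<))
    ... | inj₂ e | inj₂ e′ = trans e (sym e′)
    φa : φ a ≡ a
    φa = trans (sym b≡) (sym a≡b)
    ψa : ψ a ≡ a
    ψa = trans (cong ψ a≡b) (sym a≡)
    ext : ∀ χ {x} → (∀ {x} → x ≤ mx → χ x ≡ x) → χ a ≡ a → x ≤ mx ⊎ (x ≡ suc mx × a ≡ suc mx) → χ x ≡ x
    ext χ h _ (inj₁ x≤) = h x≤
    ext χ h e (inj₂ (refl , refl)) = e

-- In `extends φ mz z y`, φ records the images of the letters ≤ mz already read.
extends : (ℕ → ℕ) → ℕ → List ℕ → List ℕ → Bool
extends φ mz (a ∷ z) (b ∷ y) =
  if a ≤ᵇ mz then (φ a ≡ᵇ b) ∧ extends φ mz z y else extends (update φ a b) a z y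
extends φ mz _ _ = true

extends⁻ : ∀ φ mz {z y} → RGS mz z → length z ≡ length y → extends φ mz z y ≡ true →
  ∃[ ψ ] (∀ {x} → x ≤ mz → ψ x ≡ φ x) × y ≡ map ψ z
extends⁻ φ mz {[]} {[]} _ _ _ = φ , (λ _ → refl) , refl
extends⁻ φ mz {a ∷ z} {b ∷ y} (a≤ , rz) l h with a ≤ᵇ mz in e
... | true with e₁ , h′ ← ∧-true⁻ {φ a ≡ᵇ b} h
  with ψ , agree , y≡ ← extends⁻ φ mz {z} {y} (subst (λ k → RGS k z) (ℕₚ.m≤n⇒m⊔n≡n (≤ᵇ-true⁻ e)) rz) (ℕₚ.suc-injective l) h′ =
  ψ , agree , cong₂ _∷_ (trans (sym (≡ᵇ-true⁻ e₁)) (sym (agree (≤ᵇ-true⁻ e)))) y≡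
... | false
  with ψ , agree , y≡ ← extends⁻ (update φ a b) a {z} {y} (subst (λ k → RGS k z) (ℕₚ.m≥n⇒m⊔n≡m (ℕₚ.<⇒≤ (≤ᵇ-false⁻ e))) rz) (ℕₚ.suc-injective l) h =
  ψ , (λ {x} x≤ → trans (agree (ℕₚ.≤-trans x≤ (ℕₚ.<⇒≤ (≤ᵇ-false⁻ e)))) (update-≢ φ a b x (λ { refl → ℕₚ.<⇒≱ (≤ᵇ-false⁻ e) x≤ }))) ,
  cong₂ _∷_ (sym (trans (agree ℕₚ.≤-refl) (update-≡ φ a b))) y≡

extends⁺ : ∀ φ ψ mz {z} → RGS mz z → (∀ {x} → x ≤ mz → ψ x ≡ φ x) → extends φ mz z (map ψ z) ≡ true
extends⁺ φ ψ mz {[]} _ _ = refl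
extends⁺ φ ψ mz {a ∷ z} (a≤ , rz) agree with a ≤ᵇ mz in e
... | true = ∧-true⁺ (≡ᵇ-true⁺ (sym (agree (≤ᵇ-true⁻ e))))
  (extends⁺ φ ψ mz {z} (subst (λ k → RGS k z) (ℕₚ.m≤n⇒m⊔n≡n (≤ᵇ-true⁻ e)) rz) agree)
... | false with ℕₚ.m≤n⇒m<n∨m≡n a≤
...   | inj₁ a< with () ← trans (sym e) (≤ᵇ-true⁺ (ℕₚ.≤-pred a<))
...   | inj₂ refl = extends⁺ (update φ a (ψ a)) ψ a {z} (subst (λ k → RGS k z) (ℕₚ.m≥n⇒m⊔n≡m (ℕₚ.n≤1+n mz)) rz) agree′
  where
  agree′ : ∀ {x} → x ≤ a → ψ x ≡ update φ a (ψ a) x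
  agree′ {x} x≤ with ℕₚ.m≤n⇒m<n∨m≡n x≤
  ... | inj₁ x< = trans (agree (ℕₚ.≤-pred x<)) (sym (update-≢ φ a (ψ a) x (λ { refl → ℕₚ.<-irrefl refl x< })))
  ... | inj₂ refl = sym (update-≡ φ a (ψ a))

extends-old : ∀ φ {a mz} b z y → a ≤ mz → extends φ mz (a ∷ z) (b ∷ y) ≡ (φ a ≡ᵇ b) ∧ extends φ mz z y
extends-old φ b z y a≤ rewrite ≤ᵇ-true⁺ a≤ = refl

≤ᵇ-suc-false : ∀ n → (suc n ≤ᵇ n) ≡ false
≤ᵇ-suc-false n = ¬true⇒false (λ e → ℕₚ.<-irrefl {n} refl (≤ᵇ-true⁻ e))

max-shuffle : ∀ a b c → (a ⊔ b) ⊔ c ≡ b ⊔ (a ⊔ c)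
max-shuffle a b c = trans (cong (_⊔ c) (ℕₚ.⊔-comm a b)) (ℕₚ.⊔-assoc b a c)

extends-new : ∀ φ {mz} b z y → extends φ mz (suc mz ∷ z) (b ∷ y) ≡ extends (update φ (suc mz) b) (suc mz) z y
extends-new φ {mz} b z y rewrite ≤ᵇ-suc-false mz = refl

𝟙-∧ : ∀ a b → 𝟙 (a ∧ b) ≡ 𝟙 a * 𝟙 b
𝟙-∧ true b = sym (ℤₚ.*-identityˡ _)
𝟙-∧ false b = refl

update-≤ : ∀ φ {mz mx} b {x} → (∀ {x} → x ≤ mz → φ x ≤ mx) → x ≤ suc mz → update φ (suc mz) b x ≤ b ⊔ mx
update-≤ φ {mz} {mx} b {x} hφ x≤ with suc mz ≡ᵇ x in e
... | true = ℕₚ.m≤m⊔n b mx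
... | false with ℕₚ.m≤n⇒m<n∨m≡n x≤
...   | inj₁ x< = ℕₚ.≤-trans (hφ (ℕₚ.≤-pred x<)) (ℕₚ.m≤n⊔m b mx)
...   | inj₂ refl with () ← trans (sym e) (≡ᵇ-refl mz)

∑-rgs-suc : ∀ k mx (f : List ℕ → ℤ) →
  ∑ (rgs (suc k) mx) f ≡ ∑ (upTo (suc (suc mx))) (λ b → ∑ (rgs k (b ⊔ mx)) (λ y → f (b ∷ y)))
∑-rgs-suc k mx f = trans (∑-concatMap (λ b → map (b ∷_) (rgs k (b ⊔ mx))) (upTo (suc (suc mx))) f)
  (∑-cong (upTo (suc (suc mx))) (λ {b} _ → ∑-map (b ∷_) (rgs k (b ⊔ mx)) f))

-- The image of a letter already read is forced, so only the term b = `φ a` survives, and it leaves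
-- the maximum `mx` unchanged.
∑-extends-old : ∀ (g : ℕ → ℤ) φ {a mz mx} c z → a ≤ mz → φ a ≤ mx →
  (∀ b → ∑ (rgs (length z) (b ⊔ mx)) (λ y → 𝟙 (extends φ mz z y) * g (maxL y ⊔ (b ⊔ mx))) ≡ c * g (b ⊔ mx)) →
  ∑ (rgs (suc (length z)) mx) (λ y → 𝟙 (extends φ mz (a ∷ z) y) * g (maxL y ⊔ mx)) ≡ c * g mx
∑-extends-old g φ {a} {mz} {mx} c z a≤mz φa≤mx ih = begin
  ∑ (rgs (suc (length z)) mx) (λ y → 𝟙 (extends φ mz (a ∷ z) y) * g (maxL y ⊔ mx))
    ≡⟨ ∑-rgs-suc (length z) mx _ ⟩
  ∑ letters (λ b → ∑ (rgs (length z) (b ⊔ mx)) (λ y → 𝟙 (extends φ mz (a ∷ z) (b ∷ y)) * g ((b ⊔ maxL y) ⊔ mx)))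
    ≡⟨ ∑-cong letters (λ {b} _ → inner b) ⟩
  ∑ letters (λ b → 𝟙 (φ a ≡ᵇ b) * (c * g (b ⊔ mx)))
    ≡⟨ ∑-single (λ b → 𝟙 (φ a ≡ᵇ b) * (c * g (b ⊔ mx))) (Uniqueₚ.upTo⁺ (suc (suc mx))) (∈-upTo⁺ (s≤s (ℕₚ.m≤n⇒m≤1+n φa≤mx)))
      (λ {b} _ b≢ → cong (λ t → 𝟙 t * (c * g (b ⊔ mx))) (≡ᵇ-false⁺ (b≢ ∘ sym))) ⟩
  𝟙 (φ a ≡ᵇ φ a) * (c * g (φ a ⊔ mx))
    ≡⟨ cong₂ (λ t k → 𝟙 t * (c * g k)) (≡ᵇ-refl (φ a)) (ℕₚ.m≤n⇒m⊔n≡n φa≤mx) ⟩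
  1ℤ * (c * g mx)
    ≡⟨ ℤₚ.*-identityˡ _ ⟩
  c * g mx ∎
  where
  open ≡-Reasoning
  letters : List ℕ
  letters = upTo (suc (suc mx))
  inner : ∀ b → ∑ (rgs (length z) (b ⊔ mx)) (λ y → 𝟙 (extends φ mz (a ∷ z) (b ∷ y)) * g ((b ⊔ maxL y) ⊔ mx)) ≡
    𝟙 (φ a ≡ᵇ b) * (c * g (b ⊔ mx))
  inner b = trans (∑-cong (rgs (length z) (b ⊔ mx)) (λ {y} _ → trans (cong₂ _*_ (trans (cong 𝟙 (extends-old φ b z y a≤mz)) (𝟙-∧ (φ a ≡ᵇ b) _))
      (cong g (max-shuffle b (maxL y) mx))) (ℤₚ.*-assoc (𝟙 (φ a ≡ᵇ b)) _ _)))
    (trans (∑-*ˡ (𝟙 (φ a ≡ᵇ b)) (rgs (length z) (b ⊔ mx)) _) (cong (𝟙 (φ a ≡ᵇ b) *_) (ih b)))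

-- A letter opening a new block of z may be sent to each of the mx + 1 old values or to the new one.
∑-extends-new : ∀ (g : ℕ → ℤ) → (∀ k → + suc k * g k +ᶻ g (suc k) ≡ 0ℤ) → ∀ φ {mz mx} c z →
  (∀ b → ∑ (rgs (length z) (b ⊔ mx)) (λ y → 𝟙 (extends (update φ (suc mz) b) (suc mz) z y) * g (maxL y ⊔ (b ⊔ mx))) ≡ c * g (b ⊔ mx)) →
  ∑ (rgs (suc (length z)) mx) (λ y → 𝟙 (extends φ mz (suc mz ∷ z) y) * g (maxL y ⊔ mx)) ≡ 0ℤ
∑-extends-new g hg φ {mz} {mx} c z ih = begin
  ∑ (rgs (suc (length z)) mx) (λ y → 𝟙 (extends φ mz (suc mz ∷ z) y) * g (maxL y ⊔ mx))
    ≡⟨ ∑-rgs-suc (length z) mx _ ⟩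
  ∑ letters (λ b → ∑ (rgs (length z) (b ⊔ mx)) (λ y → 𝟙 (extends φ mz (suc mz ∷ z) (b ∷ y)) * g ((b ⊔ maxL y) ⊔ mx)))
    ≡⟨ ∑-cong letters (λ {b} _ → inner b) ⟩
  ∑ letters (λ b → c * g (b ⊔ mx))
    ≡⟨ ∑-*ˡ c letters _ ⟩
  c * ∑ letters (λ b → g (b ⊔ mx))
    ≡⟨ cong (c *_) (∑-upTo-last (suc mx) (λ b → g (b ⊔ mx))) ⟩
  c * (∑ (upTo (suc mx)) (λ b → g (b ⊔ mx)) +ᶻ g (suc mx ⊔ mx))
    ≡⟨ cong₂ (λ s t → c * (s +ᶻ t)) old (cong g (ℕₚ.m≥n⇒m⊔n≡m (ℕₚ.n≤1+n mx))) ⟩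
  c * (+ suc mx * g mx +ᶻ g (suc mx))
    ≡⟨ cong (c *_) (hg mx) ⟩
  c * 0ℤ
    ≡⟨ ℤₚ.*-zeroʳ c ⟩
  0ℤ ∎
  where
  open ≡-Reasoning
  letters : List ℕ
  letters = upTo (suc (suc mx))
  inner : ∀ b → ∑ (rgs (length z) (b ⊔ mx)) (λ y → 𝟙 (extends φ mz (suc mz ∷ z) (b ∷ y)) * g ((b ⊔ maxL y) ⊔ mx)) ≡ c * g (b ⊔ mx)
  inner b = trans (∑-cong (rgs (length z) (b ⊔ mx)) (λ {y} _ → cong₂ (λ t k → 𝟙 t * g k) (extends-new φ b z y) (max-shuffle b (maxL y) mx))) (ih b)
  old : ∑ (upTo (suc mx)) (λ b → g (b ⊔ mx)) ≡ + suc mx * g mx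
  old = trans (∑-cong (upTo (suc mx)) (λ b∈ → cong g (ℕₚ.m≤n⇒m⊔n≡n (ℕₚ.≤-pred (∈-upTo⁻ b∈)))))
    (trans (∑-const (upTo (suc mx)) (g mx)) (cong (λ l → + l * g mx) (Listₚ.length-upTo (suc mx))))

-- `mz` and `mx` bound the letters already read in the two words. If `z` opens no further block,
-- every image is forced and one word `y` is left; a letter that opens a block makes the sum vanish
-- through the relation between `g k` and `g (suc k)`. That relation determines `g` up to a factor
-- as the signed factorial.
∑-extends : ∀ (g : ℕ → ℤ) → (∀ k → + suc k * g k +ᶻ g (suc k) ≡ 0ℤ) → ∀ φ mz mx z → RGS mz z →
  (∀ {x} → x ≤ mz → φ x ≤ mx) →
  ∑ (rgs (length z) mx) (λ y → 𝟙 (extends φ mz z y) * g (maxL y ⊔ mx)) ≡ 𝟙 (all (_≤ᵇ mz) z) * g mx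
∑-extends g hg φ mz mx [] _ _ = ℤₚ.+-identityʳ _
∑-extends g hg φ mz mx (a ∷ z) (a≤ , rz) hφ with ℕₚ.m≤n⇒m<n∨m≡n a≤
... | inj₁ (s≤s a≤mz) = trans
  (∑-extends-old g φ (𝟙 (all (_≤ᵇ mz) z)) z a≤mz (hφ a≤mz) λ b →
    ∑-extends g hg φ mz (b ⊔ mx) z (subst (λ k → RGS k z) (ℕₚ.m≤n⇒m⊔n≡n a≤mz) rz) (λ x≤ → ℕₚ.≤-trans (hφ x≤) (ℕₚ.m≤n⊔m b mx)))
  (cong (λ t → 𝟙 (t ∧ all (_≤ᵇ mz) z) * g mx) (sym (≤ᵇ-true⁺ a≤mz)))
... | inj₂ refl = trans
  (∑-extends-new g hg φ (𝟙 (all (_≤ᵇ suc mz) z)) z λ b →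
    ∑-extends g hg (update φ (suc mz) b) (suc mz) (b ⊔ mx) z (subst (λ k → RGS k z) (ℕₚ.m≥n⇒m⊔n≡m (ℕₚ.n≤1+n mz)) rz) (update-≤ φ b hφ))
  (cong (λ t → 𝟙 (t ∧ all (_≤ᵇ mz) z) * g mx) (sym (≤ᵇ-suc-false mz)))

all-zero : ∀ z → all (_≤ᵇ 0) z ≡ z ≡ᴸ replicate (length z) 0
all-zero [] = refl
all-zero (zero ∷ z) = all-zero z
all-zero (suc a ∷ z) = refl

refines≡extends : ∀ {z y} → RGS 0 z → length z ≡ length y → refines z y ≡ extends (λ _ → 0) 0 z y
refines≡extends {z} {y} rz l = bool-ext
  (λ h → from (refines⁻ l h))
  (λ h → let ψ , agree , y≡ = extends⁻ (λ _ → 0) 0 rz l h in refines⁺ (ψ , agree z≤n , y≡))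
  where
  from : Coarsens z y → extends (λ _ → 0) 0 z y ≡ true
  from (ψ , ψ0 , refl) = extends⁺ (λ _ → 0) ψ 0 rz (λ { z≤n → ψ0 })

∑-refines : ∀ (g : ℕ → ℤ) → (∀ k → + suc k * g k +ᶻ g (suc k) ≡ 0ℤ) → ∀ n {z} → z ∈ rgs n 0 →
  ∑ (rgs n 0) (λ y → 𝟙 (refines z y) * g (maxL y)) ≡ 𝟙 (z ≡ᴸ replicate n 0) * g 0
∑-refines g hg n {z} z∈ with refl , rz ← ∈-rgs⁻ n z∈ = begin
  ∑ (rgs n 0) (λ y → 𝟙 (refines z y) * g (maxL y))
    ≡⟨ ∑-cong (rgs n 0) (λ {y} y∈ → cong₂ (λ t k → 𝟙 t * g k) (refines≡extends rz (sym (proj₁ (∈-rgs⁻ n y∈)))) (sym (ℕₚ.⊔-identityʳ (maxL y)))) ⟩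
  ∑ (rgs n 0) (λ y → 𝟙 (extends (λ _ → 0) 0 z y) * g (maxL y ⊔ 0))
    ≡⟨ ∑-extends g hg (λ _ → 0) 0 0 z rz (λ _ → z≤n) ⟩
  𝟙 (all (_≤ᵇ 0) z) * g 0
    ≡⟨ cong (λ t → 𝟙 t * g 0) (all-zero z) ⟩
  𝟙 (z ≡ᴸ replicate n 0) * g 0 ∎
  where open ≡-Reasoning

-- Ordered pointed partitions, counted by words

bumps : List ℕ → List (List ℕ)
bumps [] = []
bumps (x ∷ c) = (suc x ∷ c) ∷ map (x ∷_) (bumps c)

insertOnes : List ℕ → List (List ℕ)
insertOnes [] = (1 ∷ []) ∷ []
insertOnes (x ∷ c) = (1 ∷ x ∷ c) ∷ map (x ∷_) (insertOnes c)

-- D h sums h over the ways to add one element to an ordered pointed partition: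
-- to the pointed block, to one of the blocks, or as a new singleton block in any position.
D : (PIP → ℤ) → PIP → ℤ
D h (c , z) = h (c , suc z) +ᶻ ∑ (bumps c) (λ c → h (c , z)) +ᶻ ∑ (insertOnes c) (λ c → h (c , z))

D^ : ℕ → (PIP → ℤ) → PIP → ℤ
D^ zero h = h
D^ (suc n) h = D (D^ n h)

D^-D : ∀ n h → D^ n (D h) ≡ D (D^ n h)
D^-D zero h = refl
D^-D (suc n) h = cong D (D^-D n h)

Symmetric : (List ℕ → ℤ) → Set
Symmetric F = ∀ {c c′} → c ↭ c′ → F c ≡ F c′

∑-bumps-∷ : ∀ x c (F : List ℕ → ℤ) → ∑ (bumps (x ∷ c)) F ≡ F (suc x ∷ c) +ᶻ ∑ (bumps c) (λ c → F (x ∷ c))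
∑-bumps-∷ x c F = cong (F (suc x ∷ c) +ᶻ_) (∑-map (x ∷_) (bumps c) F)

∑-bumps-↭ : ∀ {c c′} F → Symmetric F → c ↭ c′ → ∑ (bumps c) F ≡ ∑ (bumps c′) F
∑-bumps-↭ F sF Perm.refl = refl
∑-bumps-↭ F sF (prep {xs} {ys} x p) = begin
  ∑ (bumps (x ∷ xs)) F
    ≡⟨ ∑-bumps-∷ x xs F ⟩
  F (suc x ∷ xs) +ᶻ ∑ (bumps xs) (λ c → F (x ∷ c))
    ≡⟨ cong₂ _+ᶻ_ (sF (prep (suc x) p)) (∑-bumps-↭ (λ c → F (x ∷ c)) (λ q → sF (prep x q)) p) ⟩
  F (suc x ∷ ys) +ᶻ ∑ (bumps ys) (λ c → F (x ∷ c))
    ≡⟨ ∑-bumps-∷ x ys F ⟨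
  ∑ (bumps (x ∷ ys)) F ∎
  where open ≡-Reasoning
∑-bumps-↭ F sF (swap {xs} {ys} x y p) = begin
  ∑ (bumps (x ∷ y ∷ xs)) F
    ≡⟨ trans (∑-bumps-∷ x (y ∷ xs) F) (cong (F (suc x ∷ y ∷ xs) +ᶻ_) (∑-bumps-∷ y xs (λ c → F (x ∷ c)))) ⟩
  F (suc x ∷ y ∷ xs) +ᶻ (F (x ∷ suc y ∷ xs) +ᶻ ∑ (bumps xs) (λ c → F (x ∷ y ∷ c)))
    ≡⟨ cong₂ _+ᶻ_ (sF (swap (suc x) y p)) (cong₂ _+ᶻ_ (sF (swap x (suc y) p))
         (trans (∑-cong (bumps xs) (λ _ → sF (swap x y ↭-refl))) (∑-bumps-↭ (λ c → F (y ∷ x ∷ c)) (λ q → sF (prep y (prep x q))) p))) ⟩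
  F (y ∷ suc x ∷ ys) +ᶻ (F (suc y ∷ x ∷ ys) +ᶻ ∑ (bumps ys) (λ c → F (y ∷ x ∷ c)))
    ≡⟨ exchange (F (y ∷ suc x ∷ ys)) (F (suc y ∷ x ∷ ys)) _ ⟩
  F (suc y ∷ x ∷ ys) +ᶻ (F (y ∷ suc x ∷ ys) +ᶻ ∑ (bumps ys) (λ c → F (y ∷ x ∷ c)))
    ≡⟨ trans (∑-bumps-∷ y (x ∷ ys) F) (cong (F (suc y ∷ x ∷ ys) +ᶻ_) (∑-bumps-∷ x ys (λ c → F (y ∷ c)))) ⟨
  ∑ (bumps (y ∷ x ∷ ys)) F ∎
  where
  open ≡-Reasoning
  exchange : ∀ a b c → a +ᶻ (b +ᶻ c) ≡ b +ᶻ (a +ᶻ c)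
  exchange = solve-∀
∑-bumps-↭ F sF (Perm.trans p q) = trans (∑-bumps-↭ F sF p) (∑-bumps-↭ F sF q)

-- Symmetry moves every inserted 1 to the front. The number of positions is the factor that later
-- turns m! into (m+1)!.
∑-insertOnes : ∀ c F → Symmetric F → ∑ (insertOnes c) F ≡ + suc (length c) * F (1 ∷ c)
∑-insertOnes [] F sF = trans (ℤₚ.+-identityʳ _) (sym (ℤₚ.*-identityˡ _))
∑-insertOnes (x ∷ c) F sF = begin
  F (1 ∷ x ∷ c) +ᶻ ∑ (map (x ∷_) (insertOnes c)) F
    ≡⟨ cong (F (1 ∷ x ∷ c) +ᶻ_) (trans (∑-map (x ∷_) (insertOnes c) F) (∑-insertOnes c (λ c → F (x ∷ c)) (λ q → sF (prep x q)))) ⟩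
  F (1 ∷ x ∷ c) +ᶻ + suc (length c) * F (x ∷ 1 ∷ c)
    ≡⟨ cong (λ t → F (1 ∷ x ∷ c) +ᶻ + suc (length c) * t) (sF (swap x 1 ↭-refl)) ⟩
  F (1 ∷ x ∷ c) +ᶻ + suc (length c) * F (1 ∷ x ∷ c)
    ≡⟨ lemma (F (1 ∷ x ∷ c)) (+ suc (length c)) ⟩
  (1ℤ +ᶻ + suc (length c)) * F (1 ∷ x ∷ c) ∎
  where
  open ≡-Reasoning
  lemma : ∀ a l → a +ᶻ l * a ≡ (1ℤ +ᶻ l) * a
  lemma = solve-∀

SymmetricP : (PIP → ℤ) → Set
SymmetricP h = ∀ z → Symmetric (λ c → h (c , z))

D-symmetric : ∀ {h} → SymmetricP h → SymmetricP (D h)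
D-symmetric {h} sh z {c} {c′} p = cong₂ _+ᶻ_
  (cong₂ _+ᶻ_ (sh (suc z) p) (∑-bumps-↭ (λ c → h (c , z)) (sh z) p))
  (begin
    ∑ (insertOnes c) (λ c → h (c , z))
      ≡⟨ ∑-insertOnes c _ (sh z) ⟩
    + suc (length c) * h (1 ∷ c , z)
      ≡⟨ cong₂ (λ l t → + suc l * t) (Permₚ.↭-length p) (sh z (prep 1 p)) ⟩
    + suc (length c′) * h (1 ∷ c′ , z)
      ≡⟨ ∑-insertOnes c′ _ (sh z) ⟨
    ∑ (insertOnes c′) (λ c → h (c , z)) ∎)
  where open ≡-Reasoning

D^-symmetric : ∀ n {h} → SymmetricP h → SymmetricP (D^ n h)
D^-symmetric zero sh = sh
D^-symmetric (suc n) sh = D-symmetric (D^-symmetric n sh)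

δ : ℕ → ℕ → ℕ
δ a l = if a ≡ᵇ l then 1 else 0

occ-∷ : ∀ l a w → occ l (a ∷ w) ≡ δ a l + occ l w
occ-∷ l a w with a ≡ᵇ l
... | true = refl
... | false = refl

occ-∷ʳ : ∀ l w a → occ l (w ++ [ a ]) ≡ occ l w + δ a l
occ-∷ʳ l [] a = trans (occ-∷ l a []) (ℕₚ.+-identityʳ _)
occ-∷ʳ l (b ∷ w) a = begin
  occ l (b ∷ w ++ [ a ])         ≡⟨ occ-∷ l b (w ++ [ a ]) ⟩
  δ b l + occ l (w ++ [ a ])     ≡⟨ cong (λ x → δ b l + x) (occ-∷ʳ l w a) ⟩
  δ b l + (occ l w + δ a l)      ≡⟨ ℕₚ.+-assoc (δ b l) _ _ ⟨
  δ b l + occ l w + δ a l        ≡⟨ cong (_+ δ a l) (occ-∷ l b w) ⟨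
  occ l (b ∷ w) + δ a l          ∎
  where open ≡-Reasoning

occ-above : ∀ l w → maxL w < l → occ l w ≡ 0
occ-above l [] _ = refl
occ-above l (a ∷ w) m<l = trans (occ-∷ l a w) (cong₂ _+_
  (cong (λ b → if b then 1 else 0) (≡ᵇ-false⁺ {a} {l} (λ { refl → ℕₚ.<⇒≱ m<l (ℕₚ.m≤m⊔n a (maxL w)) })))
  (occ-above l w (ℕₚ.≤-<-trans (ℕₚ.m≤n⊔m a (maxL w)) m<l)))

maxL-∷ʳ : ∀ w a → maxL (w ++ [ a ]) ≡ a ⊔ maxL w
maxL-∷ʳ [] a = refl
maxL-∷ʳ (b ∷ w) a = begin
  b ⊔ maxL (w ++ [ a ]) ≡⟨ cong (b ⊔_) (maxL-∷ʳ w a) ⟩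
  b ⊔ (a ⊔ maxL w)      ≡⟨ ℕₚ.⊔-assoc b a _ ⟨
  (b ⊔ a) ⊔ maxL w      ≡⟨ cong (_⊔ maxL w) (ℕₚ.⊔-comm b a) ⟩
  (a ⊔ b) ⊔ maxL w      ≡⟨ ℕₚ.⊔-assoc a b _ ⟩
  a ⊔ (b ⊔ maxL w)      ∎
  where open ≡-Reasoning

applyUpTo-cong-< : ∀ {f g : ℕ → A} n → (∀ {i} → i < n → f i ≡ g i) → applyUpTo f n ≡ applyUpTo g n
applyUpTo-cong-< zero h = refl
applyUpTo-cong-< (suc n) h = cong₂ _∷_ (h (s≤s z≤n)) (applyUpTo-cong-< n (λ i< → h (s≤s i<)))

applyUpTo-cong : ∀ {f g : ℕ → A} → (∀ i → f i ≡ g i) → ∀ n → applyUpTo f n ≡ applyUpTo g n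
applyUpTo-cong h n = applyUpTo-cong-< n (λ {i} _ → h i)

blockSizes : List ℕ → ℕ → List ℕ
blockSizes w = applyUpTo (λ i → occ (suc i) w)

typeP≡ : ∀ w {k} → maxL w ≡ k → typeP w ≡ (blockSizes w k , occ 0 w)
typeP≡ w refl = cong (_, occ 0 w) (Listₚ.map-applyUpTo suc (λ l → occ l w) (maxL w))

∑-bumps-applyUpTo : ∀ n (f : ℕ → ℕ) F →
  ∑ (upTo n) (λ i → F (applyUpTo (λ j → f j + δ i j) n)) ≡ ∑ (bumps (applyUpTo f n)) F
∑-bumps-applyUpTo zero f F = refl
∑-bumps-applyUpTo (suc n) f F = begin
  ∑ (upTo (suc n)) (λ i → F (applyUpTo (λ j → f j + δ i j) (suc n)))
    ≡⟨ ∑-upTo-first n (λ i → F (applyUpTo (λ j → f j + δ i j) (suc n))) ⟩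
  F ((f 0 + 1) ∷ applyUpTo (λ j → f (suc j) + 0) n) +ᶻ
    ∑ (upTo n) (λ i → F ((f 0 + 0) ∷ applyUpTo (λ j → f (suc j) + δ i j) n))
    ≡⟨ cong₂ _+ᶻ_
         (cong₂ (λ x c → F (x ∷ c)) (ℕₚ.+-comm (f 0) 1) (applyUpTo-cong (λ j → ℕₚ.+-identityʳ (f (suc j))) n))
         (trans (∑-cong (upTo n) (λ {i} _ → cong (λ x → F (x ∷ applyUpTo (λ j → f (suc j) + δ i j) n)) (ℕₚ.+-identityʳ (f 0))))
           (∑-bumps-applyUpTo n (f ∘ suc) (λ c → F (f 0 ∷ c)))) ⟩
  F (suc (f 0) ∷ applyUpTo (f ∘ suc) n) +ᶻ ∑ (bumps (applyUpTo (f ∘ suc) n)) (λ c → F (f 0 ∷ c))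
    ≡⟨ ∑-bumps-∷ (f 0) (applyUpTo (f ∘ suc) n) F ⟨
  ∑ (bumps (applyUpTo f (suc n))) F ∎
  where open ≡-Reasoning

blockSizes-∷ʳ : ∀ w a k → blockSizes (w ++ [ a ]) k ≡ applyUpTo (λ j → occ (suc j) w + δ a (suc j)) k
blockSizes-∷ʳ w a k = applyUpTo-cong (λ j → occ-∷ʳ (suc j) w a) k

typeP-zero : ∀ w → typeP (w ++ [ 0 ]) ≡ (proj₁ (typeP w) , suc (proj₂ (typeP w)))
typeP-zero w = begin
  typeP (w ++ [ 0 ])
    ≡⟨ typeP≡ (w ++ [ 0 ]) (maxL-∷ʳ w 0) ⟩
  (blockSizes (w ++ [ 0 ]) (maxL w) , occ 0 (w ++ [ 0 ]))
    ≡⟨ cong₂ _,_ (trans (blockSizes-∷ʳ w 0 (maxL w)) (applyUpTo-cong (λ j → ℕₚ.+-identityʳ _) (maxL w))) (trans (occ-∷ʳ 0 w 0) (ℕₚ.+-comm _ 1)) ⟩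
  (blockSizes w (maxL w) , suc (occ 0 w))
    ≡⟨ cong (λ p → proj₁ p , suc (proj₂ p)) (typeP≡ w refl) ⟨
  (proj₁ (typeP w) , suc (proj₂ (typeP w))) ∎
  where open ≡-Reasoning

typeP-old : ∀ w {i} → i < maxL w →
  typeP (w ++ [ suc i ]) ≡ (applyUpTo (λ j → occ (suc j) w + δ i j) (maxL w) , occ 0 w)
typeP-old w {i} i< = trans (typeP≡ (w ++ [ suc i ]) (trans (maxL-∷ʳ w (suc i)) (ℕₚ.m≤n⇒m⊔n≡n i<)))
  (cong₂ _,_ (blockSizes-∷ʳ w (suc i) (maxL w)) (trans (occ-∷ʳ 0 w (suc i)) (ℕₚ.+-identityʳ _)))

δ-< : ∀ {i j} → j < i → δ i j ≡ 0
δ-< {i} {j} j<i = cong (λ b → if b then 1 else 0) (≡ᵇ-false⁺ {i} {j} (λ { refl → ℕₚ.<-irrefl refl j<i }))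

δ-refl : ∀ i → δ i i ≡ 1
δ-refl i = cong (λ b → if b then 1 else 0) (≡ᵇ-refl i)

typeP-new : ∀ w → typeP (w ++ [ suc (maxL w) ]) ≡ (blockSizes w (maxL w) ++ [ 1 ] , occ 0 w)
typeP-new w = trans (typeP≡ (w ++ [ suc m ]) (trans (maxL-∷ʳ w (suc m)) (ℕₚ.m≥n⇒m⊔n≡m (ℕₚ.n≤1+n m))))
  (cong₂ _,_ sizes (trans (occ-∷ʳ 0 w (suc m)) (ℕₚ.+-identityʳ _)))
  where
  open ≡-Reasoning
  m = maxL w
  sizes : blockSizes (w ++ [ suc m ]) (suc m) ≡ blockSizes w m ++ [ 1 ]
  sizes = begin
    blockSizes (w ++ [ suc m ]) (suc m)
      ≡⟨ blockSizes-∷ʳ w (suc m) (suc m) ⟩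
    applyUpTo (λ j → occ (suc j) w + δ m j) (suc m)
      ≡⟨ Listₚ.applyUpTo-∷ʳ _ m ⟨
    applyUpTo (λ j → occ (suc j) w + δ m j) m ++ [ occ (suc m) w + δ m m ]
      ≡⟨ cong₂ (λ c x → c ++ [ x ])
           (applyUpTo-cong-< m (λ {j} j< → trans (cong (λ x → occ (suc j) w + x) (δ-< j<)) (ℕₚ.+-identityʳ _)))
           (cong₂ _+_ (occ-above (suc m) w ℕₚ.≤-refl) (δ-refl m)) ⟩
    blockSizes w m ++ [ 1 ] ∎

-- The three summands of `D` match the three kinds of last letter: 0 enlarges the pointed block, a
-- letter from 1 to m enlarges an old block, and m + 1 opens a block. In the last case the weight
-- grows from m! to (m+1)!, one for each position of the new block among the ordered ones.
∑-typeP-∷ʳ : ∀ h → SymmetricP h → ∀ w → let m = maxL w in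
  ∑ (upTo (suc (suc m))) (λ a → + (maxL (w ++ [ a ]) !) * h (typeP (w ++ [ a ]))) ≡ + (m !) * D h (typeP w)
∑-typeP-∷ʳ h sh w = begin
  ∑ (upTo (suc (suc m))) F
    ≡⟨ trans (∑-upTo-first (suc m) F) (cong (F 0 +ᶻ_) (∑-upTo-last m (F ∘ suc))) ⟩
  F 0 +ᶻ (∑ (upTo m) (F ∘ suc) +ᶻ F (suc m))
    ≡⟨ cong₂ _+ᶻ_ zeroth (cong₂ _+ᶻ_ old new) ⟩
  k * h (c , suc z) +ᶻ (k * ∑ (bumps c) (λ c → h (c , z)) +ᶻ k * ∑ (insertOnes c) (λ c → h (c , z)))
    ≡⟨ factor k _ _ _ ⟩
  k * D h (c , z)
    ≡⟨ cong (λ p → k * D h p) (typeP≡ w refl) ⟨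
  k * D h (typeP w) ∎
  where
  open ≡-Reasoning
  m = maxL w
  k = + (m !)
  c = blockSizes w m
  z = occ 0 w
  F : ℕ → ℤ
  F a = + (maxL (w ++ [ a ]) !) * h (typeP (w ++ [ a ]))
  factor : ∀ k a b c → k * a +ᶻ (k * b +ᶻ k * c) ≡ k * (a +ᶻ b +ᶻ c)
  factor = solve-∀
  zeroth : F 0 ≡ k * h (c , suc z)
  zeroth = cong₂ (λ m p → + (m !) * h p) (maxL-∷ʳ w 0) (trans (typeP-zero w) (cong (λ p → proj₁ p , suc (proj₂ p)) (typeP≡ w refl)))
  old : ∑ (upTo m) (F ∘ suc) ≡ k * ∑ (bumps c) (λ c → h (c , z))
  old = begin
    ∑ (upTo m) (F ∘ suc)
      ≡⟨ ∑-cong (upTo m) (λ {i} i∈ → cong₂ (λ m p → + (m !) * h p)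
           (trans (maxL-∷ʳ w (suc i)) (ℕₚ.m≤n⇒m⊔n≡n (∈-upTo⁻ i∈))) (typeP-old w (∈-upTo⁻ i∈))) ⟩
    ∑ (upTo m) (λ i → k * h (applyUpTo (λ j → occ (suc j) w + δ i j) m , z))
      ≡⟨ ∑-*ˡ k (upTo m) _ ⟩
    k * ∑ (upTo m) (λ i → h (applyUpTo (λ j → occ (suc j) w + δ i j) m , z))
      ≡⟨ cong (k *_) (∑-bumps-applyUpTo m (λ j → occ (suc j) w) (λ c → h (c , z))) ⟩
    k * ∑ (bumps c) (λ c → h (c , z)) ∎
  new : F (suc m) ≡ k * ∑ (insertOnes c) (λ c → h (c , z))
  new = begin
    F (suc m)
      ≡⟨ cong₂ (λ m p → + (m !) * h p) (trans (maxL-∷ʳ w (suc m)) (ℕₚ.m≥n⇒m⊔n≡m (ℕₚ.n≤1+n m))) (typeP-new w) ⟩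
    + (suc m ℕ.* m !) * h (c ++ [ 1 ] , z)
      ≡⟨ cong₂ _*_ (ℤₚ.pos-* (suc m) (m !)) (sh z (↭-sym (Permₚ.∷↭∷ʳ 1 c))) ⟩
    (+ suc m * k) * h (1 ∷ c , z)
      ≡⟨ assoc-comm (+ suc m) k _ ⟩
    k * (+ suc m * h (1 ∷ c , z))
      ≡⟨ cong (λ l → k * (+ suc l * h (1 ∷ c , z))) (Listₚ.length-applyUpTo (λ i → occ (suc i) w) m) ⟨
    k * (+ suc (length c) * h (1 ∷ c , z))
      ≡⟨ cong (k *_) (∑-insertOnes c _ (sh z)) ⟨
    k * ∑ (insertOnes c) (λ c → h (c , z)) ∎
    where
    assoc-comm : ∀ a b c → (a * b) * c ≡ b * (a * c)
    assoc-comm = solve-∀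

∑-rgs-typeP : ∀ h → SymmetricP h → ∀ k w {m} → maxL w ≡ m →
  ∑ (rgs k m) (λ y → + (maxL (w ++ y) !) * h (typeP (w ++ y))) ≡ + (m !) * D^ k h (typeP w)
∑-rgs-typeP h sh zero w refl = trans (ℤₚ.+-identityʳ _) (cong (λ v → + (maxL v !) * h (typeP v)) (Listₚ.++-identityʳ w))
∑-rgs-typeP h sh (suc k) w {m} refl = begin
  ∑ (rgs (suc k) m) G
    ≡⟨ ∑-rgs-suc k m G ⟩
  ∑ (upTo (suc (suc m))) (λ a → ∑ (rgs k (a ⊔ m)) (λ y → G (a ∷ y)))
    ≡⟨ ∑-cong (upTo (suc (suc m))) (λ {a} _ → inner a) ⟩
  ∑ (upTo (suc (suc m))) (λ a → + (maxL (w ++ [ a ]) !) * D^ k h (typeP (w ++ [ a ])))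
    ≡⟨ ∑-typeP-∷ʳ (D^ k h) (D^-symmetric k sh) w ⟩
  + (m !) * D (D^ k h) (typeP w) ∎
  where
  open ≡-Reasoning
  G : List ℕ → ℤ
  G y = + (maxL (w ++ y) !) * h (typeP (w ++ y))
  inner : ∀ a → ∑ (rgs k (a ⊔ m)) (λ y → G (a ∷ y)) ≡ + (maxL (w ++ [ a ]) !) * D^ k h (typeP (w ++ [ a ]))
  inner a = trans (∑-cong (rgs k (a ⊔ m)) (λ {y} _ → cong (λ v → + (maxL v !) * h (typeP v)) (sym (Listₚ.++-assoc w [ a ] y))))
    (trans (∑-rgs-typeP h sh k (w ++ [ a ]) (maxL-∷ʳ w a)) (cong (λ l → + (l !) * D^ k h (typeP (w ++ [ a ]))) (sym (maxL-∷ʳ w a))))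

-- Ordered pointed partitions, counted by permutations

Unique-resp-↭ : ∀ {xs ys : List A} → xs ↭ ys → Unique xs → Unique ys
Unique-resp-↭ {A} p = PermSetoidₚ.Unique-resp-↭ (setoid A) (Perm.↭⇒↭ₛ p)

∈⇒↭ : ∀ {x : A} {xs} → x ∈ xs → ∃[ ys ] xs ↭ x ∷ ys
∈⇒↭ {x = x} x∈ with as , bs , refl ← ∈-∃++ x∈ = as ++ bs , Permₚ.shift x as bs

∈-drop-∷ : ∀ {x y : A} {xs ys} → x ≢ y → xs ↭ x ∷ ys → y ∈ xs → y ∈ ys
∈-drop-∷ x≢y p y∈ with Permₚ.∈-resp-↭ p y∈
... | here refl = ⊥-elim (x≢y refl)
... | there y∈ys = y∈ys

unique-⊆-length : ∀ {xs ys : List A} → Unique xs → (∀ {z} → z ∈ xs → z ∈ ys) → length xs ≤ length ys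
unique-⊆-length {xs = []} _ _ = z≤n
unique-⊆-length {xs = x ∷ xs} {ys} (x∉ ∷ u) sub with zs , p ← ∈⇒↭ (sub (here refl)) =
  subst (suc (length xs) ≤_) (sym (Permₚ.↭-length p))
    (s≤s (unique-⊆-length u (λ z∈ → ∈-drop-∷ (All.lookup x∉ z∈) p (sub (there z∈)))))

unique-↭ : ∀ {xs ys : List A} → Unique xs → Unique ys →
  (∀ {z} → z ∈ xs → z ∈ ys) → (∀ {z} → z ∈ ys → z ∈ xs) → xs ↭ ys
unique-↭ {xs = []} {[]} _ _ _ _ = ↭-refl
unique-↭ {xs = []} {y ∷ ys} _ _ _ sup with () ← sup (here refl)
unique-↭ {xs = x ∷ xs} {ys} (x∉ ∷ u) v sub sup with zs , p ← ∈⇒↭ (sub (here refl)) with x∉zs ∷ w ← Unique-resp-↭ p v =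
  ↭-trans (prep x (unique-↭ u w (λ z∈ → ∈-drop-∷ (All.lookup x∉ z∈) p (sub (there z∈)))
    (λ z∈ → ∈-drop-∷ (All.lookup x∉zs z∈) ↭-refl (sup (Permₚ.∈-resp-↭ (↭-sym p) (there z∈)))))) (↭-sym p)

inserts : ℕ → List ℕ → List (List ℕ)
inserts N [] = (N ∷ []) ∷ []
inserts N (a ∷ w) = (N ∷ a ∷ w) ∷ map (a ∷_) (inserts N w)

inserts-↭ : ∀ {N w v} → v ∈ inserts N w → v ↭ N ∷ w
inserts-↭ {w = []} (here refl) = ↭-refl
inserts-↭ {w = a ∷ w} (here refl) = ↭-refl
inserts-↭ {N} {a ∷ w} (there v∈) with u , u∈ , refl ← ∈-map⁻ (a ∷_) v∈ =
  ↭-trans (prep a (inserts-↭ u∈)) (swap a N ↭-refl)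

∈-inserts : ∀ N as bs → as ++ N ∷ bs ∈ inserts N (as ++ bs)
∈-inserts N [] [] = here refl
∈-inserts N [] (b ∷ bs) = here refl
∈-inserts N (a ∷ as) bs = there (∈-map⁺ (a ∷_) (∈-inserts N as bs))

inserts-unique : ∀ {N} w → N ∉ w → Unique (inserts N w)
inserts-unique [] _ = [] ∷ []
inserts-unique {N} (a ∷ w) N∉ = All.tabulate head-≢ ∷ Uniqueₚ.map⁺ Listₚ.∷-injectiveʳ (inserts-unique w (λ N∈ → N∉ (there N∈)))
  where
  head-≢ : ∀ {v} → v ∈ map (a ∷_) (inserts N w) → N ∷ a ∷ w ≢ v
  head-≢ v∈ refl with _ , _ , eq ← ∈-map⁻ (a ∷_) v∈ = N∉ (here (Listₚ.∷-injectiveˡ eq))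

remove : ℕ → List ℕ → List ℕ
remove N = filterᵇ (λ x → not (x ≡ᵇ N))

remove-∉ : ∀ {N} w → N ∉ w → remove N w ≡ w
remove-∉ [] _ = refl
remove-∉ {N} (a ∷ w) N∉ rewrite ≡ᵇ-false⁺ {a} {N} (λ a≡N → N∉ (here (sym a≡N))) =
  cong (a ∷_) (remove-∉ w (λ N∈ → N∉ (there N∈)))

remove-inserts : ∀ {N} w {v} → N ∉ w → v ∈ inserts N w → remove N v ≡ w
remove-inserts {N} [] _ (here refl) rewrite ≡ᵇ-refl N = refl
remove-inserts {N} (a ∷ w) N∉ (here refl) rewrite ≡ᵇ-refl N = remove-∉ (a ∷ w) N∉
remove-inserts {N} (a ∷ w) N∉ (there v∈) with u , u∈ , refl ← ∈-map⁻ (a ∷_) v∈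
  rewrite ≡ᵇ-false⁺ {a} {N} (λ a≡N → N∉ (here (sym a≡N))) =
  cong (a ∷_) (remove-inserts w (λ N∈ → N∉ (there N∈)) u∈)

distinctᵇ⁻ : ∀ {xs} → distinctᵇ xs ≡ true → Unique xs
distinctᵇ⁻ {[]} _ = []
distinctᵇ⁻ {x ∷ xs} h with n , d ← ∧-true⁻ {not (any (x ≡ᵇ_) xs)} h =
  All.tabulate (λ y∈ x≡y → not-true⁻ n (any-true⁺ y∈ (≡ᵇ-true⁺ x≡y))) ∷ distinctᵇ⁻ d

distinctᵇ⁺ : ∀ {xs} → Unique xs → distinctᵇ xs ≡ true
distinctᵇ⁺ [] = refl
distinctᵇ⁺ {x ∷ xs} (x∉ ∷ u) = ∧-true⁺
  (not-true⁺ λ h → let y , y∈ , e = any-true⁻ xs h in All.lookup x∉ y∈ (≡ᵇ-true⁻ e)) (distinctᵇ⁺ u)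

∈-words⁻ : ∀ n k {w} → w ∈ words n k → length w ≡ k × (∀ {x} → x ∈ w → x < n)
∈-words⁻ n zero (here refl) = refl , λ ()
∈-words⁻ n (suc k) w∈ with a , v , refl , a∈ , v∈ ← ∈-concatMap-map⁻ (λ _ → words n k) {upTo n} w∈ with l , b ← ∈-words⁻ n k v∈ =
  cong suc l , λ { (here refl) → ∈-upTo⁻ a∈ ; (there x∈) → b x∈ }

∈-words⁺ : ∀ n {w} → (∀ {x} → x ∈ w → x < n) → w ∈ words n (length w)
∈-words⁺ n {[]} _ = here refl
∈-words⁺ n {a ∷ w} b = ∈-concatMap-map⁺ (λ _ → words n (length w)) (∈-upTo⁺ (b (here refl))) (∈-words⁺ n (λ x∈ → b (there x∈)))

words-unique : ∀ n k → Unique (words n k)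
words-unique n zero = [] ∷ []
words-unique n (suc k) = concatMap-map-unique (Uniqueₚ.upTo⁺ n) (λ _ → words-unique n k)

perms-unique : ∀ n → Unique (perms n)
perms-unique n = Uniqueₚ.filter⁺ (T? ∘ distinctᵇ) (words-unique n n)

∈-perms⁻ : ∀ n {w} → w ∈ perms n → length w ≡ n × (∀ {x} → x ∈ w → x < n) × Unique w
∈-perms⁻ n w∈ with w∈ws , d ← ∈-filterᵇ⁻ distinctᵇ {words n n} w∈ with l , b ← ∈-words⁻ n n w∈ws = l , b , distinctᵇ⁻ d

∈-perms⁺ : ∀ {n w} → length w ≡ n → (∀ {x} → x ∈ w → x < n) → Unique w → w ∈ perms n
∈-perms⁺ {n} refl b u = ∈-filter⁺ (T? ∘ distinctᵇ) (∈-words⁺ n b) (≡true⇒T (distinctᵇ⁺ u))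

-- Both lists are free of duplicates, so it suffices to compare members. On the right this holds
-- because deleting the letter n recovers the permutation into which it was inserted.
perms-suc : ∀ n → perms (suc n) ↭ concatMap (inserts n) (perms n)
perms-suc n = unique-↭ (perms-unique (suc n))
  (concatMap-unique (perms-unique n) (λ w∈ → inserts-unique _ (n∉ w∈))
    (λ x∈ y∈ v∈x v∈y → trans (sym (remove-inserts _ (n∉ x∈) v∈x)) (remove-inserts _ (n∉ y∈) v∈y)))
  to from
  where
  n∉ : ∀ {w} → w ∈ perms n → n ∉ w
  n∉ w∈ n∈w = ℕₚ.<-irrefl refl (proj₁ (proj₂ (∈-perms⁻ n w∈)) n∈w)

  n∈ : ∀ {w} → w ∈ perms (suc n) → n ∈ w
  n∈ {w} w∈ with l , b , u ← ∈-perms⁻ (suc n) w∈ with n ∈? w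
  ... | yes n∈w = n∈w
  -- Pigeonhole: without the letter n, the n + 1 distinct letters would all lie in `upTo n`.
  ... | no n∉w = ⊥-elim (ℕₚ.<-irrefl refl (subst (_≤ n) l (subst (length w ≤_) (Listₚ.length-upTo n)
      (unique-⊆-length u λ x∈ → ∈-upTo⁺ (ℕₚ.≤∧≢⇒< (ℕₚ.≤-pred (b x∈)) (λ { refl → n∉w x∈ }))))))

  to : ∀ {w} → w ∈ perms (suc n) → w ∈ concatMap (inserts n) (perms n)
  to w∈ with as , bs , refl ← ∈-∃++ (n∈ w∈) with l , b , u ← ∈-perms⁻ (suc n) w∈
    with n∉asbs ∷ u′ ← Unique-resp-↭ (Permₚ.shift n as bs) u =
    ∈-concatMap⁺ (inserts n) (lose (∈-perms⁺ (ℕₚ.suc-injective (trans (sym (Permₚ.↭-length (Permₚ.shift n as bs))) l))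
      (λ {x} x∈ → ℕₚ.≤∧≢⇒< (ℕₚ.≤-pred (b (Permₚ.∈-resp-↭ (↭-sym (Permₚ.shift n as bs)) (there x∈)))) (λ x≡n → All.lookup n∉asbs x∈ (sym x≡n)))
      u′) (∈-inserts n as bs))

  from : ∀ {w} → w ∈ concatMap (inserts n) (perms n) → w ∈ perms (suc n)
  from {w} w∈ with v , v∈ , w∈v ← find (∈-concatMap⁻ (inserts n) {perms n} w∈) with l , b , u ← ∈-perms⁻ n v∈ =
    ∈-perms⁺ (trans (Permₚ.↭-length p) (cong suc l)) bound
      (Unique-resp-↭ (↭-sym p) (All.tabulate (λ { x∈ refl → n∉ v∈ x∈ }) ∷ u))
    where
    p = inserts-↭ w∈v
    bound : ∀ {x} → x ∈ w → x < suc n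
    bound x∈ with Permₚ.∈-resp-↭ p x∈
    ... | here refl = ℕₚ.n<1+n n
    ... | there x∈v = ℕₚ.m<n⇒m<1+n (b x∈v)

prefix : ℕ → (PIP → ℤ) → PIP → ℤ
prefix s h p = h (s ∷ proj₁ p , proj₂ p)

-- The sum of h over the pointed compositions of the word a ∷ w, its first s letters (a being the last of them) forming
-- the beginning of the first block, that have a bar at every descent.
barSum : (PIP → ℤ) → ℕ → ℕ → List ℕ → ℤ
barSum h s a [] = h ([] , s) +ᶻ h (s ∷ [] , 0)
barSum h s a (b ∷ w) = 𝟙 (not (b <ᵇ a)) * barSum h (suc s) b w +ᶻ barSum (prefix s h) 1 b w

-- The letters after the last bar form the pointed block. It may be empty, since `barSum` also
-- allows a bar after the last letter.
Φ : (PIP → ℤ) → List ℕ → ℤ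
Φ h [] = h ([] , 0)
Φ h (a ∷ w) = barSum h 1 a w

barSum-+ : ∀ h k s a w → barSum (λ p → h p +ᶻ k p) s a w ≡ barSum h s a w +ᶻ barSum k s a w
barSum-+ h k s a [] = lemma (h ([] , s)) (k ([] , s)) (h (s ∷ [] , 0)) (k (s ∷ [] , 0))
  where
  lemma : ∀ a b c d → (a +ᶻ b) +ᶻ (c +ᶻ d) ≡ (a +ᶻ c) +ᶻ (b +ᶻ d)
  lemma = solve-∀
barSum-+ h k s a (b ∷ w) = trans
  (cong₂ (λ x y → 𝟙 (not (b <ᵇ a)) * x +ᶻ y) (barSum-+ h k (suc s) b w) (barSum-+ (prefix s h) (prefix s k) 1 b w))
  (lemma (𝟙 (not (b <ᵇ a))) _ _ _ _)
  where
  lemma : ∀ t a b c d → t * (a +ᶻ b) +ᶻ (c +ᶻ d) ≡ (t * a +ᶻ c) +ᶻ (t * b +ᶻ d)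
  lemma = solve-∀

barSum-cong : ∀ {h k} → (∀ p → h p ≡ k p) → ∀ s a w → barSum h s a w ≡ barSum k s a w
barSum-cong e s a [] = cong₂ _+ᶻ_ (e _) (e _)
barSum-cong e s a (b ∷ w) = cong₂ (λ x y → 𝟙 (not (b <ᵇ a)) * x +ᶻ y) (barSum-cong e (suc s) b w) (barSum-cong (λ p → e _) 1 b w)

-- The summands of D h in which the new element does not form a new first block.
D′ : (PIP → ℤ) → PIP → ℤ
D′ h ([] , z) = h ([] , suc z)
D′ h (x ∷ c , z) = h (suc x ∷ c , z) +ᶻ D (prefix x h) (c , z)

D-split : ∀ h p → D h p ≡ prefix 1 h p +ᶻ D′ h p
D-split h ([] , z) = lemma (h ([] , suc z)) (h (1 ∷ [] , z))
  where
  lemma : ∀ a b → a +ᶻ 0ℤ +ᶻ (b +ᶻ 0ℤ) ≡ b +ᶻ a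
  lemma = solve-∀
D-split h (x ∷ c , z)
  rewrite ∑-map (x ∷_) (bumps c) (λ c → h (c , z)) | ∑-map (x ∷_) (insertOnes c) (λ c → h (c , z)) =
  lemma (h (x ∷ c , suc z)) (h (suc x ∷ c , z)) _ (h (1 ∷ x ∷ c , z)) _
  where
  lemma : ∀ a b s c t → a +ᶻ (b +ᶻ s) +ᶻ (c +ᶻ t) ≡ c +ᶻ (b +ᶻ (a +ᶻ s +ᶻ t))
  lemma = solve-∀

barSum-max : ∀ h s {N b} w → b < N → barSum h s N (b ∷ w) ≡ barSum (prefix s h) 1 b w
barSum-max h s w b<N rewrite <ᵇ-true⁺ b<N = ℤₚ.+-identityˡ _

-- Blocks are increasing, so the largest letter ends its block. Placed between `a` and `b`, it
-- forces a bar before `b`, while the bar before it is optional: without that bar it enlarges the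
-- block of `a`, with it it is a new singleton block. Each way of adding an element arises once,
-- except a new first block, which would need N in front of the whole word; hence `D′`.
∑-inserts-barSum : ∀ N h s a w → (∀ {x} → x ∈ a ∷ w → x < N) →
  ∑ (inserts N w) (barSum h s a) ≡ barSum (D′ h) s a w
∑-inserts-barSum N h s a [] b rewrite <ᵇ-false⁺ (ℕₚ.<⇒≤ (b (here refl))) =
  lemma (h ([] , suc s)) (h (suc s ∷ [] , 0)) (h (s ∷ [] , 1)) (h (s ∷ 1 ∷ [] , 0))
  where
  lemma : ∀ x y z t → (1ℤ * (x +ᶻ y) +ᶻ (z +ᶻ t)) +ᶻ 0ℤ ≡ x +ᶻ (y +ᶻ (z +ᶻ 0ℤ +ᶻ (t +ᶻ 0ℤ)))
  lemma = solve-∀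
∑-inserts-barSum N h s a (b ∷ w) bd = begin
  barSum h s a (N ∷ b ∷ w) +ᶻ ∑ (map (b ∷_) (inserts N w)) (barSum h s a)
    ≡⟨ cong₂ _+ᶻ_ first rest ⟩
  (barSum (prefix (suc s) h) 1 b w +ᶻ barSum (prefix 1 (prefix s h)) 1 b w) +ᶻ
  (t * barSum (D′ h) (suc s) b w +ᶻ barSum (D′ (prefix s h)) 1 b w)
    ≡⟨ rearrange (barSum (prefix (suc s) h) 1 b w) (barSum (prefix 1 (prefix s h)) 1 b w) (t * barSum (D′ h) (suc s) b w) _ ⟩
  t * barSum (D′ h) (suc s) b w +ᶻ
  (barSum (prefix (suc s) h) 1 b w +ᶻ (barSum (prefix 1 (prefix s h)) 1 b w +ᶻ barSum (D′ (prefix s h)) 1 b w))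
    ≡⟨ cong (t * barSum (D′ h) (suc s) b w +ᶻ_) (begin
         barSum (prefix (suc s) h) 1 b w +ᶻ (barSum (prefix 1 (prefix s h)) 1 b w +ᶻ barSum (D′ (prefix s h)) 1 b w)
           ≡⟨ cong (barSum (prefix (suc s) h) 1 b w +ᶻ_) (barSum-+ (prefix 1 (prefix s h)) (D′ (prefix s h)) 1 b w) ⟨
         barSum (prefix (suc s) h) 1 b w +ᶻ barSum (λ p → prefix 1 (prefix s h) p +ᶻ D′ (prefix s h) p) 1 b w
           ≡⟨ cong (barSum (prefix (suc s) h) 1 b w +ᶻ_) (barSum-cong (D-split (prefix s h)) 1 b w) ⟨
         barSum (prefix (suc s) h) 1 b w +ᶻ barSum (D (prefix s h)) 1 b w
           ≡⟨ barSum-+ (prefix (suc s) h) (D (prefix s h)) 1 b w ⟨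
         barSum (prefix s (D′ h)) 1 b w ∎) ⟩
  t * barSum (D′ h) (suc s) b w +ᶻ barSum (prefix s (D′ h)) 1 b w ∎
  where
  open ≡-Reasoning
  t = 𝟙 (not (b <ᵇ a))
  rearrange : ∀ p q r u → (p +ᶻ q) +ᶻ (r +ᶻ u) ≡ r +ᶻ (p +ᶻ (q +ᶻ u))
  rearrange = solve-∀
  b<N : b < N
  b<N = bd (there (here refl))
  first : barSum h s a (N ∷ b ∷ w) ≡ barSum (prefix (suc s) h) 1 b w +ᶻ barSum (prefix 1 (prefix s h)) 1 b w
  first rewrite <ᵇ-false⁺ (ℕₚ.<⇒≤ (bd (here refl))) =
    cong₂ _+ᶻ_ (trans (ℤₚ.*-identityˡ _) (barSum-max h (suc s) w b<N)) (barSum-max (prefix s h) 1 w b<N)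
  rest : ∑ (map (b ∷_) (inserts N w)) (barSum h s a) ≡ t * barSum (D′ h) (suc s) b w +ᶻ barSum (D′ (prefix s h)) 1 b w
  rest = begin
    ∑ (map (b ∷_) (inserts N w)) (barSum h s a)
      ≡⟨ ∑-map (b ∷_) (inserts N w) (barSum h s a) ⟩
    ∑ (inserts N w) (λ v → t * barSum h (suc s) b v +ᶻ barSum (prefix s h) 1 b v)
      ≡⟨ ∑-+ (inserts N w) (λ v → t * barSum h (suc s) b v) (barSum (prefix s h) 1 b) ⟩
    ∑ (inserts N w) (λ v → t * barSum h (suc s) b v) +ᶻ ∑ (inserts N w) (barSum (prefix s h) 1 b)
      ≡⟨ cong₂ _+ᶻ_ (trans (∑-*ˡ t (inserts N w) (barSum h (suc s) b)) (cong (t *_) (∑-inserts-barSum N h (suc s) b w (λ x∈ → bd (there x∈)))))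
           (∑-inserts-barSum N (prefix s h) 1 b w (λ x∈ → bd (there x∈))) ⟩
    t * barSum (D′ h) (suc s) b w +ᶻ barSum (D′ (prefix s h)) 1 b w ∎

∑-inserts-Φ : ∀ N h w → (∀ {x} → x ∈ w → x < N) → ∑ (inserts N w) (Φ h) ≡ Φ (D h) w
∑-inserts-Φ N h [] _ = lemma (h ([] , 1)) (h (1 ∷ [] , 0))
  where
  lemma : ∀ a b → (a +ᶻ b) +ᶻ 0ℤ ≡ a +ᶻ 0ℤ +ᶻ (b +ᶻ 0ℤ)
  lemma = solve-∀
∑-inserts-Φ N h (a ∷ w) b = begin
  barSum h 1 N (a ∷ w) +ᶻ ∑ (map (a ∷_) (inserts N w)) (Φ h)
    ≡⟨ cong₂ _+ᶻ_ (barSum-max h 1 w (b (here refl))) (trans (∑-map (a ∷_) (inserts N w) (Φ h)) (∑-inserts-barSum N h 1 a w b)) ⟩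
  barSum (prefix 1 h) 1 a w +ᶻ barSum (D′ h) 1 a w
    ≡⟨ barSum-+ (prefix 1 h) (D′ h) 1 a w ⟨
  barSum (λ p → prefix 1 h p +ᶻ D′ h p) 1 a w
    ≡⟨ barSum-cong (D-split h) 1 a w ⟨
  barSum (D h) 1 a w ∎
  where open ≡-Reasoning

∑-perms-Φ : ∀ n h → ∑ (perms n) (Φ h) ≡ D^ n h ([] , 0)
∑-perms-Φ zero h = ℤₚ.+-identityʳ _
∑-perms-Φ (suc n) h = begin
  ∑ (perms (suc n)) (Φ h)
    ≡⟨ ∑-↭ (Φ h) (perms-suc n) ⟩
  ∑ (concatMap (inserts n) (perms n)) (Φ h)
    ≡⟨ ∑-concatMap (inserts n) (perms n) (Φ h) ⟩
  ∑ (perms n) (λ w → ∑ (inserts n w) (Φ h))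
    ≡⟨ ∑-cong (perms n) (λ w∈ → ∑-inserts-Φ n h _ (proj₁ (proj₂ (∈-perms⁻ n w∈)))) ⟩
  ∑ (perms n) (Φ (D h))
    ≡⟨ ∑-perms-Φ n (D h) ⟩
  D^ n (D h) ([] , 0)
    ≡⟨ cong (λ k → k ([] , 0)) (D^-D n h) ⟩
  D (D^ n h) ([] , 0) ∎
  where open ≡-Reasoning

-- The order on pointed integer partitions

insert-comm-< : ∀ {x y} zs → x < y → insert x (insert y zs) ≡ insert y (insert x zs)
insert-comm-< {x} {y} [] x<y rewrite <ᵇ-true⁺ x<y | <ᵇ-false⁺ (ℕₚ.<⇒≤ x<y) = refl
insert-comm-< {x} {y} (z ∷ zs) x<y with ℕₚ.<-≤-connex z x
... | inj₁ z<x rewrite <ᵇ-true⁺ z<x | <ᵇ-true⁺ (ℕₚ.<-trans z<x x<y) | <ᵇ-true⁺ z<x = cong (z ∷_) (insert-comm-< zs x<y)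
... | inj₂ x≤z rewrite <ᵇ-false⁺ x≤z | <ᵇ-true⁺ x<y with ℕₚ.<-≤-connex z y
...   | inj₁ z<y rewrite <ᵇ-true⁺ z<y | <ᵇ-false⁺ x≤z = refl
...   | inj₂ y≤z rewrite <ᵇ-false⁺ y≤z | <ᵇ-false⁺ (ℕₚ.<⇒≤ x<y) = refl

insert-comm : ∀ x y zs → insert x (insert y zs) ≡ insert y (insert x zs)
insert-comm x y zs with ℕₚ.<-cmp x y
... | tri< x<y _ _ = insert-comm-< zs x<y
... | tri≈ _ refl _ = refl
... | tri> _ _ y<x = sym (insert-comm-< zs y<x)

insert-↭ : ∀ x ys → insert x ys ↭ x ∷ ys
insert-↭ x [] = ↭-refl
insert-↭ x (y ∷ ys) with y <ᵇ x
... | true = ↭-trans (prep y (insert-↭ x ys)) (swap y x ↭-refl)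
... | false = ↭-refl

sort-↭ : ∀ xs → sort xs ↭ xs
sort-↭ [] = ↭-refl
sort-↭ (x ∷ xs) = ↭-trans (insert-↭ x (sort xs)) (prep x (sort-↭ xs))

sort-cong : ∀ {xs ys} → xs ↭ ys → sort xs ≡ sort ys
sort-cong Perm.refl = refl
sort-cong (prep x p) = cong (insert x) (sort-cong p)
sort-cong (swap {xs} x y p) = trans (insert-comm x y (sort xs)) (cong (λ zs → insert y (insert x zs)) (sort-cong p))
sort-cong (Perm.trans p q) = trans (sort-cong p) (sort-cong q)

≡ᴾ⁻ : ∀ {p q} → p ≡ᴾ q ≡ true → proj₁ p ↭ proj₁ q × proj₂ p ≡ proj₂ q
≡ᴾ⁻ {a , m} {b , m′} h with s , e ← ∧-true⁻ {sort a ≡ᴸ sort b} h =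
  ↭-trans (↭-sym (sort-↭ a)) (subst (_↭ b) (sym (≡ᴸ-true⁻ s)) (sort-↭ b)) , ≡ᵇ-true⁻ e

≡ᴾ⁺ : ∀ {p q} → proj₁ p ↭ proj₁ q → proj₂ p ≡ proj₂ q → p ≡ᴾ q ≡ true
≡ᴾ⁺ p e = ∧-true⁺ (≡ᴸ-true⁺ (sort-cong p)) (≡ᵇ-true⁺ e)

≡ᴾ-congʳ : ∀ p {c c′} z → c ↭ c′ → p ≡ᴾ (c , z) ≡ p ≡ᴾ (c′ , z)
≡ᴾ-congʳ p z q rewrite sort-cong q = refl

any-cong : ∀ {p q : A → Bool} → (∀ x → p x ≡ q x) → ∀ xs → any p xs ≡ any q xs
any-cong h [] = refl
any-cong h (x ∷ xs) = cong₂ _∨_ (h x) (any-cong h xs)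

-- The target is inspected only by `≡ᴾ`, which sorts it. This is the source of the symmetry of
-- `filterTerm`.
reach-congʳ : ∀ f p {c c′} z → c ↭ c′ → reach f p (c , z) ≡ reach f p (c′ , z)
reach-congʳ zero p z q = ≡ᴾ-congʳ p z q
reach-congʳ (suc f) p z q = cong₂ _∨_ (≡ᴾ-congʳ p z q) (any-cong (λ r → reach-congʳ f r z q) (covers p))

∈-picks⁻ : ∀ {x : A} {r} ps → (x , r) ∈ picks ps → ps ↭ x ∷ r
∈-picks⁻ (p ∷ ps) (here refl) = ↭-refl
∈-picks⁻ (p ∷ ps) (there x∈) with (y , s) , ys∈ , refl ← ∈-map⁻ _ x∈ = ↭-trans (prep p (∈-picks⁻ ps ys∈)) (swap p y ↭-refl)

∈-picks⁺ : ∀ {x : A} {ps} → x ∈ ps → ∃[ r ] (x , r) ∈ picks ps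
∈-picks⁺ {ps = p ∷ ps} (here refl) = ps , here refl
∈-picks⁺ {ps = p ∷ ps} (there x∈) with r , xr∈ ← ∈-picks⁺ x∈ = p ∷ r , there (∈-map⁺ _ xr∈)

picks-↭ : ∀ {x : A} {ps r} → ps ↭ x ∷ r → ∃[ r′ ] (x , r′) ∈ picks ps × r′ ↭ r
picks-↭ {ps = ps} p with r′ , xr∈ ← ∈-picks⁺ (Permₚ.∈-resp-↭ (↭-sym p) (here refl)) =
  r′ , xr∈ , Permₚ.drop-∷ (↭-trans (↭-sym (∈-picks⁻ ps xr∈)) p)

data Step : PIP → PIP → Set where
  merge : ∀ {ps qs m} x y r → ps ↭ x ∷ y ∷ r → qs ↭ (x + y) ∷ r → Step (ps , m) (qs , m)
  absorb : ∀ {ps qs m m′} x → ps ↭ x ∷ qs → m′ ≡ m + x → Step (ps , m) (qs , m′)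

covers-sound : ∀ {p q} → q ∈ covers p → Step p q
covers-sound {ps , m} q∈ with ∈-++⁻ (concatMap _ (picks ps)) q∈
... | inj₁ q∈ˡ with (x , r) , xr∈ , q∈x ← find (∈-concatMap⁻ _ {picks ps} q∈ˡ) with (y , r′) , yr∈ , refl ← ∈-map⁻ _ q∈x =
  merge x y r′ (↭-trans (∈-picks⁻ ps xr∈) (prep x (∈-picks⁻ r yr∈))) ↭-refl
covers-sound {ps , m} q∈ | inj₂ q∈ʳ with (x , r) , xr∈ , refl ← ∈-map⁻ _ q∈ʳ = absorb x (∈-picks⁻ ps xr∈) refl

covers-complete : ∀ {p q} → Step p q → ∃[ q′ ] q′ ∈ covers p × proj₁ q′ ↭ proj₁ q × proj₂ q′ ≡ proj₂ q
covers-complete {ps , m} (merge x y r p e) with r₁ , xr∈ , e₁ ← picks-↭ p with r₂ , yr∈ , e₂ ← picks-↭ e₁ =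
  ((x + y) ∷ r₂ , m) , ∈-++⁺ˡ (∈-concatMap⁺ _ (lose xr∈ (∈-map⁺ _ yr∈))) , ↭-trans (prep (x + y) e₂) (↭-sym e) , refl
covers-complete {ps , m} (absorb x p refl) with r , xr∈ , e ← picks-↭ p =
  (r , m + x) , ∈-++⁺ʳ (concatMap _ (picks ps)) (∈-map⁺ _ xr∈) , e , refl

data Steps : PIP → PIP → Set where
  done : ∀ {ps qs m m′} → ps ↭ qs → m ≡ m′ → Steps (ps , m) (qs , m′)
  step : ∀ {p q r} → Step p q → Steps q r → Steps p r

Step-↭ˡ : ∀ {ps ps′ m q} → ps′ ↭ ps → Step (ps , m) q → Step (ps′ , m) q
Step-↭ˡ e (merge x y r p q) = merge x y r (↭-trans e p) q
Step-↭ˡ e (absorb x p q) = absorb x (↭-trans e p) q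

Steps-↭ˡ : ∀ {ps ps′ m q} → ps′ ↭ ps → Steps (ps , m) q → Steps (ps′ , m) q
Steps-↭ˡ e (done p q) = done (↭-trans e p) q
Steps-↭ˡ e (step s ss) = step (Step-↭ˡ e s) ss

Steps-trans : ∀ {p q r} → Steps p q → Steps q r → Steps p r
Steps-trans (done p refl) ss = Steps-↭ˡ p ss
Steps-trans (step s ss) ss′ = step s (Steps-trans ss ss′)

Step-∷ : ∀ c {ps qs m m′} → Step (ps , m) (qs , m′) → Step (c ∷ ps , m) (c ∷ qs , m′)
Step-∷ c (merge x y r p q) = merge x y (c ∷ r)
  (↭-trans (prep c p) (↭-trans (swap c x ↭-refl) (prep x (swap c y ↭-refl)))) (↭-trans (prep c q) (swap c (x + y) ↭-refl))
Step-∷ c (absorb x p q) = absorb x (↭-trans (prep c p) (swap c x ↭-refl)) q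

Steps-∷ : ∀ c {ps qs m m′} → Steps (ps , m) (qs , m′) → Steps (c ∷ ps , m) (c ∷ qs , m′)
Steps-∷ c (done p q) = done (prep c p) q
Steps-∷ c (step s ss) = step (Step-∷ c s) (Steps-∷ c ss)

Step-length : ∀ {p q} → Step p q → length (proj₁ p) ≡ suc (length (proj₁ q))
Step-length (merge x y r p q) = trans (Permₚ.↭-length p) (cong suc (sym (Permₚ.↭-length q)))
Step-length (absorb x p q) = Permₚ.↭-length p

reach-complete : ∀ f {p q} → Steps p q → length (proj₁ p) ≤ f → reach f p q ≡ true
reach-complete zero (done p e) _ = ≡ᴾ⁺ p e
reach-complete zero (step s ss) l with () ← subst (_≤ 0) (Step-length s) l
reach-complete (suc f) (done p e) _ = ∨-true⁺ˡ (≡ᴾ⁺ p e)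
reach-complete (suc f) {p} {q} (step s ss) l with (qs , m) , q∈ , e , refl ← covers-complete s =
  ∨-true⁺ʳ {p ≡ᴾ q} (any-true⁺ q∈ (reach-complete f (Steps-↭ˡ e ss)
    (ℕₚ.≤-pred (subst (_≤ suc f) (trans (Step-length s) (cong suc (sym (Permₚ.↭-length e)))) l))))

-- Coloured parts: a part of colour 0 is absorbed by the pointed part, one of colour suc i by the i-th part.
Coloured : Set
Coloured = List (ℕ × ℕ)

weight : ℕ → Coloured → ℕ
weight l [] = 0
weight l ((a , x) ∷ P) = (if a ≡ᵇ l then x else 0) + weight l P

parts : Coloured → List ℕ
parts = map proj₂

nth : List ℕ → ℕ → ℕ
nth [] _ = 0
nth (x ∷ xs) zero = x
nth (x ∷ xs) (suc i) = nth xs i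

-- A witness of p ≤ q that forgets the order in which parts are merged. Since `nth` defaults to 0, a
-- colour beyond the last part of `q` has weight 0 and can only be worn by parts equal to 0.
record Colouring (p q : PIP) : Set where
  constructor colouring
  field
    coloured : Coloured
    parts-↭ : parts coloured ↭ proj₁ p
    weight-0 : proj₂ p + weight 0 coloured ≡ proj₂ q
    weight-suc : ∀ i → weight (suc i) coloured ≡ nth (proj₁ q) i

weight-↭ : ∀ l {P Q} → P ↭ Q → weight l P ≡ weight l Q
weight-↭ l Perm.refl = refl
weight-↭ l (prep (a , x) p) = cong (λ t → (if a ≡ᵇ l then x else 0) + t) (weight-↭ l p)
weight-↭ l (swap {ys = ys} (a , x) (b , y) p) rewrite weight-↭ l p =
  exchange (if a ≡ᵇ l then x else 0) (if b ≡ᵇ l then y else 0) (weight l ys)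
  where
  exchange : ∀ a b c → a + (b + c) ≡ b + (a + c)
  exchange a b c = trans (sym (ℕₚ.+-assoc a b c)) (trans (cong (_+ c) (ℕₚ.+-comm a b)) (ℕₚ.+-assoc b a c))
weight-↭ l (Perm.trans p q) = trans (weight-↭ l p) (weight-↭ l q)

-- Colour 0 belongs to the pointed part and stays; the other colours move up and free colour 1 for a
-- new first part.
shiftColour : ℕ → ℕ
shiftColour zero = zero
shiftColour (suc c) = suc (suc c)

shift : Coloured → Coloured
shift = map (λ p → shiftColour (proj₁ p) , proj₂ p)

parts-shift : ∀ P → parts (shift P) ≡ parts P
parts-shift P = sym (Listₚ.map-∘ P)

weight-shift-0 : ∀ P → weight 0 (shift P) ≡ weight 0 P
weight-shift-0 [] = refl
weight-shift-0 ((zero , x) ∷ P) = cong (λ t → x + t) (weight-shift-0 P)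
weight-shift-0 ((suc c , x) ∷ P) = weight-shift-0 P

weight-shift-1 : ∀ P → weight 1 (shift P) ≡ 0
weight-shift-1 [] = refl
weight-shift-1 ((zero , x) ∷ P) = weight-shift-1 P
weight-shift-1 ((suc c , x) ∷ P) = weight-shift-1 P

weight-shift-suc : ∀ i P → weight (suc (suc i)) (shift P) ≡ weight (suc i) P
weight-shift-suc i [] = refl
weight-shift-suc i ((zero , x) ∷ P) = weight-shift-suc i P
weight-shift-suc i ((suc c , x) ∷ P) = cong (λ t → (if c ≡ᵇ i then x else 0) + t) (weight-shift-suc i P)

paint₁ : List ℕ → Coloured → Coloured
paint₁ A P = map (1 ,_) A ++ shift P

parts-paint₁ : ∀ A P → parts (paint₁ A P) ≡ A ++ parts P
parts-paint₁ [] P = parts-shift P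
parts-paint₁ (x ∷ A) P = cong (x ∷_) (parts-paint₁ A P)

weight-paint₁-0 : ∀ A P → weight 0 (paint₁ A P) ≡ weight 0 P
weight-paint₁-0 [] P = weight-shift-0 P
weight-paint₁-0 (x ∷ A) P = weight-paint₁-0 A P

weight-paint₁-1 : ∀ A P → weight 1 (paint₁ A P) ≡ sum A
weight-paint₁-1 [] P = weight-shift-1 P
weight-paint₁-1 (x ∷ A) P = cong (λ t → x + t) (weight-paint₁-1 A P)

weight-paint₁-suc : ∀ i A P → weight (suc (suc i)) (paint₁ A P) ≡ weight (suc i) P
weight-paint₁-suc i [] P = weight-shift-suc i P
weight-paint₁-suc i (x ∷ A) P = weight-paint₁-suc i A P

colouring-∷ : ∀ {A ps c cs m z} → sum A ≡ c → Colouring (ps , m) (cs , z) → Colouring (A ++ ps , m) (c ∷ cs , z)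
colouring-∷ {A} {ps} {m = m} e (colouring P p w₀ wₛ) = colouring (paint₁ A P)
  (subst (_↭ A ++ ps) (sym (parts-paint₁ A P)) (Permₚ.++⁺ˡ A p))
  (trans (cong (λ t → m + t) (weight-paint₁-0 A P)) w₀)
  λ { zero → trans (weight-paint₁-1 A P) e ; (suc i) → trans (weight-paint₁-suc i A P) (wₛ i) }

-- The inverse of `paint₁`: the parts of colour 1 are taken out, and the higher colours move down by
-- one.
record Peeled (P : Coloured) : Set where
  constructor peeled
  field
    first : List ℕ
    rest : Coloured
    parts-peel : parts P ↭ first ++ parts rest
    sum-first : sum first ≡ weight 1 P
    weight-rest-0 : weight 0 rest ≡ weight 0 P
    weight-rest-suc : ∀ i → weight (suc i) rest ≡ weight (suc (suc i)) P

peel : ∀ P → Peeled P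
peel [] = peeled [] [] ↭-refl refl refl (λ _ → refl)
peel ((c , x) ∷ P) with peel P
peel ((zero , x) ∷ P) | peeled A Q p s w₀ wₛ = peeled A ((0 , x) ∷ Q)
  (↭-trans (prep x p) (↭-sym (Permₚ.shift x A (parts Q)))) s (cong (λ t → x + t) w₀) wₛ
peel ((suc zero , x) ∷ P) | peeled A Q p s w₀ wₛ = peeled (x ∷ A) Q (prep x p) (cong (λ t → x + t) s) w₀ wₛ
peel ((suc (suc c) , x) ∷ P) | peeled A Q p s w₀ wₛ = peeled A ((suc c , x) ∷ Q)
  (↭-trans (prep x p) (↭-sym (Permₚ.shift x A (parts Q)))) s w₀ (λ i → cong (λ t → (if c ≡ᵇ i then x else 0) + t) (wₛ i))

colouring-∷⁻ : ∀ {ps c cs m z} → Colouring (ps , m) (c ∷ cs , z) →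
  ∃[ A ] ∃[ qs ] ps ↭ A ++ qs × sum A ≡ c × Colouring (qs , m) (cs , z)
colouring-∷⁻ {m = m} (colouring P p w₀ wₛ) with peeled A Q q s v₀ vₛ ← peel P =
  A , parts Q , ↭-trans (↭-sym p) q , trans s (wₛ 0) ,
  colouring Q ↭-refl (trans (cong (λ t → m + t) v₀) w₀) (λ i → trans (vₛ i) (wₛ (suc i)))

colouring-[] : ∀ {ps m z} → m + sum ps ≡ z → Colouring (ps , m) ([] , z)
colouring-[] {ps} {m} e = colouring (map (0 ,_) ps) (subst (_↭ ps) (parts-0 ps) ↭-refl)
  (trans (cong (λ t → m + t) (weight-0 ps)) e) (weight-suc ps)
  where
  parts-0 : ∀ ps → ps ≡ parts (map (0 ,_) ps)
  parts-0 ps = trans (sym (Listₚ.map-id ps)) (Listₚ.map-∘ ps)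
  weight-0 : ∀ ps → weight 0 (map (0 ,_) ps) ≡ sum ps
  weight-0 [] = refl
  weight-0 (x ∷ ps) = cong (λ t → x + t) (weight-0 ps)
  weight-suc : ∀ ps i → weight (suc i) (map (0 ,_) ps) ≡ 0
  weight-suc [] i = refl
  weight-suc (x ∷ ps) i = weight-suc ps i

-- All nonzero colours have weight 0 here, so each part wearing one is 0 and the whole sum sits in
-- colour 0.
colouring-[]⁻ : ∀ {ps m z} → Colouring (ps , m) ([] , z) → m + sum ps ≡ z
colouring-[]⁻ {ps} {m} (colouring P p w₀ wₛ) = trans (cong (λ t → m + t) (trans (sym (sum-↭ p)) (total P wₛ))) w₀
  where
  total : ∀ P → (∀ i → weight (suc i) P ≡ 0) → sum (parts P) ≡ weight 0 P
  total [] h = refl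
  total ((zero , x) ∷ P) h = cong (λ t → x + t) (total P h)
  total ((suc c , x) ∷ P) h = trans (cong₂ _+_ x≡0 refl) (total P (λ i → ℕₚ.m+n≡0⇒n≡0 _ (h i)))
    where
    x≡0 : x ≡ 0
    x≡0 = trans (cong (λ b → if b then x else 0) (sym (≡ᵇ-refl c))) (ℕₚ.m+n≡0⇒m≡0 _ (h c))

colouring-id : ∀ qs {m} → Colouring (qs , m) (qs , m)
colouring-id [] = colouring-[] (ℕₚ.+-identityʳ _)
colouring-id (x ∷ qs) = colouring-∷ {x ∷ []} (ℕₚ.+-identityʳ x) (colouring-id qs)

colouring-refl : ∀ {ps qs m} → ps ↭ qs → Colouring (ps , m) (qs , m)
colouring-refl {qs = qs} p with colouring P q w₀ wₛ ← colouring-id qs = colouring P (↭-trans q (↭-sym p)) w₀ wₛ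

-- A cover is undone on the coloured side: the merged part is split into two parts of its own
-- colour, and an absorbed part gets colour 0.
Step-colouring : ∀ {p q r} → Step p q → Colouring q r → Colouring p r
Step-colouring (merge x y r p q) (colouring P e w₀ wₛ)
  with (l , .(x + y)) ∷ Q , refl , P↭ ← Permₚ.↭-map-inv proj₂ (↭-trans e q) =
  colouring ((l , x) ∷ (l , y) ∷ Q) (↭-sym p) (trans (cong (λ t → _ + t) (split 0)) w₀) (λ i → trans (split (suc i)) (wₛ i))
  where
  split : ∀ k → weight k ((l , x) ∷ (l , y) ∷ Q) ≡ weight k P
  split k = trans (lemma (l ≡ᵇ k)) (sym (weight-↭ k P↭))
    where
    lemma : ∀ b → (if b then x else 0) + ((if b then y else 0) + weight k Q) ≡ (if b then x + y else 0) + weight k Q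
    lemma true = sym (ℕₚ.+-assoc x y _)
    lemma false = refl
Step-colouring {_ , m} (absorb x p refl) (colouring P e w₀ wₛ) =
  colouring ((0 , x) ∷ P) (↭-trans (prep x e) (↭-sym p)) (trans (sym (ℕₚ.+-assoc m x _)) w₀) wₛ

reach⁻ : ∀ f {p q} → reach f p q ≡ true → Colouring p q
reach⁻ zero {p} {q} h with e , refl ← ≡ᴾ⁻ {p} {q} h = colouring-refl e
reach⁻ (suc f) {p} {q} h with ∨-true⁻ {p ≡ᴾ q} h
... | inj₁ h′ with e , refl ← ≡ᴾ⁻ {p} {q} h′ = colouring-refl e
... | inj₂ h′ with r , r∈ , h″ ← any-true⁻ (covers p) h′ = Step-colouring (covers-sound r∈) (reach⁻ f h″)

merge-all : ∀ {x A qs m} → Steps (x ∷ A ++ qs , m) (sum (x ∷ A) ∷ qs , m)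
merge-all {x} {[]} {qs} = done (subst (λ y → x ∷ qs ↭ y ∷ qs) (sym (ℕₚ.+-identityʳ x)) ↭-refl) refl
merge-all {x} {y ∷ A} {qs} {m} = step (merge x y (A ++ qs) ↭-refl ↭-refl)
  (subst (λ s → Steps ((x + y) ∷ A ++ qs , m) (s ∷ qs , m)) (ℕₚ.+-assoc x y (sum A)) merge-all)

absorb-all : ∀ {ps m} → Steps (ps , m) ([] , m + sum ps)
absorb-all {[]} {m} = done ↭-refl (sym (ℕₚ.+-identityʳ m))
absorb-all {x ∷ ps} {m} = step (absorb x ↭-refl refl)
  (subst (λ s → Steps (ps , m + x) ([] , s)) (ℕₚ.+-assoc m x (sum ps)) absorb-all)

colouring⇒Steps : ∀ {ps m} cs {z} → All (0 <_) cs → Colouring (ps , m) (cs , z) → Steps (ps , m) (cs , z)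
colouring⇒Steps [] _ C with refl ← colouring-[]⁻ C = absorb-all
colouring⇒Steps (c ∷ cs) (c>0 ∷ pos) C with colouring-∷⁻ C
-- A positive part of the target is not an empty sum, so its colour class has a part with which the
-- merging can begin.
... | [] , _ , _ , refl , _ with () ← c>0
... | x ∷ A , qs , p , refl , C′ =
  Steps-↭ˡ p (Steps-trans (merge-all {x} {A}) (Steps-∷ (x + sum A) (colouring⇒Steps cs pos C′)))

inFilter⁻ : ∀ {p q} → inFilter p q ≡ true → Colouring p q
inFilter⁻ {ps , m} h = reach⁻ (length ps) h

inFilter⁺ : ∀ {p q} → All (0 <_) (proj₁ q) → Colouring p q → inFilter p q ≡ true
inFilter⁺ {ps , m} {cs , z} pos C = reach-complete (length ps) (colouring⇒Steps cs pos C) ℕₚ.≤-refl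

inFilter-congʳ : ∀ p {c c′} z → c ↭ c′ → inFilter p (c , z) ≡ inFilter p (c′ , z)
inFilter-congʳ (ps , m) z q = reach-congʳ (length ps) (ps , m) z q

-- Upward closure of the filter under coarsening of pointed set partitions

recolour : (ℕ → ℕ) → Coloured → Coloured
recolour φ = map (λ p → φ (proj₁ p) , proj₂ p)

parts-recolour : ∀ φ P → parts (recolour φ P) ≡ parts P
parts-recolour φ P = sym (Listₚ.map-∘ P)

maxColour : Coloured → ℕ
maxColour P = maxL (map proj₁ P)

weight-ℤ : ∀ l P → + weight l P ≡ ∑ P (λ p → 𝟙 (proj₁ p ≡ᵇ l) * + proj₂ p)
weight-ℤ l [] = refl
weight-ℤ l ((a , x) ∷ P) = cong₂ _+ᶻ_ (lemma (a ≡ᵇ l)) (weight-ℤ l P)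
  where
  lemma : ∀ b → + (if b then x else 0) ≡ 𝟙 b * + x
  lemma true = sym (ℤₚ.*-identityˡ (+ x))
  lemma false = refl

weight-recolour : ∀ φ l {N} P → (∀ {p} → p ∈ P → proj₁ p < N) →
  + weight l (recolour φ P) ≡ ∑ (upTo N) (λ a → 𝟙 (φ a ≡ᵇ l) * + weight a P)
weight-recolour φ l {N} P bound = begin
  + weight l (recolour φ P)
    ≡⟨ trans (weight-ℤ l (recolour φ P)) (∑-map _ P _) ⟩
  ∑ P (λ p → 𝟙 (φ (proj₁ p) ≡ᵇ l) * + proj₂ p)
    ≡⟨ ∑-cong P expand ⟩
  ∑ P (λ p → ∑ (upTo N) (λ a → 𝟙 (φ a ≡ᵇ l) * (𝟙 (proj₁ p ≡ᵇ a) * + proj₂ p)))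
    ≡⟨ ∑-swap P (upTo N) _ ⟩
  ∑ (upTo N) (λ a → ∑ P (λ p → 𝟙 (φ a ≡ᵇ l) * (𝟙 (proj₁ p ≡ᵇ a) * + proj₂ p)))
    ≡⟨ ∑-cong (upTo N) (λ {a} _ → trans (∑-*ˡ (𝟙 (φ a ≡ᵇ l)) P _) (cong (𝟙 (φ a ≡ᵇ l) *_) (sym (weight-ℤ a P)))) ⟩
  ∑ (upTo N) (λ a → 𝟙 (φ a ≡ᵇ l) * + weight a P) ∎
  where
  open ≡-Reasoning
  expand : ∀ {p} → p ∈ P → 𝟙 (φ (proj₁ p) ≡ᵇ l) * + proj₂ p ≡ ∑ (upTo N) (λ a → 𝟙 (φ a ≡ᵇ l) * (𝟙 (proj₁ p ≡ᵇ a) * + proj₂ p))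
  expand {c , x} p∈ = sym (trans
    (∑-single (λ a → 𝟙 (φ a ≡ᵇ l) * (𝟙 (c ≡ᵇ a) * + x)) (Uniqueₚ.upTo⁺ N) (∈-upTo⁺ (bound p∈))
      (λ {a} _ a≢ → trans (cong (λ b → 𝟙 (φ a ≡ᵇ l) * (𝟙 b * + x)) (≡ᵇ-false⁺ (a≢ ∘ sym))) (ℤₚ.*-zeroʳ (𝟙 (φ a ≡ᵇ l)))))
    (cong (𝟙 (φ c ≡ᵇ l) *_) (trans (cong (λ b → 𝟙 b * + x) (≡ᵇ-refl c)) (ℤₚ.*-identityˡ (+ x)))))

∈-maxColour : ∀ {P p} → p ∈ P → proj₁ p ≤ maxColour P
∈-maxColour {p ∷ P} (here refl) = ℕₚ.m≤m⊔n (proj₁ p) (maxColour P)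
∈-maxColour {q ∷ P} (there p∈) = ℕₚ.≤-trans (∈-maxColour p∈) (ℕₚ.m≤n⊔m (proj₁ q) (maxColour P))

-- The new weight of `l` is the total of the old weights over the fibre of φ at `l`, so it depends
-- on the old weights alone. N lies above all colours of both lists, which makes the fibre sums
-- finite over a common range.
recolour-weight : ∀ φ {P Q} → (∀ l → weight l P ≡ weight l Q) → ∀ l → weight l (recolour φ P) ≡ weight l (recolour φ Q)
recolour-weight φ {P} {Q} h l = ℤₚ.+-injective (begin
  + weight l (recolour φ P)
    ≡⟨ weight-recolour φ l P (λ p∈ → s≤s (ℕₚ.≤-trans (∈-maxColour p∈) (ℕₚ.m≤m⊔n (maxColour P) (maxColour Q)))) ⟩
  ∑ (upTo N) (λ a → 𝟙 (φ a ≡ᵇ l) * + weight a P)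
    ≡⟨ ∑-cong (upTo N) (λ {a} _ → cong (λ k → 𝟙 (φ a ≡ᵇ l) * + k) (h a)) ⟩
  ∑ (upTo N) (λ a → 𝟙 (φ a ≡ᵇ l) * + weight a Q)
    ≡⟨ weight-recolour φ l Q (λ p∈ → s≤s (ℕₚ.≤-trans (∈-maxColour p∈) (ℕₚ.m≤n⊔m (maxColour P) (maxColour Q)))) ⟨
  + weight l (recolour φ Q) ∎)
  where
  open ≡-Reasoning
  N = suc (maxColour P ⊔ maxColour Q)

-- A word is itself a colouring of parts equal to 1, whose weights are the block sizes.
units : List ℕ → Coloured
units = map (_, 1)

occ≡weight : ∀ l w → occ l w ≡ weight l (units w)
occ≡weight l [] = refl
occ≡weight l (a ∷ w) = trans (occ-∷ l a w) (cong (λ t → δ a l + t) (occ≡weight l w))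

units-map : ∀ φ w → units (map φ w) ≡ recolour φ (units w)
units-map φ w = trans (sym (Listₚ.map-∘ w)) (Listₚ.map-∘ w)

nth-applyUpTo : ∀ f n {i} → i < n → nth (applyUpTo f n) i ≡ f i
nth-applyUpTo f (suc n) {zero} _ = refl
nth-applyUpTo f (suc n) {suc i} (s≤s i<n) = nth-applyUpTo (f ∘ suc) n i<n

nth-applyUpTo-≥ : ∀ f n {i} → n ≤ i → nth (applyUpTo f n) i ≡ 0
nth-applyUpTo-≥ f zero _ = refl
nth-applyUpTo-≥ f (suc n) (s≤s n≤i) = nth-applyUpTo-≥ (f ∘ suc) n n≤i

nth-blockSizes : ∀ w i → nth (blockSizes w (maxL w)) i ≡ occ (suc i) w
nth-blockSizes w i with ℕₚ.<-≤-connex i (maxL w)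
... | inj₁ i< = nth-applyUpTo _ (maxL w) i<
... | inj₂ ≤i = trans (nth-applyUpTo-≥ _ (maxL w) ≤i) (sym (occ-above (suc i) w (s≤s ≤i)))

-- The pointed part of `p` is treated as one more part of colour 0, so that a single equation covers
-- the zero block and the other blocks.
record WordColouring (p : PIP) (w : List ℕ) : Set where
  constructor wordColouring
  field
    coloured : Coloured
    parts-↭ : parts coloured ↭ proj₁ p
    weight-occ : ∀ l → weight l ((0 , proj₂ p) ∷ coloured) ≡ occ l w

colouring⇒word : ∀ {p w} → Colouring p (typeP w) → WordColouring p w
colouring⇒word {p} {w} C with colouring P e w₀ wₛ ← subst (Colouring p) (typeP≡ w refl) C =
  wordColouring P e λ { zero → w₀ ; (suc i) → trans (wₛ i) (nth-blockSizes w i) }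

word⇒colouring : ∀ {p w} → WordColouring p w → Colouring p (typeP w)
word⇒colouring {p} {w} (wordColouring P e h) = subst (Colouring p) (sym (typeP≡ w refl))
  (colouring P e (h 0) (λ i → trans (h (suc i)) (sym (nth-blockSizes w i))))

-- Applying φ to the colours does it: the coloured parts and the letters of `z` have equal weights,
-- and recolouring preserves this. Since φ fixes 0, the pointed part keeps its colour.
wordColouring-coarsens : ∀ {p z y} → Coarsens z y → WordColouring p z → WordColouring p y
wordColouring-coarsens {ps , m} {z} (φ , φ0 , refl) (wordColouring P e h) =
  wordColouring (recolour φ P) (subst (_↭ ps) (sym (parts-recolour φ P)) e) λ l → begin
    weight l ((0 , m) ∷ recolour φ P)
      ≡⟨ cong (λ c → weight l ((c , m) ∷ recolour φ P)) φ0 ⟨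
    weight l (recolour φ ((0 , m) ∷ P))
      ≡⟨ recolour-weight φ {(0 , m) ∷ P} {units z} (λ a → trans (h a) (occ≡weight a z)) l ⟩
    weight l (recolour φ (units z))
      ≡⟨ cong (weight l) (units-map φ z) ⟨
    weight l (units (map φ z))
      ≡⟨ occ≡weight l (map φ z) ⟨
    occ l (map φ z) ∎
  where open ≡-Reasoning

RGS-∈ : ∀ mx w {l} → RGS mx w → mx < l → l ≤ maxL w → l ∈ w
RGS-∈ mx [] _ mx<l l≤ with () ← ℕₚ.<-≤-trans mx<l l≤
RGS-∈ mx (a ∷ w) {l} (a≤ , r) mx<l l≤ with ℕₚ.<-≤-connex (a ⊔ mx) l
... | inj₁ a⊔mx<l = there (RGS-∈ (a ⊔ mx) w r a⊔mx<l l≤w)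
  where
  l≤w : l ≤ maxL w
  l≤w with ℕₚ.≤-total a (maxL w)
  ... | inj₁ a≤w = subst (l ≤_) (ℕₚ.m≤n⇒m⊔n≡n a≤w) l≤
  ... | inj₂ w≤a = ⊥-elim (ℕₚ.<⇒≱ (ℕₚ.≤-<-trans (ℕₚ.m≤m⊔n a mx) a⊔mx<l) (subst (l ≤_) (ℕₚ.m≥n⇒m⊔n≡m w≤a) l≤))
... | inj₂ l≤a⊔mx with ≤⊔-cases a≤ l≤a⊔mx
...   | inj₁ l≤mx = ⊥-elim (ℕₚ.<⇒≱ mx<l l≤mx)
...   | inj₂ (refl , refl) = here refl

∈⇒occ>0 : ∀ {l w} → l ∈ w → 0 < occ l w
∈⇒occ>0 {l} {l ∷ w} (here refl) = subst (0 <_) (sym (trans (occ-∷ l l w) (cong (_+ occ l w) (δ-refl l)))) (s≤s z≤n)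
∈⇒occ>0 {l} {a ∷ w} (there l∈) = subst (0 <_) (sym (occ-∷ l a w)) (ℕₚ.<-≤-trans (∈⇒occ>0 l∈) (ℕₚ.m≤n+m _ (δ a l)))

applyUpTo-All : ∀ {Q : ℕ → Set} f n → (∀ {i} → i < n → Q (f i)) → All Q (applyUpTo f n)
applyUpTo-All f zero h = []
applyUpTo-All f (suc n) h = h (s≤s z≤n) ∷ applyUpTo-All (f ∘ suc) n (λ i< → h (s≤s i<))

typeP-positive : ∀ {w} → RGS 0 w → All (0 <_) (proj₁ (typeP w))
typeP-positive {w} r = subst (λ p → All (0 <_) (proj₁ p)) (sym (typeP≡ w refl))
  (applyUpTo-All _ (maxL w) (λ i< → ∈⇒occ>0 (RGS-∈ 0 w r (s≤s z≤n) i<)))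

inFilter-upward : ∀ {p z y} → RGS 0 y → Coarsens z y → inFilter p (typeP z) ≡ true → inFilter p (typeP y) ≡ true
inFilter-upward {p} {z} {y} r c h = inFilter⁺ {p} (typeP-positive r)
  (word⇒colouring {w = y} (wordColouring-coarsens c (colouring⇒word {w = z} (inFilter⁻ {p} h))))

-- Sums of sub-multisets of a knapsack partition

++-cancelˡ-↭ : ∀ (xs : List A) {ys zs} → xs ++ ys ↭ xs ++ zs → ys ↭ zs
++-cancelˡ-↭ [] p = p
++-cancelˡ-↭ (x ∷ xs) p = ++-cancelˡ-↭ xs (Permₚ.drop-∷ p)

-- Sublists with their complements: the complement supplies the next difference in a chain of sums.
splits : List ℕ → List (List ℕ × List ℕ)
splits [] = ([] , []) ∷ []
splits (x ∷ xs) = map (λ s → x ∷ proj₁ s , proj₂ s) (splits xs) ++ map (λ s → proj₁ s , x ∷ proj₂ s) (splits xs)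

splits-↭ : ∀ xs {A R} → (A , R) ∈ splits xs → A ++ R ↭ xs
splits-↭ [] (here refl) = ↭-refl
splits-↭ (x ∷ xs) s∈ with ∈-++⁻ (map _ (splits xs)) s∈
... | inj₁ l with _ , s′∈ , refl ← ∈-map⁻ _ l = prep x (splits-↭ xs s′∈)
... | inj₂ r with (A , R) , s′∈ , refl ← ∈-map⁻ _ r = ↭-trans (Permₚ.shift x A R) (prep x (splits-↭ xs s′∈))

splits-⊆ : ∀ xs {A R} → (A , R) ∈ splits xs → A ⊆ xs
splits-⊆ [] (here refl) = []
splits-⊆ (x ∷ xs) s∈ with ∈-++⁻ (map _ (splits xs)) s∈
... | inj₁ l with _ , s′∈ , refl ← ∈-map⁻ _ l = refl ∷ splits-⊆ xs s′∈
... | inj₂ r with _ , s′∈ , refl ← ∈-map⁻ _ r = x ∷ʳ splits-⊆ xs s′∈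

⊆⇒∈subs : ∀ {A xs} → A ⊆ xs → A ∈ subs xs
⊆⇒∈subs [] = here refl
⊆⇒∈subs {xs = x ∷ xs} (x ∷ʳ s) = ∈-++⁺ˡ (⊆⇒∈subs s)
⊆⇒∈subs {xs = x ∷ xs} (refl ∷ s) = ∈-++⁺ʳ (subs xs) (∈-map⁺ (x ∷_) (⊆⇒∈subs s))

∈subs⇒↭ : ∀ xs {A} → A ∈ subs xs → ∃[ R ] A ++ R ↭ xs
∈subs⇒↭ [] (here refl) = [] , ↭-refl
∈subs⇒↭ (x ∷ xs) {A} A∈ with ∈-++⁻ (subs xs) A∈
... | inj₁ l with R , p ← ∈subs⇒↭ xs l = x ∷ R , ↭-trans (Permₚ.shift x A R) (prep x p)
... | inj₂ r with A′ , A′∈ , refl ← ∈-map⁻ (x ∷_) r with R , p ← ∈subs⇒↭ xs A′∈ = R , prep x p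

splits-complete : ∀ xs A R → A ++ R ↭ xs → ∃[ A′ ] ∃[ R′ ] (A′ , R′) ∈ splits xs × A′ ↭ A × R′ ↭ R
splits-complete [] [] [] p = [] , [] , here refl , ↭-refl , ↭-refl
splits-complete [] [] (r ∷ R) p = ⊥-elim (Permₚ.¬x∷xs↭[] p)
splits-complete [] (a ∷ A) R p = ⊥-elim (Permₚ.¬x∷xs↭[] p)
splits-complete (x ∷ xs) A R p with ∈-++⁻ A (Permₚ.∈-resp-↭ (↭-sym p) (here refl))
... | inj₁ x∈A with A₁ , e ← ∈⇒↭ x∈A
  with A′ , R′ , s∈ , eA , eR ← splits-complete xs A₁ R (Permₚ.drop-∷ (↭-trans (↭-sym (Permₚ.++⁺ʳ R e)) p)) =
  x ∷ A′ , R′ , ∈-++⁺ˡ (∈-map⁺ _ s∈) , ↭-trans (prep x eA) (↭-sym e) , eR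
... | inj₂ x∈R with R₁ , e ← ∈⇒↭ x∈R
  with A′ , R′ , s∈ , eA , eR ← splits-complete xs A R₁
         (Permₚ.drop-∷ (↭-trans (↭-sym (↭-trans (Permₚ.++⁺ˡ A e) (Permₚ.shift x A R₁))) p)) =
  A′ , x ∷ R′ , ∈-++⁺ʳ (map _ (splits xs)) (∈-map⁺ _ s∈) , eA , ↭-trans (prep x eR) (↭-sym e)

↭⇒∈subs : ∀ xs A R → A ++ R ↭ xs → ∃[ A′ ] A′ ∈ subs xs × A′ ↭ A
↭⇒∈subs xs A R p with A′ , R′ , s∈ , eA , _ ← splits-complete xs A R p = A′ , ⊆⇒∈subs (splits-⊆ xs s∈) , eA

∈subs-⊆ : ∀ {xs A x} → A ∈ subs xs → x ∈ A → x ∈ xs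
∈subs-⊆ {xs} A∈ x∈ with R , p ← ∈subs⇒↭ xs A∈ = Permₚ.∈-resp-↭ p (∈-++⁺ˡ x∈)

Unique-++ˡ : ∀ {xs ys : List A} → Unique (xs ++ ys) → Unique xs
Unique-++ˡ {xs = []} _ = []
Unique-++ˡ {xs = x ∷ xs} (x∉ ∷ u) = All.tabulate (λ y∈ → All.lookup x∉ (∈-++⁺ˡ y∈)) ∷ Unique-++ˡ u

∈subs-unique : ∀ {xs A} → Unique xs → A ∈ subs xs → Unique A
∈subs-unique {xs} u A∈ with R , p ← ∈subs⇒↭ xs A∈ = Unique-++ˡ (Unique-resp-↭ (↭-sym p) u)

subs-unique : ∀ {xs} → Unique xs → Unique (subs xs)
subs-unique [] = [] ∷ []
subs-unique {x ∷ xs} (x∉ ∷ u) = Uniqueₚ.++⁺ (subs-unique u) (Uniqueₚ.map⁺ Listₚ.∷-injectiveʳ (subs-unique u)) disjoint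
  where
  disjoint : ∀ {A} → A ∈ subs xs × A ∈ map (x ∷_) (subs xs) → ⊥
  disjoint (l , r) with _ , _ , refl ← ∈-map⁻ (x ∷_) r = All.lookup x∉ (∈subs-⊆ {xs} l (here refl)) refl

subs-↭⇒≡ : ∀ {xs A B} → Unique xs → A ∈ subs xs → B ∈ subs xs → A ↭ B → A ≡ B
subs-↭⇒≡ {[]} _ (here refl) (here refl) _ = refl
subs-↭⇒≡ {x ∷ xs} (x∉ ∷ u) A∈ B∈ p with ∈-++⁻ (subs xs) A∈ | ∈-++⁻ (subs xs) B∈
... | inj₁ a | inj₁ b = subs-↭⇒≡ u a b p
... | inj₁ a | inj₂ b with _ , _ , refl ← ∈-map⁻ (x ∷_) b =
  ⊥-elim (All.lookup x∉ (∈subs-⊆ {xs} a (Permₚ.∈-resp-↭ (↭-sym p) (here refl))) refl)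
... | inj₂ a | inj₁ b with _ , _ , refl ← ∈-map⁻ (x ∷_) a =
  ⊥-elim (All.lookup x∉ (∈subs-⊆ {xs} b (Permₚ.∈-resp-↭ p (here refl))) refl)
... | inj₂ a | inj₂ b with _ , a′ , refl ← ∈-map⁻ (x ∷_) a | _ , b′ , refl ← ∈-map⁻ (x ∷_) b =
  cong (x ∷_) (subs-↭⇒≡ u a′ b′ (Permₚ.drop-∷ p))

unique-⊆⇒↭ : ∀ {U B : List A} → Unique U → (∀ {x} → x ∈ U → x ∈ B) → ∃[ B′ ] B ↭ U ++ B′
unique-⊆⇒↭ {U = []} {B} _ _ = B , ↭-refl
unique-⊆⇒↭ {U = x ∷ U} (x∉ ∷ u) sub with B₁ , e ← ∈⇒↭ (sub (here refl))
  with B′ , e′ ← unique-⊆⇒↭ u (λ y∈ → ∈-drop-∷ (All.lookup x∉ y∈) e (sub (there y∈))) =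
  B′ , ↭-trans e (prep x e′)

sgn : ℕ → ℤ
sgn k = (-ᶻ (+ 1)) ℤ.^ k

sgn-+ : ∀ a b → sgn (a + b) ≡ sgn a * sgn b
sgn-+ a b = ℤₚ.^-distribˡ-+-* (-ᶻ (+ 1)) a b

-- Expansion of the product of 1 - [p x] over x ∈ xs.
∑-subs-sgn : ∀ (p : ℕ → Bool) xs → ∑ (subs xs) (λ U → sgn (length U) * 𝟙 (all p U)) ≡ 𝟙 (all (λ x → not (p x)) xs)
∑-subs-sgn p [] = refl
∑-subs-sgn p (x ∷ xs) = begin
  ∑ (subs xs ++ map (x ∷_) (subs xs)) f
    ≡⟨ ∑-++ (subs xs) _ f ⟩
  ∑ (subs xs) f +ᶻ ∑ (map (x ∷_) (subs xs)) f
    ≡⟨ cong (∑ (subs xs) f +ᶻ_) (trans (∑-map (x ∷_) (subs xs) f) (trans (∑-cong (subs xs) (λ {U} _ → pull U)) (∑-*ˡ (-ᶻ 𝟙 (p x)) (subs xs) f))) ⟩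
  ∑ (subs xs) f +ᶻ -ᶻ 𝟙 (p x) * ∑ (subs xs) f
    ≡⟨ cong (λ s → s +ᶻ -ᶻ 𝟙 (p x) * s) (∑-subs-sgn p xs) ⟩
  𝟙 (all (λ x → not (p x)) xs) +ᶻ -ᶻ 𝟙 (p x) * 𝟙 (all (λ x → not (p x)) xs)
    ≡⟨ final (p x) (𝟙 (all (λ x → not (p x)) xs)) ⟩
  𝟙 (not (p x)) * 𝟙 (all (λ x → not (p x)) xs)
    ≡⟨ 𝟙-∧ (not (p x)) _ ⟨
  𝟙 (all (λ x → not (p x)) (x ∷ xs)) ∎
  where
  open ≡-Reasoning
  f : List ℕ → ℤ
  f U = sgn (length U) * 𝟙 (all p U)
  pull : ∀ U → f (x ∷ U) ≡ -ᶻ 𝟙 (p x) * f U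
  pull U rewrite 𝟙-∧ (p x) (all p U) = lemma (sgn (length U)) (𝟙 (p x)) (𝟙 (all p U))
    where
    lemma : ∀ s a b → (-ᶻ 1ℤ * s) * (a * b) ≡ -ᶻ a * (s * b)
    lemma = solve-∀
  final : ∀ b s → s +ᶻ -ᶻ 𝟙 b * s ≡ 𝟙 (not b) * s
  final true s = lemma s
    where
    lemma : ∀ s → s +ᶻ -ᶻ 1ℤ * s ≡ 0ℤ * s
    lemma = solve-∀
  final false s = lemma s
    where
    lemma : ∀ s → s +ᶻ -ᶻ 0ℤ * s ≡ 1ℤ * s
    lemma = solve-∀

-- Peeled at the lower end, as the position advances in `walk`.
rangeSum : (ℕ → ℤ) → ℕ → ℕ → ℤ
rangeSum f i zero = 0ℤ
rangeSum f i (suc k) = f i +ᶻ rangeSum f (suc i) k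

rangeSum≡∑ : ∀ f i k → rangeSum f i k ≡ ∑ (upTo k) (λ j → f (i + j))
rangeSum≡∑ f i zero = refl
rangeSum≡∑ f i (suc k) = trans
  (cong₂ _+ᶻ_ (cong f (sym (ℕₚ.+-identityʳ i))) (trans (rangeSum≡∑ f (suc i) k) (∑-cong (upTo k) (λ {j} _ → cong f (sym (ℕₚ.+-suc i j))))))
  (sym (∑-upTo-first k (λ j → f (i + j))))

rangeSum-zero : ∀ {f} i k → (∀ {z} → i ≤ z → f z ≡ 0ℤ) → rangeSum f i k ≡ 0ℤ
rangeSum-zero i zero h = refl
rangeSum-zero i (suc k) h rewrite h (ℕₚ.≤-refl {i}) = trans (ℤₚ.+-identityˡ _) (rangeSum-zero (suc i) k (λ i<z → h (ℕₚ.<⇒≤ i<z)))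

desFrom-≥ : ∀ i a w {d E} → desFrom i (a ∷ w) ≡ d ∷ E → i ≤ d
desFrom-≥ i a (b ∷ w) e with b <ᵇ a
desFrom-≥ i a (b ∷ w) refl | true = ℕₚ.≤-refl
desFrom-≥ i a (b ∷ w) e | false = ℕₚ.≤-trans (ℕₚ.n≤1+n i) (desFrom-≥ (suc i) b w e)

sum≡0⇒[] : ∀ {xs} → All (0 <_) xs → sum xs ≡ 0 → xs ≡ []
sum≡0⇒[] [] _ = refl
sum≡0⇒[] {suc x ∷ xs} (_ ∷ _) ()

module KnapsackSums (lam : List ℕ) (positive : All (0 <_) lam) (knapsack : Knapsack lam) where

  L : ℕ
  L = sum lam

  -- `Knapsack` speaks of sublists of a fixed list; this form speaks of sub-multisets given with a
  -- complement, which is how they occur below.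
  sum-determines : ∀ A R B R′ → A ++ R ↭ lam → B ++ R′ ↭ lam → sum A ≡ sum B → A ↭ B
  sum-determines A R B R′ p q e
    with A₁ , _ , A∈ , eA , _ ← splits-complete lam A R p | B₁ , _ , B∈ , eB , _ ← splits-complete lam B R′ q =
    ↭-trans (↭-sym eA) (↭-trans (knapsack A₁ B₁ (splits-⊆ lam A∈) (splits-⊆ lam B∈)
      (trans (sum-↭ eA) (trans e (sym (sum-↭ eB))))) eB)

  record Sum (t : ℕ) : Set where
    constructor mkSum
    field
      part rest : List ℕ
      part-rest : part ++ rest ↭ lam
      sum-part : sum part ≡ t

  record _⊑_ (t d : ℕ) : Set where
    constructor mk⊑
    field
      lower diff rest : List ℕ
      all-parts : lower ++ diff ++ rest ↭ lam
      sum-lower : sum lower ≡ t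
      sum-diff : t + sum diff ≡ d

  _⊑ᵇ_ : ℕ → ℕ → Bool
  t ⊑ᵇ d = any (λ s → (sum (proj₁ s) ≡ᵇ t) ∧ any (λ B → t + sum B ≡ᵇ d) (subs (proj₂ s))) (splits lam)

  ⊑⁻ : ∀ {t d} → t ⊑ᵇ d ≡ true → t ⊑ d
  ⊑⁻ {t} {d} h with (A , R) , s∈ , h′ ← any-true⁻ (splits lam) h
    with e₁ , h″ ← ∧-true⁻ {sum A ≡ᵇ t} h′
    with B , B∈ , e₂ ← any-true⁻ (subs R) h″
    with R′ , p ← ∈subs⇒↭ R B∈ =
    mk⊑ A B R′ (↭-trans (Permₚ.++⁺ˡ A p) (splits-↭ lam s∈)) (≡ᵇ-true⁻ e₁) (≡ᵇ-true⁻ e₂)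

  ⊑⁺ : ∀ {t d} → t ⊑ d → t ⊑ᵇ d ≡ true
  ⊑⁺ {t} {d} (mk⊑ A B R p eA eB)
    with A′ , R′ , s∈ , pA , pR ← splits-complete lam A (B ++ R) p
    with B′ , B∈ , pB ← ↭⇒∈subs R′ B R (↭-sym pR) =
    any-true⁺ s∈ (∧-true⁺ (≡ᵇ-true⁺ (trans (sum-↭ pA) eA))
      (any-true⁺ B∈ (≡ᵇ-true⁺ (trans (cong (λ s → t + s) (sum-↭ pB)) eB))))

  ⊑-upper : ∀ {t d} → t ⊑ d → Sum d
  ⊑-upper {t} {d} (mk⊑ A B R p eA eB) = mkSum (A ++ B) R (subst (_↭ lam) (sym (Listₚ.++-assoc A B R)) p)
    (trans (sum-++ A B) (trans (cong (_+ sum B) eA) eB))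

  Sum-≤ : ∀ {t} → Sum t → t ≤ L
  Sum-≤ {t} (mkSum A R p e) = subst₂ _≤_ e (trans (sym (sum-++ A R)) (sum-↭ p)) (ℕₚ.m≤m+n (sum A) (sum R))

  ⊑-refl : ∀ {t} → Sum t → t ⊑ t
  ⊑-refl {t} (mkSum A R p e) = mk⊑ A [] R p e (ℕₚ.+-identityʳ t)

  ⊑-top : ∀ {t} → Sum t → t ⊑ L
  ⊑-top {t} (mkSum A R p e) = mk⊑ A R [] (subst (λ Q → A ++ Q ↭ lam) (sym (Listₚ.++-identityʳ R)) p) e
    (trans (cong (_+ sum R) (sym e)) (trans (sym (sum-++ A R)) (sum-↭ p)))

  -- By uniqueness `A` agrees with the lower multiset of the given witness and cancels. So the
  -- representation of `t` may be fixed in advance, which is what lets steps of `⊑` be chained.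
  ⊑-from : ∀ {t d A R} → A ++ R ↭ lam → sum A ≡ t → t ⊑ d → ∃[ B ] ∃[ R′ ] R ↭ B ++ R′ × t + sum B ≡ d
  ⊑-from {A = A} {R} p e (mk⊑ A′ B R′ p′ e′ eB) = B , R′ ,
    ++-cancelˡ-↭ A (↭-trans p (↭-sym (↭-trans (Permₚ.++⁺ʳ (B ++ R′) (sum-determines A R A′ (B ++ R′) p p′ (trans e (sym e′)))) p′))) , eB

  ⊑-trans : ∀ {t z d} → t ⊑ z → z ⊑ d → t ⊑ d
  ⊑-trans {t} {z} {d} (mk⊑ A C R p eA eC) z⊑d
    with B , R′ , q , eB ← ⊑-from {A = A ++ C} {R} (subst (_↭ lam) (sym (Listₚ.++-assoc A C R)) p)
                             (trans (sum-++ A C) (trans (cong (_+ sum C) eA) eC)) z⊑d =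
    mk⊑ A (C ++ B) R′ (↭-trans (Permₚ.++⁺ˡ A (subst (_↭ C ++ R) (sym (Listₚ.++-assoc C B R′)) (Permₚ.++⁺ˡ C (↭-sym q)))) p) eA
      (trans (cong (λ s → t + s) (sum-++ C B)) (trans (sym (ℕₚ.+-assoc t (sum C) (sum B))) (trans (cong (_+ sum B) eC) eB)))

  -- Each value occurs once, so `subs values` runs over the sets of parts without repetition.
  values : List ℕ
  values = deduplicate ℕ._≟_ lam

  values-unique : Unique values
  values-unique = deduplicate-! lam

  ∈values⁺ : ∀ {x} → x ∈ lam → x ∈ values
  ∈values⁺ = ∈-deduplicate⁺ ℕ._≟_

  ∈values⁻ : ∀ {x} → x ∈ values → x ∈ lam
  ∈values⁻ = ∈-deduplicate⁻ ℕ._≟_ lam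

  subs-values : ∀ {U} → U ∈ subs values → Unique U × ∃[ R ] U ++ R ↭ lam
  subs-values U∈ with u ← ∈subs-unique values-unique U∈
    with R , p ← unique-⊆⇒↭ {B = lam} u (λ x∈ → ∈values⁻ (∈subs-⊆ U∈ x∈)) = u , R , ↭-sym p

  -- The Möbius function of the poset of sub-multiset sums ordered by ⊑.
  μ : ℕ → ℕ → ℤ
  μ t d = 𝟙 (t ⊑ᵇ d) * ∑ (subs values) (λ U → 𝟙 (t + sum U ≡ᵇ d) * sgn (length U))

  μ-⋢ : ∀ {t d} → ¬ t ⊑ d → μ t d ≡ 0ℤ
  μ-⋢ {t} {d} ⋢ rewrite ¬true⇒false {t ⊑ᵇ d} (λ h → ⋢ (⊑⁻ h)) = refl

  -- The difference `B` from t to d is the sum of the differences `C` from t to z and `B₂` from z to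
  -- d, by uniqueness; and `B₂` is `U`, having the same sum.
  diff-contains : ∀ {t z d A B R U} → A ++ B ++ R ↭ lam → sum A ≡ t → t + sum B ≡ d → U ∈ subs values →
    t ⊑ z → z ⊑ d → z + sum U ≡ d → ∀ {x} → x ∈ U → x ∈ B
  diff-contains {t} {z} {d} {A} {B} {R} {U} p eA eB U∈ t⊑z z⊑d eU x∈
    with C , R₁ , q₁ , eC ← ⊑-from {A = A} {B ++ R} p eA t⊑z
    with B₂ , R₂ , q₂ , eB₂ ← ⊑-from {A = A ++ C} {R₁}
           (subst (_↭ lam) (sym (Listₚ.++-assoc A C R₁)) (↭-trans (Permₚ.++⁺ˡ A (↭-sym q₁)) p))
           (trans (sum-++ A C) (trans (cong (_+ sum C) eA) eC)) z⊑d
    with u , R₃ , q₃ ← subs-values U∈ =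
    Permₚ.∈-resp-↭ (↭-sym B↭) (∈-++⁺ʳ C (Permₚ.∈-resp-↭ (↭-sym B₂↭U) x∈))
    where
    whole : A ++ C ++ B₂ ++ R₂ ↭ lam
    whole = ↭-trans (Permₚ.++⁺ˡ A (↭-trans (Permₚ.++⁺ˡ C (↭-sym q₂)) (↭-sym q₁))) p
    B₂↭U : B₂ ↭ U
    B₂↭U = sum-determines B₂ ((A ++ C) ++ R₂) U R₃
      (↭-trans (Permₚ.shifts B₂ (A ++ C)) (subst (_↭ lam) (sym (Listₚ.++-assoc A C (B₂ ++ R₂))) whole)) q₃
      (ℕₚ.+-cancelˡ-≡ z _ _ (trans eB₂ (sym eU)))
    B↭ : B ↭ C ++ B₂
    B↭ = ++-cancelˡ-↭ A (sum-determines (A ++ B) R (A ++ C ++ B₂) R₂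
      (subst (_↭ lam) (sym (Listₚ.++-assoc A B R)) p)
      (subst (_↭ lam) (sym (trans (Listₚ.++-assoc A (C ++ B₂) R₂) (cong (A ++_) (Listₚ.++-assoc C B₂ R₂)))) whole)
      (begin
        sum (A ++ B)            ≡⟨ trans (sum-++ A B) (cong (_+ sum B) eA) ⟩
        t + sum B               ≡⟨ eB ⟩
        d                       ≡⟨ eB₂ ⟨
        z + sum B₂              ≡⟨ cong (_+ sum B₂) eC ⟨
        t + sum C + sum B₂      ≡⟨ ℕₚ.+-assoc t (sum C) (sum B₂) ⟩
        t + (sum C + sum B₂)    ≡⟨ cong₂ _+_ eA (sum-++ C B₂) ⟨
        sum A + sum (C ++ B₂)   ≡⟨ sum-++ A (C ++ B₂) ⟨
        sum (A ++ C ++ B₂)      ∎))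
      where open ≡-Reasoning

  -- The converse of `diff-contains`: a set inside the difference can be taken off at its upper end.
  ⊑-remove : ∀ {t d A B R U B′} → A ++ B ++ R ↭ lam → sum A ≡ t → t + sum B ≡ d → B ↭ U ++ B′ →
    t ⊑ (t + sum B′) × (t + sum B′) ⊑ d × t + sum B′ + sum U ≡ d
  ⊑-remove {t} {d} {A} {B} {R} {U} {B′} p eA eB q =
    mk⊑ A B′ (U ++ R) (↭-trans (Permₚ.++⁺ˡ A (Permₚ.shifts B′ U)) whole) eA refl ,
    mk⊑ (A ++ B′) U R (subst (_↭ lam) (sym (Listₚ.++-assoc A B′ (U ++ R))) (↭-trans (Permₚ.++⁺ˡ A (Permₚ.shifts B′ U)) whole))
      (trans (sum-++ A B′) (cong (_+ sum B′) eA)) total ,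
    total
    where
    whole : A ++ U ++ B′ ++ R ↭ lam
    whole = ↭-trans (Permₚ.++⁺ˡ A (subst (_↭ B ++ R) (Listₚ.++-assoc U B′ R) (Permₚ.++⁺ʳ R (↭-sym q)))) p
    total : t + sum B′ + sum U ≡ d
    total = trans (ℕₚ.+-assoc t (sum B′) (sum U)) (trans (cong (λ s → t + s)
      (trans (ℕₚ.+-comm (sum B′) (sum U)) (trans (sym (sum-++ U B′)) (sym (sum-↭ q))))) eB)

  _∈ᵇ_ : ℕ → List ℕ → Bool
  x ∈ᵇ B = any (x ≡ᵇ_) B

  ∈ᵇ⁺ : ∀ {x B} → x ∈ B → x ∈ᵇ B ≡ true
  ∈ᵇ⁺ {x} x∈ = any-true⁺ x∈ (≡ᵇ-refl x)

  ∈ᵇ⁻ : ∀ {x B} → x ∈ᵇ B ≡ true → x ∈ B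
  ∈ᵇ⁻ {x} {B} h with y , y∈ , e ← any-true⁻ B h = subst (_∈ B) (sym (≡ᵇ-true⁻ e)) y∈

  μ-term : ℕ → ℕ → List ℕ → ℕ → ℤ
  μ-term t d U z = 𝟙 (t ⊑ᵇ z) * (𝟙 (z ⊑ᵇ d) * 𝟙 (z + sum U ≡ᵇ d))

  μ-term-1 : ∀ {t d U z} → t ⊑ z → z ⊑ d → z + sum U ≡ d → μ-term t d U z ≡ 1ℤ
  μ-term-1 a b c rewrite ⊑⁺ a | ⊑⁺ b | ≡ᵇ-true⁺ c = refl

  μ-term-0 : ∀ {t d U z} → ¬ (t ⊑ z × z ⊑ d × z + sum U ≡ d) → μ-term t d U z ≡ 0ℤ
  μ-term-0 {t} {d} {U} {z} h with t ⊑ᵇ z in e₁ | z ⊑ᵇ d in e₂ | z + sum U ≡ᵇ d in e₃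
  ... | false | _ | _ = refl
  ... | true | false | _ = refl
  ... | true | true | false = refl
  ... | true | true | true = ⊥-elim (h (⊑⁻ e₁ , ⊑⁻ e₂ , ≡ᵇ-true⁻ e₃))

  -- At most one z can contribute, namely d minus the sum of `U`, and it lies between t and d
  -- exactly when `U` is contained in `B`.
  ∑-μ-term : ∀ {t d A B R U} → A ++ B ++ R ↭ lam → sum A ≡ t → t + sum B ≡ d → U ∈ subs values →
    ∑ (upTo (suc (sum B))) (λ j → μ-term t d U (t + j)) ≡ 𝟙 (all (_∈ᵇ B) U)
  ∑-μ-term {t} {d} {A} {B} {R} {U} p eA eB U∈ = cases (all (_∈ᵇ B) U) refl
    where
    cases : ∀ b → all (_∈ᵇ B) U ≡ b → ∑ (upTo (suc (sum B))) (λ j → μ-term t d U (t + j)) ≡ 𝟙 b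
    cases false e = ∑-zero (upTo (suc (sum B))) λ {j} _ → μ-term-0 {t} {d} {U} {t + j} λ (a , b , c) →
      case trans (sym e) (all-true⁺ U (λ {x} x∈ → ∈ᵇ⁺ {x} {B} (diff-contains {A = A} {B} {R} p eA eB U∈ a b c x∈))) of λ ()
    cases true e with B′ , q ← unique-⊆⇒↭ {B = B} (proj₁ (subs-values U∈)) (λ x∈ → ∈ᵇ⁻ {B = B} (all-true⁻ e x∈))
      with a , b , c ← ⊑-remove {A = A} {B} {R} {U} {B′} p eA eB q = trans
      (∑-single (λ j → μ-term t d U (t + j)) (Uniqueₚ.upTo⁺ (suc (sum B))) (∈-upTo⁺ (s≤s B′≤B))
        (λ {j} _ j≢ → μ-term-0 {t} {d} {U} {t + j} λ (_ , _ , c′) → j≢ (ℕₚ.+-cancelˡ-≡ t _ _ (ℕₚ.+-cancelʳ-≡ (sum U) _ _ (trans c′ (sym c))))))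
      (μ-term-1 {U = U} a b c)
      where
      B′≤B : sum B′ ≤ sum B
      B′≤B = subst (sum B′ ≤_) (sym (trans (sum-↭ q) (sum-++ U B′))) (ℕₚ.m≤n+m (sum B′) (sum U))

  -- Inclusion-exclusion: exchanging the sums over z and `U` leaves the expansion of the product of
  -- 1 - [x ∈ B] over all values x. Since t < d, `B` has an element, and its factor is 0.
  ∑-⊑-μ : ∀ {t d} → t ⊑ d → t < d → rangeSum (λ z → 𝟙 (t ⊑ᵇ z) * μ z d) t (suc (d ∸ t)) ≡ 0ℤ
  ∑-⊑-μ {t} {d} (mk⊑ A [] R p eA eB) t<d = ⊥-elim (ℕₚ.<-irrefl (trans (sym (ℕₚ.+-identityʳ t)) eB) t<d)
  ∑-⊑-μ {t} {d} (mk⊑ A B@(e ∷ _) R p eA eB) t<d = begin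
    rangeSum (λ z → 𝟙 (t ⊑ᵇ z) * μ z d) t (suc (d ∸ t))
      ≡⟨ rangeSum≡∑ (λ z → 𝟙 (t ⊑ᵇ z) * μ z d) t (suc (d ∸ t)) ⟩
    ∑ (upTo (suc (d ∸ t))) (λ j → 𝟙 (t ⊑ᵇ (t + j)) * μ (t + j) d)
      ≡⟨ cong (λ k → ∑ (upTo (suc k)) (λ j → 𝟙 (t ⊑ᵇ (t + j)) * μ (t + j) d)) d∸t ⟩
    ∑ range (λ j → 𝟙 (t ⊑ᵇ (t + j)) * μ (t + j) d)
      ≡⟨ ∑-cong range (λ {j} _ → expand (t + j)) ⟩
    ∑ range (λ j → ∑ (subs values) (λ U → sgn (length U) * μ-term t d U (t + j)))
      ≡⟨ ∑-swap range (subs values) _ ⟩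
    ∑ (subs values) (λ U → ∑ range (λ j → sgn (length U) * μ-term t d U (t + j)))
      ≡⟨ ∑-cong (subs values) (λ {U} U∈ → trans (∑-*ˡ (sgn (length U)) range _) (cong (sgn (length U) *_) (∑-μ-term {A = A} {B} {R} p eA eB U∈))) ⟩
    ∑ (subs values) (λ U → sgn (length U) * 𝟙 (all (_∈ᵇ B) U))
      ≡⟨ ∑-subs-sgn (_∈ᵇ B) values ⟩
    𝟙 (all (λ x → not (x ∈ᵇ B)) values)
      ≡⟨ cong 𝟙 (¬true⇒false λ h → not-true⁻ (all-true⁻ h (∈values⁺ e∈lam)) (∈ᵇ⁺ {e} {B} (here refl))) ⟩
    0ℤ ∎
    where
    open ≡-Reasoning
    range = upTo (suc (sum B))
    e∈lam : e ∈ lam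
    e∈lam = Permₚ.∈-resp-↭ p (∈-++⁺ʳ A (here refl))
    d∸t : d ∸ t ≡ sum B
    d∸t = trans (cong (_∸ t) (sym eB)) (ℕₚ.m+n∸m≡n t (sum B))
    expand : ∀ z → 𝟙 (t ⊑ᵇ z) * μ z d ≡ ∑ (subs values) (λ U → sgn (length U) * μ-term t d U z)
    expand z = sym (trans (∑-cong (subs values) (λ {U} _ → lemma (sgn (length U)) (𝟙 (t ⊑ᵇ z)) (𝟙 (z ⊑ᵇ d)) _))
      (trans (∑-*ˡ (𝟙 (t ⊑ᵇ z)) (subs values) _) (cong (𝟙 (t ⊑ᵇ z) *_) (∑-*ˡ (𝟙 (z ⊑ᵇ d)) (subs values) _))))
      where
      lemma : ∀ s a b c → s * (a * (b * c)) ≡ a * (b * (c * s))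
      lemma = solve-∀

  -- By uniqueness of sums, the only set `U` with sum d - t is `B` itself, up to order.
  μ-distinct : ∀ {t d A B R} → A ++ B ++ R ↭ lam → sum A ≡ t → t + sum B ≡ d → Unique B → μ t d ≡ sgn (length B)
  μ-distinct {t} {d} {A} {B} {R} p eA eB uB
    with G , q ← unique-⊆⇒↭ {B = values} uB (λ x∈ → ∈values⁺ (Permₚ.∈-resp-↭ p (∈-++⁺ʳ A (∈-++⁺ˡ x∈))))
    with U , U∈ , U↭B ← ↭⇒∈subs values B G (↭-sym q) = begin
    𝟙 (t ⊑ᵇ d) * ∑ (subs values) term
      ≡⟨ cong₂ (λ b s → 𝟙 b * s) (⊑⁺ (mk⊑ A B R p eA eB)) (∑-single term (subs-unique values-unique) U∈ other) ⟩
    1ℤ * term U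
      ≡⟨ trans (ℤₚ.*-identityˡ _) (cong (λ b → 𝟙 b * sgn (length U)) (≡ᵇ-true⁺ (trans (cong (λ s → t + s) (sum-↭ U↭B)) eB))) ⟩
    1ℤ * sgn (length U)
      ≡⟨ trans (ℤₚ.*-identityˡ _) (cong sgn (Permₚ.↭-length U↭B)) ⟩
    sgn (length B) ∎
    where
    open ≡-Reasoning
    term : List ℕ → ℤ
    term U = 𝟙 (t + sum U ≡ᵇ d) * sgn (length U)
    other : ∀ {U′} → U′ ∈ subs values → U′ ≢ U → term U′ ≡ 0ℤ
    other {U′} U′∈ U′≢U with R′ , q′ ← proj₂ (subs-values U′∈) = cong (λ b → 𝟙 b * sgn (length U′)) (≡ᵇ-false⁺ λ e →
      U′≢U (subs-↭⇒≡ values-unique U′∈ U∈ (↭-trans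
        (sum-determines U′ R′ B (A ++ R) q′ (↭-trans (Permₚ.shifts B A) p) (ℕₚ.+-cancelˡ-≡ t _ _ (trans e (sym eB)))) (↭-sym U↭B))))

  -- A set with sum d - t would be a permutation of `B`, which has a repetition.
  μ-repeated : ∀ {t d A B R} → A ++ B ++ R ↭ lam → sum A ≡ t → t + sum B ≡ d → ¬ Unique B → μ t d ≡ 0ℤ
  μ-repeated {t} {d} {A} {B} {R} p eA eB ¬uB = trans (cong (𝟙 (t ⊑ᵇ d) *_) (∑-zero (subs values) vanish)) (ℤₚ.*-zeroʳ (𝟙 (t ⊑ᵇ d)))
    where
    vanish : ∀ {U} → U ∈ subs values → 𝟙 (t + sum U ≡ᵇ d) * sgn (length U) ≡ 0ℤ
    vanish {U} U∈ with u , R′ , q ← subs-values U∈ = cong (λ b → 𝟙 b * sgn (length U)) (≡ᵇ-false⁺ λ e →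
      ¬uB (Unique-resp-↭ (sum-determines U R′ B (A ++ R) q (↭-trans (Permₚ.shifts B A) p) (ℕₚ.+-cancelˡ-≡ t _ _ (trans e (sym eB)))) u))

  μ-refl : ∀ {d} → Sum d → μ d d ≡ 1ℤ
  μ-refl {d} (mkSum A R p e) = μ-distinct {A = A} {[]} {R} p e (ℕₚ.+-identityʳ d) []

  -- t is the position of the last bar, and i the number of letters read so far.
  walk : ℕ → ℕ → ℕ → List ℕ → ℤ
  walk t i a [] = 1ℤ +ᶻ -ᶻ 𝟙 (t ⊑ᵇ i)
  walk t i a (b ∷ w) = 𝟙 (not (b <ᵇ a)) * walk t (suc i) b w +ᶻ -ᶻ 𝟙 (t ⊑ᵇ i) * walk i (suc i) b w

  -- The closing factor stands for the free end: the signed chains that start at t and may stop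
  -- anywhere above it add up to 1 if t is the top sum, and to 0 otherwise.
  μ-chain : ℕ → List ℕ → ℤ
  μ-chain t [] = 𝟙 (t ≡ᵇ L)
  μ-chain t (d ∷ E) = μ t d * μ-chain d E

  -- With no descent ahead, the chains that continue from a next bar z < `L` cancel, so besides the
  -- chain that stops at t only z = `L` counts, and it is still available when i ≤ `L`. The bound on
  -- `L` keeps this position within the word.
  walk-ascending : ∀ {t} i a w → Sum t → t < i → L ≤ i + length w → desFrom i (a ∷ w) ≡ [] →
    walk t i a w ≡ 1ℤ +ᶻ -ᶻ 𝟙 (i ≤ᵇ L)
  walk-ascending {t} i a [] st t<i L≤ _ = cong (λ b → 1ℤ +ᶻ -ᶻ 𝟙 b) (bool-ext
    (λ h → ≤ᵇ-true⁺ (Sum-≤ (⊑-upper (⊑⁻ h))))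
    (λ h → ⊑⁺ (subst (t ⊑_) (ℕₚ.≤-antisym (subst (L ≤_) (ℕₚ.+-identityʳ i) L≤) (≤ᵇ-true⁻ {i} h)) (⊑-top st))))
  walk-ascending {t} i a (b ∷ w) st t<i L≤ e with b <ᵇ a
  ... | false
    rewrite walk-ascending {t} (suc i) b w st (ℕₚ.m<n⇒m<1+n t<i) (subst (L ≤_) (ℕₚ.+-suc i (length w)) L≤) e
    with t ⊑ᵇ i in e₁
  -- The walks with and without a bar at i have the same value and opposite signs; and i ≤ `L`,
  -- being a sum, so 0 is the right value.
  ...   | true
    rewrite walk-ascending {i} (suc i) b w (⊑-upper (⊑⁻ e₁)) ℕₚ.≤-refl (subst (L ≤_) (ℕₚ.+-suc i (length w)) L≤) e
          | ≤ᵇ-true⁺ (Sum-≤ (⊑-upper (⊑⁻ e₁))) = lemma (1ℤ +ᶻ -ᶻ 𝟙 (suc i ≤ᵇ L))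
    where
    lemma : ∀ x → 1ℤ * x +ᶻ -ᶻ 1ℤ * x ≡ 0ℤ
    lemma = solve-∀
  -- As t ⊑ `L`, the position i is not `L`, and so i ≤ `L` and i + 1 ≤ `L` are equivalent.
  ...   | false = trans (lemma (1ℤ +ᶻ -ᶻ 𝟙 (suc i ≤ᵇ L)) (walk i (suc i) b w)) (cong (λ b → 1ℤ +ᶻ -ᶻ 𝟙 b) (bool-ext
      (λ h → ≤ᵇ-true⁺ (ℕₚ.<⇒≤ (≤ᵇ-true⁻ {suc i} h)))
      (λ h → ≤ᵇ-true⁺ (ℕₚ.≤∧≢⇒< (≤ᵇ-true⁻ {i} h) λ { refl → case trans (sym e₁) (⊑⁺ (⊑-top st)) of λ () }))))
    where
    lemma : ∀ x y → 1ℤ * x +ᶻ -ᶻ 0ℤ * y ≡ x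
    lemma = solve-∀

  -- A sum over the position z of the next bar, which cannot lie beyond d because a bar is forced
  -- there. The bars after z contribute `μ z d * μ-chain d E` by `walk-μ`; `suc d ∸ i` counts the
  -- positions from i to d.
  walk-descending : ∀ {t} i a w {d E} → Sum t → t < i → L ≤ i + length w → desFrom i (a ∷ w) ≡ d ∷ E →
    walk t i a w ≡ -ᶻ rangeSum (λ z → 𝟙 (t ⊑ᵇ z) * μ z d) i (suc d ∸ i) * μ-chain d E
  -- Directly after a bar at t, the next bar z ranges over t < z ≤ d for the next descent d. The
  -- terms `μ z d` with t ⊑ z, including z = t, add up to 0, so the negated sum without z = t is
  -- `μ t d`. If t ⊑ d fails, transitivity makes every term 0.
  walk-μ : ∀ {t} a w → Sum t → L ≤ suc t + length w → walk t (suc t) a w ≡ μ-chain t (desFrom (suc t) (a ∷ w))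

  walk-descending {t} i a (b ∷ w) {d} {E} st t<i L≤ e with b <ᵇ a
  -- The descent is at i itself, so d is i and the range shrinks to that single position.
  walk-descending {t} i a (b ∷ w) {d} {E} st t<i L≤ refl | true
    rewrite ℕₚ.+-∸-assoc 1 (ℕₚ.≤-refl {i}) | ℕₚ.n∸n≡0 i with t ⊑ᵇ i in e₁
  ... | true rewrite walk-μ {i} b w (⊑-upper (⊑⁻ e₁)) (subst (L ≤_) (ℕₚ.+-suc i (length w)) L≤)
                   | μ-refl (⊑-upper (⊑⁻ e₁)) = lemma (walk t (suc i) b w) (μ-chain i (desFrom (suc i) (b ∷ w)))
    where
    lemma : ∀ x y → 0ℤ * x +ᶻ -ᶻ 1ℤ * y ≡ -ᶻ (1ℤ * 1ℤ +ᶻ 0ℤ) * y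
    lemma = solve-∀
  ... | false = lemma (walk t (suc i) b w) (walk i (suc i) b w) (μ i i) (μ-chain i (desFrom (suc i) (b ∷ w)))
    where
    lemma : ∀ x y z u → 0ℤ * x +ᶻ -ᶻ 0ℤ * y ≡ -ᶻ (0ℤ * z +ᶻ 0ℤ) * u
    lemma = solve-∀
  walk-descending {t} i a (b ∷ w) {d} {E} st t<i L≤ e | false
    rewrite ℕₚ.+-∸-assoc 1 (ℕₚ.<⇒≤ (desFrom-≥ (suc i) b w e))
          | walk-descending {t} (suc i) b w st (ℕₚ.m<n⇒m<1+n t<i) (subst (L ≤_) (ℕₚ.+-suc i (length w)) L≤) e
    with t ⊑ᵇ i in e₁
  ... | true rewrite walk-μ {i} b w (⊑-upper (⊑⁻ e₁)) (subst (L ≤_) (ℕₚ.+-suc i (length w)) L≤) | e =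
    lemma (rangeSum (λ z → 𝟙 (t ⊑ᵇ z) * μ z d) (suc i) (d ∸ i)) (μ i d) (μ-chain d E)
    where
    lemma : ∀ r m c → 1ℤ * (-ᶻ r * c) +ᶻ -ᶻ 1ℤ * (m * c) ≡ -ᶻ (1ℤ * m +ᶻ r) * c
    lemma = solve-∀
  ... | false = lemma (rangeSum (λ z → 𝟙 (t ⊑ᵇ z) * μ z d) (suc i) (d ∸ i)) (μ i d) (μ-chain d E) (walk i (suc i) b w)
    where
    lemma : ∀ r m c x → 1ℤ * (-ᶻ r * c) +ᶻ -ᶻ 0ℤ * x ≡ -ᶻ (0ℤ * m +ᶻ r) * c
    lemma = solve-∀

  walk-μ {t} a w st L≤ with desFrom (suc t) (a ∷ w) in e
  ... | [] = trans (walk-ascending (suc t) a w st ℕₚ.≤-refl L≤ e) (top (ℕₚ.m≤n⇒m<n∨m≡n (Sum-≤ st)))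
    where
    top : t < L ⊎ t ≡ L → 1ℤ +ᶻ -ᶻ 𝟙 (suc t ≤ᵇ L) ≡ 𝟙 (t ≡ᵇ L)
    top (inj₁ t<L) rewrite ≤ᵇ-true⁺ t<L | ≡ᵇ-false⁺ (ℕₚ.<⇒≢ t<L) = refl
    top (inj₂ refl) rewrite ≤ᵇ-suc-false L | ≡ᵇ-refl L = refl
  ... | d ∷ E = trans (walk-descending (suc t) a w st ℕₚ.≤-refl L≤ e) (cong (_* μ-chain d E) (closed (t ⊑ᵇ d) refl))
    where
    f : ℕ → ℤ
    f z = 𝟙 (t ⊑ᵇ z) * μ z d
    t<d : t < d
    t<d = desFrom-≥ (suc t) a w e
    isolate : ∀ {x r} m → x ≡ m → x +ᶻ r ≡ 0ℤ → -ᶻ r ≡ m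
    isolate {x} {r} m refl h = trans (lemma x r) (trans (cong (x +ᶻ_) (cong -ᶻ_ h)) (ℤₚ.+-identityʳ x))
      where
      lemma : ∀ x r → -ᶻ r ≡ x +ᶻ -ᶻ (x +ᶻ r)
      lemma = solve-∀
    closed : ∀ b → (t ⊑ᵇ d) ≡ b → -ᶻ rangeSum f (suc t) (d ∸ t) ≡ μ t d
    closed true h = isolate {f t} (μ t d) (trans (cong (λ b → 𝟙 b * μ t d) (⊑⁺ (⊑-refl st))) (ℤₚ.*-identityˡ _)) (∑-⊑-μ (⊑⁻ h) t<d)
    closed false h = trans (cong -ᶻ_ (rangeSum-zero (suc t) (d ∸ t) (λ {z} _ → vanish z))) (sym (μ-⋢ ⋢))
      where
      ⋢ : ¬ t ⊑ d
      ⋢ t⊑d = case trans (sym h) (⊑⁺ t⊑d) of λ ()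
      vanish : ∀ z → f z ≡ 0ℤ
      vanish z with t ⊑ᵇ z in e₁
      ... | false = refl
      ... | true = trans (ℤₚ.*-identityˡ _) (μ-⋢ (λ z⊑d → ⋢ (⊑-trans (⊑⁻ e₁) z⊑d)))

-- Compositions as chains of sums

barSum-* : ∀ k h s a w → barSum (λ p → k * h p) s a w ≡ k * barSum h s a w
barSum-* k h s a [] = sym (ℤₚ.*-distribˡ-+ k _ _)
barSum-* k h s a (b ∷ w) rewrite barSum-* k h (suc s) b w | barSum-* k (prefix s h) 1 b w =
  lemma (𝟙 (not (b <ᵇ a))) k (barSum h (suc s) b w) (barSum (prefix s h) 1 b w)
  where
  lemma : ∀ t k x y → t * (k * x) +ᶻ k * y ≡ k * (t * x +ᶻ y)
  lemma = solve-∀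

-- `barSum` evaluates its function only at pointed compositions of N with positive parts, which is
-- where the filter is shown to agree with the chain condition.
barSum-cong-valid : ∀ {h k N} → (∀ c z → All (0 <_) c → sum c + z ≡ N → h (c , z) ≡ k (c , z)) →
  ∀ s a w → 0 < s → s + length w ≡ N → barSum h s a w ≡ barSum k s a w
barSum-cong-valid e s a [] s>0 refl = cong₂ _+ᶻ_ (e [] s [] (sym (ℕₚ.+-identityʳ s))) (e (s ∷ []) 0 (s>0 ∷ []) (ℕₚ.+-identityʳ (s + 0)))
barSum-cong-valid e s a (b ∷ w) s>0 refl = cong₂ (λ x y → 𝟙 (not (b <ᵇ a)) * x +ᶻ y)
  (barSum-cong-valid e (suc s) b w (s≤s z≤n) (sym (ℕₚ.+-suc s (length w))))
  (barSum-cong-valid (λ c z pos eq → e (s ∷ c) z (s>0 ∷ pos) (trans (ℕₚ.+-assoc s (sum c) z) (cong (λ t → s + t) eq))) 1 b w (s≤s z≤n) refl)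

Increasing : ℕ → List ℕ → Set
Increasing t [] = ⊤
Increasing t (d ∷ E) = t < d × Increasing d E

desFrom-increasing : ∀ {t} i a w → t < i → Increasing t (desFrom i (a ∷ w))
desFrom-increasing i a [] _ = tt
desFrom-increasing i a (b ∷ w) t<i with b <ᵇ a
... | true = t<i , desFrom-increasing (suc i) b w ℕₚ.≤-refl
... | false = desFrom-increasing (suc i) b w (ℕₚ.m<n⇒m<1+n t<i)

desFrom-< : ∀ i a w → All (_< i + length w) (desFrom i (a ∷ w))
desFrom-< i a [] = []
desFrom-< i a (b ∷ w) rewrite ℕₚ.+-suc i (length w) with b <ᵇ a
... | true = s≤s (ℕₚ.m≤m+n i (length w)) ∷ desFrom-< (suc i) b w
... | false = desFrom-< (suc i) b w

∈-compsF : ∀ f s {cs} → s ≤ f → cs ∈ compsF f s → All (0 <_) cs × sum cs ≡ s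
∈-compsF zero zero _ (here refl) = [] , refl
∈-compsF (suc f) zero _ (here refl) = [] , refl
∈-compsF (suc f) (suc s) (s≤s s≤f) cs∈
  with a , a∈ , cs∈a ← find (∈-concatMap⁻ (λ a → map (suc a ∷_) (compsF f (s ∸ a))) {upTo (suc s)} cs∈)
  with cs′ , cs′∈ , refl ← ∈-map⁻ (suc a ∷_) cs∈a
  with pos , e ← ∈-compsF f (s ∸ a) (ℕₚ.≤-trans (ℕₚ.m∸n≤m s a) s≤f) cs′∈ =
  s≤s z≤n ∷ pos , cong suc (trans (cong (λ t → a + t) e) (ℕₚ.m+[n∸m]≡n (ℕₚ.≤-pred (∈-upTo⁻ a∈))))

module KnapsackChains (lam : List ℕ) (positive : All (0 <_) lam) (knapsack : Knapsack lam) where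

  open KnapsackSums lam positive knapsack

  -- Sign and chain condition in product form: putting a part in front contributes a factor that
  -- depends only on the partial sums before and after it. This is what turns `barSum` into `walk`.
  chain : ℕ → PIP → ℤ
  chain t ([] , z) = 1ℤ
  chain t (c ∷ cs , z) = -ᶻ 𝟙 (t ⊑ᵇ (t + c)) * chain (t + c) (cs , z)

  barSum-walk : ∀ t s a w → barSum (chain t) s a w ≡ walk t (t + s) a w
  barSum-walk t s a [] = cong (1ℤ +ᶻ_) (ℤₚ.*-identityʳ (-ᶻ 𝟙 (t ⊑ᵇ (t + s))))
  barSum-walk t s a (b ∷ w) = cong₂ (λ x y → 𝟙 (not (b <ᵇ a)) * x +ᶻ y)
    (trans (barSum-walk t (suc s) b w) (cong (λ i → walk t i b w) (ℕₚ.+-suc t s)))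
    (trans (barSum-* (-ᶻ 𝟙 (t ⊑ᵇ (t + s))) (chain (t + s)) 1 b w) (cong (-ᶻ 𝟙 (t ⊑ᵇ (t + s)) *_)
      (trans (barSum-walk (t + s) 1 b w) (cong (λ i → walk (t + s) i b w) (ℕₚ.+-comm (t + s) 1)))))

  chainᵇ : ℕ → List ℕ → Bool
  chainᵇ t [] = true
  chainᵇ t (c ∷ cs) = (t ⊑ᵇ (t + c)) ∧ chainᵇ (t + c) cs

  chain≡ : ∀ t cs z → chain t (cs , z) ≡ sgn (length cs) * 𝟙 (chainᵇ t cs)
  chain≡ t [] z = refl
  chain≡ t (c ∷ cs) z rewrite chain≡ (t + c) cs z | 𝟙-∧ (t ⊑ᵇ (t + c)) (chainᵇ (t + c) cs) =
    lemma (𝟙 (t ⊑ᵇ (t + c))) (sgn (length cs)) (𝟙 (chainᵇ (t + c) cs))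
    where
    lemma : ∀ a s b → -ᶻ a * (s * b) ≡ (-ᶻ 1ℤ * s) * (a * b)
    lemma = solve-∀

  module _ (m : ℕ) where

    -- The colour classes, taken in the order of the parts of `cs`, are the successive differences
    -- of the chain.
    colouring⇒chain : ∀ {t A ps} cs {z} → A ++ ps ↭ lam → sum A ≡ t → Colouring (ps , m) (cs , z) → chainᵇ t cs ≡ true
    colouring⇒chain [] _ _ _ = refl
    colouring⇒chain {t} {A} (c ∷ cs) p e C with B , qs , q , refl , C′ ← colouring-∷⁻ C = ∧-true⁺
      (⊑⁺ (mk⊑ A B qs whole e refl))
      (colouring⇒chain {A = A ++ B} cs (subst (_↭ lam) (sym (Listₚ.++-assoc A B qs)) whole)
        (trans (sum-++ A B) (cong (_+ sum B) e)) C′)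
      where
      whole = ↭-trans (Permₚ.++⁺ˡ A (↭-sym q)) p

    -- `⊑-from` takes each class out of what is left of λ. The remainder at the end is absorbed by
    -- the pointed part, whose size the total then dictates.
    chain⇒colouring : ∀ {t A ps} cs {z} → A ++ ps ↭ lam → sum A ≡ t → t + (sum cs + z) ≡ L + m →
      chainᵇ t cs ≡ true → Colouring (ps , m) (cs , z)
    chain⇒colouring {t} {A} {ps} [] {z} p e total _ = colouring-[] (ℕₚ.+-cancelˡ-≡ t _ _ (begin
      t + (m + sum ps)       ≡⟨ cong₂ (λ x y → x + y) (sym e) (ℕₚ.+-comm m (sum ps)) ⟩
      sum A + (sum ps + m)   ≡⟨ ℕₚ.+-assoc (sum A) (sum ps) m ⟨
      sum A + sum ps + m     ≡⟨ cong (_+ m) (trans (sym (sum-++ A ps)) (sum-↭ p)) ⟩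
      L + m                  ≡⟨ total ⟨
      t + z                  ∎))
      where open ≡-Reasoning
    chain⇒colouring {t} {A} {ps} (c ∷ cs) {z} p e total h with h₁ , h₂ ← ∧-true⁻ {t ⊑ᵇ (t + c)} h
      with B , R , q , eB ← ⊑-from {A = A} {ps} p e (⊑⁻ h₁) =
      colouring-↭ˡ q (colouring-∷ (ℕₚ.+-cancelˡ-≡ t _ _ eB)
        (chain⇒colouring {A = A ++ B} cs (subst (_↭ lam) (sym (Listₚ.++-assoc A B R)) (↭-trans (Permₚ.++⁺ˡ A (↭-sym q)) p))
          (trans (sum-++ A B) (trans (cong (_+ sum B) e) eB))
          (trans (ℕₚ.+-assoc t c (sum cs + z)) (trans (cong (λ x → t + x) (sym (ℕₚ.+-assoc c (sum cs) z))) total)) h₂))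
      where
      colouring-↭ˡ : ∀ {ps qs m r} → ps ↭ qs → Colouring (qs , m) r → Colouring (ps , m) r
      colouring-↭ˡ p (colouring P e w₀ wₛ) = colouring P (↭-trans e (↭-sym p)) w₀ wₛ

    inFilter≡chain : ∀ {cs z} → All (0 <_) cs → sum cs + z ≡ L + m → inFilter (lam , m) (cs , z) ≡ chainᵇ 0 cs
    inFilter≡chain {cs} {z} pos total = bool-ext
      (λ h → colouring⇒chain {A = []} cs ↭-refl refl (inFilter⁻ {lam , m} h))
      (λ h → inFilter⁺ {lam , m} pos (chain⇒colouring {A = []} cs ↭-refl refl total h))

  module _ {A B R : List ℕ} (p : A ++ B ++ R ↭ lam) where

    private
      B-sub : B ++ A ++ R ↭ lam
      B-sub = ↭-trans (Permₚ.shifts B A) p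

    -- Every sublist of λ with the sum of `B` is a permutation of `B`, so the test over all of them
    -- is a test of `B`.
    distinctRep⁺ : Unique B → distinctRep lam (sum B) ≡ true
    distinctRep⁺ u with B′ , B′∈ , e ← ↭⇒∈subs lam B (A ++ R) B-sub = ∧-true⁺
      (any-true⁺ B′∈ (≡ᵇ-true⁺ (sum-↭ e))) (all-true⁺ (subs lam) unique)
      where
      unique : ∀ {s} → s ∈ subs lam → not (sum s ≡ᵇ sum B) ∨ distinctᵇ s ≡ true
      unique {s} s∈ with sum s ≡ᵇ sum B in eq
      ... | false = refl
      ... | true with R′ , q ← ∈subs⇒↭ lam s∈ = distinctᵇ⁺ (Unique-resp-↭ (↭-sym (sum-determines s R′ B (A ++ R) q B-sub (≡ᵇ-true⁻ eq))) u)

    distinctRep⁻ : distinctRep lam (sum B) ≡ true → Unique B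
    distinctRep⁻ h with B′ , B′∈ , e ← ↭⇒∈subs lam B (A ++ R) B-sub =
      Unique-resp-↭ e (distinctᵇ⁻ (simplify (all-true⁻ (proj₂ (∧-true⁻ {any (λ s → sum s ≡ᵇ sum B) (subs lam)} h)) B′∈)))
      where
      simplify : not (sum B′ ≡ᵇ sum B) ∨ distinctᵇ B′ ≡ true → distinctᵇ B′ ≡ true
      simplify rewrite ≡ᵇ-true⁺ (sum-↭ e) = id

  -- Descent sets with nonzero contribution

  distinctChain : ℕ → List ℕ → Bool
  distinctChain t [] = t ≡ᵇ L
  distinctChain t (d ∷ E) = ((t ⊑ᵇ d) ∧ distinctRep lam (d ∸ t)) ∧ distinctChain d E

  -- The signs of the differences multiply, and a chain that reaches the top uses up the remaining
  -- parts `R`; so the sign depends on their number and not on the chain. At the end positivity of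
  -- the parts turns a remainder of sum 0 into the empty one.
  μ-chain≡ : ∀ {t A R} E → A ++ R ↭ lam → sum A ≡ t → μ-chain t E ≡ sgn (length R) * 𝟙 (distinctChain t E)
  μ-chain≡ {t} {A} {R} [] p e with t ≡ᵇ L in eq
  ... | false = sym (ℤₚ.*-zeroʳ (sgn (length R)))
  ... | true = cong (λ R → sgn (length R) * 1ℤ) (sym R≡[])
    where
    R≡[] : R ≡ []
    R≡[] = sum≡0⇒[] (All.tabulate (λ x∈ → All.lookup positive (Permₚ.∈-resp-↭ p (∈-++⁺ʳ A x∈))))
      (ℕₚ.+-cancelˡ-≡ (sum A) _ _ (trans (sym (sum-++ A R)) (trans (sum-↭ p) (trans (sym (≡ᵇ-true⁻ eq)) (trans (sym e) (sym (ℕₚ.+-identityʳ (sum A))))))))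
  μ-chain≡ {t} {A} {R} (d ∷ E) p e = split (t ⊑ᵇ d) refl
    where
    zero-left : ∀ {b} → μ t d ≡ 0ℤ → b ≡ false → μ t d * μ-chain d E ≡ sgn (length R) * 𝟙 (b ∧ distinctChain d E)
    zero-left e refl = trans (cong (_* μ-chain d E) e) (sym (ℤₚ.*-zeroʳ (sgn (length R))))

    main : ∀ B R′ → R ↭ B ++ R′ → t + sum B ≡ d → ∀ b → distinctRep lam (d ∸ t) ≡ b →
      μ t d * μ-chain d E ≡ sgn (length R) * 𝟙 (b ∧ distinctChain d E)
    main B R′ q eB = λ where
        false h → zero-left (μ-repeated {A = A} {B} {R′} whole e eB
          (λ u → case trans (sym h) (trans (cong (distinctRep lam) gap) (distinctRep⁺ {A} {B} {R′} whole u)) of λ ())) refl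
        true h → begin
          μ t d * μ-chain d E
            ≡⟨ cong₂ _*_ (μ-distinct {A = A} {B} {R′} whole e eB (distinctRep⁻ {A} {B} {R′} whole (trans (cong (distinctRep lam) (sym gap)) h)))
                 (μ-chain≡ {A = A ++ B} {R′} E (subst (_↭ lam) (sym (Listₚ.++-assoc A B R′)) whole) (trans (sum-++ A B) (trans (cong (_+ sum B) e) eB))) ⟩
          sgn (length B) * (sgn (length R′) * 𝟙 (distinctChain d E))
            ≡⟨ ℤₚ.*-assoc (sgn (length B)) _ _ ⟨
          sgn (length B) * sgn (length R′) * 𝟙 (distinctChain d E)
            ≡⟨ cong (_* 𝟙 (distinctChain d E)) (sgn-+ (length B) (length R′)) ⟨
          sgn (length B + length R′) * 𝟙 (distinctChain d E)
            ≡⟨ cong (λ l → sgn l * 𝟙 (distinctChain d E)) (trans (sym (Listₚ.length-++ B)) (sym (Permₚ.↭-length q))) ⟩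
          sgn (length R) * 𝟙 (distinctChain d E) ∎
      where
      open ≡-Reasoning
      whole : A ++ B ++ R′ ↭ lam
      whole = ↭-trans (Permₚ.++⁺ˡ A (↭-sym q)) p
      gap : d ∸ t ≡ sum B
      gap = trans (cong (_∸ t) (sym eB)) (ℕₚ.m+n∸m≡n t (sum B))

    split : ∀ b → (t ⊑ᵇ d) ≡ b → μ t d * μ-chain d E ≡ sgn (length R) * 𝟙 ((b ∧ distinctRep lam (d ∸ t)) ∧ distinctChain d E)
    split false h = zero-left (μ-⋢ (λ t⊑d → case trans (sym h) (⊑⁺ t⊑d) of λ ())) refl
    split true h with B , R′ , q , eB ← ⊑-from {A = A} {R} p e (⊑⁻ h) = main B R′ q eB (distinctRep lam (d ∸ t)) refl

  distinctChain-below : ∀ t E → t < L → All (_< L) E → distinctChain t E ≡ false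
  distinctChain-below t [] t<L [] = ≡ᵇ-false⁺ (ℕₚ.<⇒≢ t<L)
  distinctChain-below t (d ∷ E) _ (d<L ∷ b) = ¬true⇒false λ h →
    case trans (sym (distinctChain-below d E d<L b)) (proj₂ (∧-true⁻ {(t ⊑ᵇ d) ∧ distinctRep lam (d ∸ t)} h)) of λ ()

  admissible : ℕ → List ℕ → Bool
  admissible t cs = chainᵇ t cs ∧ all (distinctRep lam) cs

  𝟙-admissible-∷ : ∀ t c cs → 𝟙 (admissible t (c ∷ cs)) ≡ 𝟙 ((t ⊑ᵇ (t + c)) ∧ distinctRep lam c) * 𝟙 (admissible (t + c) cs)
  𝟙-admissible-∷ t c cs with t ⊑ᵇ (t + c) | chainᵇ (t + c) cs | distinctRep lam c
  ... | false | _ | _ = refl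
  ... | true | false | b = sym (ℤₚ.*-zeroʳ (𝟙 b))
  ... | true | true | true = sym (ℤₚ.*-identityˡ _)
  ... | true | true | false = refl

  -- A set E of partial sums comes from exactly one composition.
  ∑-compsF : ∀ f s t E → s ≤ f → t + s ≡ L → Increasing t E →
    ∑ (compsF f s) (λ cs → 𝟙 (admissible t cs) * 𝟙 (E ≡ᴸ psums t cs)) ≡ 𝟙 (distinctChain t E)
  ∑-compsF-empty : ∀ t E → t ≡ L → Increasing t E →
    𝟙 (admissible t []) * 𝟙 (E ≡ᴸ psums t []) +ᶻ 0ℤ ≡ 𝟙 (distinctChain t E)
  ∑-compsF-empty t [] refl _ rewrite ≡ᵇ-refl L = refl
  ∑-compsF-empty t (d ∷ E) refl (t<d , _) = sym (cong (λ b → 𝟙 ((b ∧ distinctRep lam (d ∸ t)) ∧ distinctChain d E))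
    (¬true⇒false λ h → ℕₚ.<⇒≱ t<d (Sum-≤ (⊑-upper (⊑⁻ h)))))
  ∑-compsF zero zero t E _ e inc = ∑-compsF-empty t E (trans (sym (ℕₚ.+-identityʳ t)) e) inc
  ∑-compsF (suc f) zero t E _ e inc = ∑-compsF-empty t E (trans (sym (ℕₚ.+-identityʳ t)) e) inc
  ∑-compsF (suc f) (suc s) t E (s≤s s≤f) e inc = begin
    ∑ (compsF (suc f) (suc s)) F
      ≡⟨ ∑-concatMap (λ a → map (suc a ∷_) (compsF f (s ∸ a))) (upTo (suc s)) F ⟩
    ∑ (upTo (suc s)) (λ a → ∑ (map (suc a ∷_) (compsF f (s ∸ a))) F)
      ≡⟨ ∑-cong (upTo (suc s)) (λ {a} _ → ∑-map (suc a ∷_) (compsF f (s ∸ a)) F) ⟩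
    ∑ (upTo (suc s)) (λ a → ∑ (compsF f (s ∸ a)) (λ cs → F (suc a ∷ cs)))
      ≡⟨ cases E inc ⟩
    𝟙 (distinctChain t E) ∎
    where
    open ≡-Reasoning
    F : List ℕ → ℤ
    F cs = 𝟙 (admissible t cs) * 𝟙 (E ≡ᴸ psums t cs)
    t<L : t < L
    t<L = subst (t <_) e (ℕₚ.m<m+n t (s≤s z≤n))
    cases : ∀ E → Increasing t E →
      ∑ (upTo (suc s)) (λ a → ∑ (compsF f (s ∸ a)) (λ cs → 𝟙 (admissible t (suc a ∷ cs)) * 𝟙 (E ≡ᴸ psums t (suc a ∷ cs))))
        ≡ 𝟙 (distinctChain t E)
    cases [] _ = trans (∑-zero (upTo (suc s)) λ {a} _ → ∑-zero (compsF f (s ∸ a)) λ {cs} _ → ℤₚ.*-zeroʳ (𝟙 (admissible t (suc a ∷ cs))))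
      (cong 𝟙 (sym (≡ᵇ-false⁺ (ℕₚ.<⇒≢ t<L))))
    cases (d ∷ E) (t<d , inc) = begin
      ∑ (upTo (suc s)) (λ a → ∑ (compsF f (s ∸ a)) (λ cs → 𝟙 (admissible t (suc a ∷ cs)) * 𝟙 ((d ∷ E) ≡ᴸ psums t (suc a ∷ cs))))
        ≡⟨ ∑-cong (upTo (suc s)) (λ {a} a∈ → inner a (ℕₚ.≤-pred (∈-upTo⁻ a∈))) ⟩
      ∑ (upTo (suc s)) (λ a → 𝟙 (d ≡ᵇ t + suc a) * 𝟙 (distinctChain t (d ∷ E)))
        ≡⟨ collect (ℕₚ.<-≤-connex L d) ⟩
      𝟙 (distinctChain t (d ∷ E)) ∎
      where
      inner : ∀ a → a ≤ s → ∑ (compsF f (s ∸ a)) (λ cs → 𝟙 (admissible t (suc a ∷ cs)) * 𝟙 ((d ∷ E) ≡ᴸ psums t (suc a ∷ cs)))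
        ≡ 𝟙 (d ≡ᵇ t + suc a) * 𝟙 (distinctChain t (d ∷ E))
      inner a a≤s with d ≡ᵇ t + suc a in eq
      ... | false = ∑-zero (compsF f (s ∸ a)) λ {cs} _ → ℤₚ.*-zeroʳ (𝟙 (admissible t (suc a ∷ cs)))
      ... | true with refl ← ≡ᵇ-true⁻ {d} {t + suc a} eq = begin
        ∑ (compsF f (s ∸ a)) (λ cs → 𝟙 (admissible t (suc a ∷ cs)) * 𝟙 (E ≡ᴸ psums (t + suc a) cs))
          ≡⟨ ∑-cong (compsF f (s ∸ a)) (λ {cs} _ → trans (cong (_* 𝟙 (E ≡ᴸ psums d cs)) (𝟙-admissible-∷ t (suc a) cs)) (ℤₚ.*-assoc k _ _)) ⟩
        ∑ (compsF f (s ∸ a)) (λ cs → k * (𝟙 (admissible d cs) * 𝟙 (E ≡ᴸ psums d cs)))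
          ≡⟨ ∑-*ˡ k (compsF f (s ∸ a)) _ ⟩
        k * ∑ (compsF f (s ∸ a)) (λ cs → 𝟙 (admissible d cs) * 𝟙 (E ≡ᴸ psums d cs))
          ≡⟨ cong (k *_) (∑-compsF f (s ∸ a) d E (ℕₚ.≤-trans (ℕₚ.m∸n≤m s a) s≤f) total inc) ⟩
        k * 𝟙 (distinctChain d E)
          ≡⟨ 𝟙-∧ _ (distinctChain d E) ⟨
        𝟙 (((t ⊑ᵇ d) ∧ distinctRep lam (suc a)) ∧ distinctChain d E)
          ≡⟨ cong (λ c → 𝟙 (((t ⊑ᵇ d) ∧ distinctRep lam c) ∧ distinctChain d E)) (ℕₚ.m+n∸m≡n t (suc a)) ⟨
        𝟙 (distinctChain t (d ∷ E))
          ≡⟨ ℤₚ.*-identityˡ _ ⟨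
        1ℤ * 𝟙 (distinctChain t (d ∷ E)) ∎
        where
        k = 𝟙 ((t ⊑ᵇ d) ∧ distinctRep lam (suc a))
        total : t + suc a + (s ∸ a) ≡ L
        total = trans (ℕₚ.+-assoc t (suc a) (s ∸ a)) (trans (cong (λ x → t + suc x) (ℕₚ.m+[n∸m]≡n a≤s)) e)
      collect : L < d ⊎ d ≤ L → ∑ (upTo (suc s)) (λ a → 𝟙 (d ≡ᵇ t + suc a) * 𝟙 (distinctChain t (d ∷ E))) ≡ 𝟙 (distinctChain t (d ∷ E))
      collect (inj₁ L<d) = trans (∑-zero (upTo (suc s)) λ {a} _ → trans (cong (𝟙 (d ≡ᵇ t + suc a) *_) zero-chain) (ℤₚ.*-zeroʳ (𝟙 (d ≡ᵇ t + suc a)))) (sym zero-chain)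
        where
        zero-chain : 𝟙 (distinctChain t (d ∷ E)) ≡ 0ℤ
        zero-chain = cong (λ b → 𝟙 ((b ∧ distinctRep lam (d ∸ t)) ∧ distinctChain d E))
          (¬true⇒false λ h → ℕₚ.<⇒≱ L<d (Sum-≤ (⊑-upper (⊑⁻ h))))
      collect (inj₂ d≤L) = trans
        (∑-single (λ a → 𝟙 (d ≡ᵇ t + suc a) * 𝟙 (distinctChain t (d ∷ E))) (Uniqueₚ.upTo⁺ (suc s)) (∈-upTo⁺ a₀<)
          (λ {a} _ a≢ → cong (λ b → 𝟙 b * 𝟙 (distinctChain t (d ∷ E))) (≡ᵇ-false⁺ {d} {t + suc a} λ d≡ → a≢ (ℕₚ.suc-injective (ℕₚ.+-cancelˡ-≡ t _ _ (trans (sym d≡) d≡a₀))))))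
        (trans (cong (λ b → 𝟙 b * 𝟙 (distinctChain t (d ∷ E))) (≡ᵇ-true⁺ d≡a₀)) (ℤₚ.*-identityˡ _))
        where
        a₀ = d ∸ suc t
        d≡a₀ : d ≡ t + suc a₀
        d≡a₀ = trans (sym (ℕₚ.m+[n∸m]≡n t<d)) (sym (ℕₚ.+-suc t a₀))
        a₀< : a₀ < suc s
        a₀< = ℕₚ.+-cancelˡ-≤ t _ _ (subst₂ _≤_ d≡a₀ (sym e) d≤L)

  -- The sum over permutations and the composition set `V`

  filterTerm : ℕ → PIP → ℤ
  filterTerm m p = sgn (length (proj₁ p)) * 𝟙 (inFilter (lam , m) p)

  filterTerm-symmetric : ∀ m → SymmetricP (filterTerm m)
  filterTerm-symmetric m z q = cong₂ (λ l b → sgn l * 𝟙 b) (Permₚ.↭-length q) (inFilter-congʳ (lam , m) z q)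

  Φ-filterTerm : ∀ m a w → suc (length w) ≡ L + m →
    Φ (filterTerm m) (a ∷ w) ≡ sgn (length lam) * 𝟙 (distinctChain 0 (descents (a ∷ w)))
  Φ-filterTerm m a w len = begin
    barSum (filterTerm m) 1 a w
      ≡⟨ barSum-cong-valid (λ c z pos total → trans (cong (λ b → sgn (length c) * 𝟙 b) (inFilter≡chain m pos total)) (sym (chain≡ 0 c z))) 1 a w (s≤s z≤n) len ⟩
    barSum (chain 0) 1 a w
      ≡⟨ barSum-walk 0 1 a w ⟩
    walk 0 1 a w
      ≡⟨ walk-μ a w (mkSum [] lam ↭-refl refl) (subst (L ≤_) (sym len) (ℕₚ.m≤m+n L m)) ⟩
    μ-chain 0 (descents (a ∷ w))
      ≡⟨ μ-chain≡ {A = []} (descents (a ∷ w)) ↭-refl refl ⟩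
    sgn (length lam) * 𝟙 (distinctChain 0 (descents (a ∷ w))) ∎
    where open ≡-Reasoning

  β≡ : ∀ n cs m → + β n (cs , suc m) ≡ ∑ (perms n) (λ w → 𝟙 (descents w ≡ᴸ psums 0 cs))
  β≡ n [] m = length-filterᵇ _ (perms n)
  β≡ n (c ∷ cs) m = length-filterᵇ _ (perms n)

  perm-shape : ∀ n {w} → w ∈ perms (suc n) → ∃[ a ] ∃[ v ] w ≡ a ∷ v × length v ≡ n
  perm-shape n {w} w∈ with w | proj₁ (∈-perms⁻ (suc n) w∈)
  ... | a ∷ v | l = a , v , refl , ℕₚ.suc-injective l

  -- For m > 0 each descent set comes from one composition. For m = 0 both sides are 0: β vanishes
  -- by convention, and a chain would have to end at `L` = n + 1, which is beyond the last possible
  -- descent.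
  ∑-β : ∀ n m → suc n ≡ L + m → ∑ (comps L) (λ cs → 𝟙 (admissible 0 cs) * + β (suc n) (cs , m)) ≡
    ∑ (perms (suc n)) (λ w → 𝟙 (distinctChain 0 (descents w)))
  ∑-β n zero total = trans (∑-zero (comps L) left) (sym (∑-zero (perms (suc n)) right))
    where
    L≡ : suc n ≡ L
    L≡ = trans total (ℕₚ.+-identityʳ L)
    left : ∀ {cs} → cs ∈ comps L → 𝟙 (admissible 0 cs) * + β (suc n) (cs , 0) ≡ 0ℤ
    -- β is 1 at the empty composition with pointed part 0, but that composition has sum 0 whereas
    -- `L` is positive.
    left {[]} cs∈ with () ← trans (proj₂ (∈-compsF L L ℕₚ.≤-refl cs∈)) (sym L≡)
    left {c ∷ cs} _ = ℤₚ.*-zeroʳ (𝟙 (admissible 0 (c ∷ cs)))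
    right : ∀ {w} → w ∈ perms (suc n) → 𝟙 (distinctChain 0 (descents w)) ≡ 0ℤ
    right w∈ with a , v , refl , l ← perm-shape n w∈ = cong 𝟙 (distinctChain-below 0 (descents (a ∷ v))
      (subst (0 <_) L≡ (s≤s z≤n)) (subst (λ k → All (_< k) (descents (a ∷ v))) (trans (cong suc l) L≡) (desFrom-< 1 a v)))
  ∑-β n (suc m) total = begin
    ∑ (comps L) (λ cs → 𝟙 (admissible 0 cs) * + β (suc n) (cs , suc m))
      ≡⟨ ∑-cong (comps L) (λ {cs} _ → trans (cong (𝟙 (admissible 0 cs) *_) (β≡ (suc n) cs m)) (sym (∑-*ˡ (𝟙 (admissible 0 cs)) (perms (suc n)) _))) ⟩
    ∑ (comps L) (λ cs → ∑ (perms (suc n)) (λ w → 𝟙 (admissible 0 cs) * 𝟙 (descents w ≡ᴸ psums 0 cs)))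
      ≡⟨ ∑-swap (comps L) (perms (suc n)) _ ⟩
    ∑ (perms (suc n)) (λ w → ∑ (comps L) (λ cs → 𝟙 (admissible 0 cs) * 𝟙 (descents w ≡ᴸ psums 0 cs)))
      ≡⟨ ∑-cong (perms (suc n)) inner ⟩
    ∑ (perms (suc n)) (λ w → 𝟙 (distinctChain 0 (descents w))) ∎
    where
    open ≡-Reasoning
    inner : ∀ {w} → w ∈ perms (suc n) →
      ∑ (comps L) (λ cs → 𝟙 (admissible 0 cs) * 𝟙 (descents w ≡ᴸ psums 0 cs)) ≡ 𝟙 (distinctChain 0 (descents w))
    inner w∈ with a , v , refl , _ ← perm-shape n w∈ =
      ∑-compsF L L 0 (descents (a ∷ v)) ℕₚ.≤-refl refl (desFrom-increasing 1 a v (s≤s z≤n))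

  ∑-V : ∀ n m → suc n ≡ L + m → + sum (map (β (suc n)) (V (suc n) lam m)) ≡ ∑ (perms (suc n)) (λ w → 𝟙 (distinctChain 0 (descents w)))
  ∑-V n m total = begin
    + sum (map (β (suc n)) (V (suc n) lam m))
      ≡⟨ sum-map (β (suc n)) (V (suc n) lam m) ⟩
    ∑ (filterᵇ inV (map (_, m) (comps (suc n ∸ m)))) (λ c → + β (suc n) c)
      ≡⟨ trans (∑-filterᵇ inV (map (_, m) (comps (suc n ∸ m))) _) (∑-map (_, m) (comps (suc n ∸ m)) _) ⟩
    ∑ (comps (suc n ∸ m)) (λ cs → 𝟙 (inV (cs , m)) * + β (suc n) (cs , m))
      ≡⟨ cong (λ k → ∑ (comps k) (λ cs → 𝟙 (inV (cs , m)) * + β (suc n) (cs , m))) (trans (cong (_∸ m) total) (ℕₚ.m+n∸n≡m L m)) ⟩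
    ∑ (comps L) (λ cs → 𝟙 (inV (cs , m)) * + β (suc n) (cs , m))
      ≡⟨ ∑-cong (comps L) (λ {cs} cs∈ → cong (λ b → 𝟙 (b ∧ all (distinctRep lam) cs) * + β (suc n) (cs , m)) (same cs∈)) ⟩
    ∑ (comps L) (λ cs → 𝟙 (admissible 0 cs) * + β (suc n) (cs , m))
      ≡⟨ ∑-β n m total ⟩
    ∑ (perms (suc n)) (λ w → 𝟙 (distinctChain 0 (descents w))) ∎
    where
    open ≡-Reasoning
    inV : PIP → Bool
    inV c = inFilter (lam , m) c ∧ all (distinctRep lam) (proj₁ c)
    same : ∀ {cs} → cs ∈ comps L → inFilter (lam , m) (cs , m) ≡ chainᵇ 0 cs
    same cs∈ with pos , s ← ∈-compsF L L ℕₚ.≤-refl cs∈ = inFilter≡chain m pos (cong (_+ m) s)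

-- The poset with adjoined minimum, and the conclusion

signedFactorial : ℕ → ℤ
signedFactorial k = sgn k * + (k !)

signedFactorial-suc : ∀ k → + suc k * signedFactorial k +ᶻ signedFactorial (suc k) ≡ 0ℤ
signedFactorial-suc k = trans (cong (λ f → + suc k * signedFactorial k +ᶻ (-ᶻ 1ℤ * sgn k) * f) (ℤₚ.pos-* (suc k) (k !)))
  (lemma (+ suc k) (sgn k) (+ (k !)))
  where
  lemma : ∀ s g f → s * (g * f) +ᶻ (-ᶻ 1ℤ * g) * (s * f) ≡ 0ℤ
  lemma = solve-∀

module PosetSums (lam : List ℕ) (m n : ℕ) (total : sum lam + m ≡ n) where

  elems : List (Maybe (List ℕ))
  elems = ΠF0-elems n (lam , m)

  inF : List ℕ → Bool
  inF w = inFilter (lam , m) (typeP w)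

  just∈⁻ : ∀ {w} → just w ∈ elems → w ∈ rgs n 0 × inF w ≡ true
  just∈⁻ (there w∈) with _ , v∈ , refl ← ∈-map⁻ just w∈ = ∈-filterᵇ⁻ inF {rgs n 0} v∈

  same-length : ∀ {w v} → just w ∈ elems → just v ∈ elems → length w ≡ length v
  same-length w∈ v∈ = trans (proj₁ (∈-rgs⁻ n (proj₁ (just∈⁻ w∈)))) (sym (proj₁ (∈-rgs⁻ n (proj₁ (just∈⁻ v∈)))))

  eq⇒≡ : ∀ {x y} → ΠF0-eq x y ≡ true → x ≡ y
  eq⇒≡ {nothing} {nothing} _ = refl
  eq⇒≡ {just w} {just v} h = cong just (≡ᴸ-true⁻ h)

  eq-refl : ∀ x → ΠF0-eq x x ≡ true
  eq-refl nothing = refl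
  eq-refl (just w) = ≡ᴸ-refl w

  leq-refl : ∀ {x} → x ∈ elems → ΠF0-leq x x ≡ true
  leq-refl {nothing} _ = refl
  leq-refl {just w} _ = refines⁺ (Coarsens-refl w)

  leq-trans : ∀ {x y z} → x ∈ elems → y ∈ elems → z ∈ elems → ΠF0-leq x y ≡ true → ΠF0-leq y z ≡ true → ΠF0-leq x z ≡ true
  leq-trans {nothing} _ _ _ _ _ = refl
  leq-trans {just x} {just y} {just z} x∈ y∈ z∈ p q =
    refines⁺ {x} {z} (Coarsens-trans {x} {y} {z} (refines⁻ (same-length x∈ y∈) p) (refines⁻ (same-length y∈ z∈) q))

  leq-antisym : ∀ {x y} → x ∈ elems → y ∈ elems → ΠF0-leq x y ≡ true → ΠF0-leq y x ≡ true → x ≡ y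
  leq-antisym {nothing} {nothing} _ _ _ _ = refl
  leq-antisym {just x} {just y} x∈ y∈ p q = cong just (Coarsens-antisym
    (proj₂ (∈-rgs⁻ n (proj₁ (just∈⁻ x∈)))) (proj₂ (∈-rgs⁻ n (proj₁ (just∈⁻ y∈))))
    (refines⁻ (same-length x∈ y∈) p) (refines⁻ (same-length y∈ x∈) q))

  elems-unique : Unique elems
  elems-unique = All.tabulate (λ { w∈ refl → case ∈-map⁻ just w∈ of λ () }) ∷
    Uniqueₚ.map⁺ just-injective (Uniqueₚ.filter⁺ (T? ∘ inF) (rgs-unique n 0))

  zeros∈ : ∀ k → replicate k 0 ∈ rgs k 0
  zeros∈ zero = here refl
  zeros∈ (suc k) = ∈-concatMap-map⁺ (λ a → rgs k (a ⊔ 0)) {upTo 2} (here refl) (zeros∈ k)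

  maxL-zeros : ∀ k → maxL (replicate k 0) ≡ 0
  maxL-zeros zero = refl
  maxL-zeros (suc k) = maxL-zeros k

  occ-zeros : ∀ k → occ 0 (replicate k 0) ≡ k
  occ-zeros zero = refl
  occ-zeros (suc k) = cong suc (occ-zeros k)

  top∈ : ΠF0-top n ∈ elems
  top∈ = there (∈-map⁺ just (∈-filter⁺ (T? ∘ inF) (zeros∈ n) (≡true⇒T
    (subst (λ p → inFilter (lam , m) p ≡ true) (sym (trans (typeP≡ (replicate n 0) (maxL-zeros n)) (cong ([] ,_) (occ-zeros n))))
      (inFilter⁺ {lam , m} [] (colouring-[] (trans (ℕₚ.+-comm m (sum lam)) total)))))))

  open FinitePoset ΠF0-leq ΠF0-eq elems eq⇒≡ eq-refl leq-refl leq-trans leq-antisym elems-unique nothing (here refl) (λ _ → refl)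

  -- The values μ(π, 1̂) in the whole poset of pointed partitions.
  dual : Maybe (List ℕ) → ℤ
  dual nothing = 0ℤ
  dual (just w) = signedFactorial (maxL w)

  ∑-elems : ∀ (f : Maybe (List ℕ) → ℤ) → f nothing ≡ 0ℤ → ∑ elems f ≡ ∑ (rgs n 0) (λ w → 𝟙 (inF w) * f (just w))
  ∑-elems f f0 = trans (cong₂ _+ᶻ_ f0 (trans (∑-map just (filterᵇ inF (rgs n 0)) f) (∑-filterᵇ inF (rgs n 0) (f ∘ just)))) (ℤₚ.+-identityˡ _)

  dual-inverse : ∀ {z} → z ∈ elems → z ≢ nothing → ∑ elems (λ y → 𝟙 (ΠF0-leq z y) * dual y) ≡ 𝟙 (ΠF0-eq z (ΠF0-top n))
  dual-inverse {nothing} _ z≢ = ⊥-elim (z≢ refl)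
  dual-inverse {just z} z∈ _ with z∈rgs , inFz ← just∈⁻ z∈ = begin
    ∑ elems (λ y → 𝟙 (ΠF0-leq (just z) y) * dual y)
      ≡⟨ ∑-elems (λ y → 𝟙 (ΠF0-leq (just z) y) * dual y) refl ⟩
    ∑ (rgs n 0) (λ y → 𝟙 (inF y) * (𝟙 (refines z y) * signedFactorial (maxL y)))
      ≡⟨ ∑-cong (rgs n 0) drop ⟩
    ∑ (rgs n 0) (λ y → 𝟙 (refines z y) * signedFactorial (maxL y))
      ≡⟨ ∑-refines signedFactorial signedFactorial-suc n z∈rgs ⟩
    𝟙 (z ≡ᴸ replicate n 0) * 1ℤ
      ≡⟨ ℤₚ.*-identityʳ _ ⟩
    𝟙 (z ≡ᴸ replicate n 0) ∎
    where
    open ≡-Reasoning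
    -- Whatever lies above `z` is in the filter with `z`, so the restriction to the filter can be
    -- lifted and the sum taken over all pointed partitions.
    drop : ∀ {y} → y ∈ rgs n 0 → 𝟙 (inF y) * (𝟙 (refines z y) * signedFactorial (maxL y)) ≡ 𝟙 (refines z y) * signedFactorial (maxL y)
    drop {y} y∈ with refines z y in r
    ... | false = ℤₚ.*-zeroʳ (𝟙 (inF y))
    ... | true with l , ry ← ∈-rgs⁻ n y∈
      rewrite inFilter-upward {lam , m} {z} {y} ry (refines⁻ (trans (proj₁ (∈-rgs⁻ n z∈rgs)) (sym l)) r) inFz = ℤₚ.*-identityˡ _

  μΠF-dual : μΠF n (lam , m) ≡ -ᶻ ∑ (rgs n 0) (λ w → 𝟙 (inF w) * signedFactorial (maxL w))
  μΠF-dual = trans (M-top (ΠF0-top n) top∈ dual refl dual-inverse (λ ())) (cong -ᶻ_ (∑-elems dual refl))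

theorem4p5 : ∀ (n : ℕ) (lam : List ℕ) (m : ℕ)
    → All (λ x → 0 < x) lam
    → sum lam + m ≡ n
    → Knapsack lam
    → μΠF n (lam , m) ≡ signPm1 (length lam) * (+ sum (map (β n) (V n lam m)))
-- The case n = 0 is computed: the poset has two elements, V consists of the empty composition, and
-- both sides are -1.
theorem4p5 zero [] zero _ _ _ = refl
theorem4p5 zero (suc x ∷ lam) m _ () _
theorem4p5 zero (zero ∷ lam) m (() ∷ _) _ _
theorem4p5 (suc n) lam m positive total knapsack = begin
  μΠF (suc n) (lam , m)
    ≡⟨ μΠF-dual ⟩
  -ᶻ ∑ (rgs (suc n) 0) (λ w → 𝟙 (inF w) * signedFactorial (maxL w))
    ≡⟨ cong -ᶻ_ (∑-cong (rgs (suc n) 0) (λ {w} _ → regroup w)) ⟩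
  -ᶻ ∑ (rgs (suc n) 0) (λ w → + (maxL w !) * filterTerm m (typeP w))
    -- The empty word, with 0! = 1 and type `([] , 0)`, starts the recursion for words where the one
    -- for permutations starts too.
    ≡⟨ cong -ᶻ_ (trans (∑-rgs-typeP (filterTerm m) (filterTerm-symmetric m) (suc n) [] refl) (ℤₚ.*-identityˡ _)) ⟩
  -ᶻ D^ (suc n) (filterTerm m) ([] , 0)
    ≡⟨ cong -ᶻ_ (∑-perms-Φ (suc n) (filterTerm m)) ⟨
  -ᶻ ∑ (perms (suc n)) (Φ (filterTerm m))
    ≡⟨ cong -ᶻ_ (trans (∑-cong (perms (suc n)) perm-term) (∑-*ˡ (sgn (length lam)) (perms (suc n)) _)) ⟩
  -ᶻ (sgn (length lam) * ∑ (perms (suc n)) (λ w → 𝟙 (distinctChain 0 (descents w))))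
    ≡⟨ ℤₚ.neg-distribˡ-* (sgn (length lam)) _ ⟩
  -ᶻ sgn (length lam) * ∑ (perms (suc n)) (λ w → 𝟙 (distinctChain 0 (descents w)))
    ≡⟨ cong (-ᶻ sgn (length lam) *_) (∑-V n m (sym total)) ⟨
  signPm1 (length lam) * (+ sum (map (β (suc n)) (V (suc n) lam m))) ∎
  where
  open ≡-Reasoning
  open PosetSums lam m (suc n) total
  open KnapsackChains lam positive knapsack

  regroup : ∀ w → 𝟙 (inF w) * signedFactorial (maxL w) ≡ + (maxL w !) * filterTerm m (typeP w)
  regroup w = trans (lemma (𝟙 (inF w)) (sgn (maxL w)) (+ (maxL w !))) (cong (λ l → + (maxL w !) * (sgn l * 𝟙 (inF w))) (sym blocks))
    where
    lemma : ∀ a s f → a * (s * f) ≡ f * (s * a)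
    lemma = solve-∀
    blocks : length (proj₁ (typeP w)) ≡ maxL w
    blocks = trans (cong (λ p → length (proj₁ p)) (typeP≡ w refl)) (Listₚ.length-applyUpTo _ (maxL w))

  perm-term : ∀ {w} → w ∈ perms (suc n) → Φ (filterTerm m) w ≡ sgn (length lam) * 𝟙 (distinctChain 0 (descents w))
  perm-term w∈ with a , v , refl , l ← perm-shape n w∈ = Φ-filterTerm m a v (trans (cong suc l) (sym total))
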